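{- The graded linear map $\mathsf{IG}(q^{ -1})\to\mathsf{cf}(\mathrm{UT}_\bullet)$ defined by $\mathrm{inc}(\pi)\mapsto\overline{\delta}_\pi$ for $\pi\in\mathcal{NO}_n$, $n\ge0$, is an injective Hopf algebra homomorphism.
   Context: Fix the finite field $\mathbb{F}_q$; $[n]=\{1,\dots,n\}$. $\mathrm{UT}_n$ is the group of $n\times n$ unipotent upper triangular matrices over $\mathbb{F}_q$. A natural unit interval order of $[n]$ is a partial order $\pi\subseteq[n]\times[n]$ (reflexive, antisymmetric, transitive relation) with $(i,j)\in\pi\Rightarrow i\le j$, such that for every $(j,k)\in\pi$ with $j\ne k$, all $(i,l)$ with $i\le j$ and $k\le l$ lie in $\pi$; $\mathcal{NO}_n$ is the set of these. For such $\pi$, $\mathrm{UT}(\pi)=\{g\in\mathrm{UT}_n:(g-1_n)_{i,j}\ne0\text{ only if }(i,j)\in\pi\}$ (a normal subgroup) and $\overline{\delta}_\pi\in\mathsf{cf}(\mathrm{UT}_n)$ is its indicator function. Hopf algebra $\mathsf{cf}(\mathrm{UT}_\bullet)=\bigoplus_n\mathsf{cf}(\mathrm{UT}_n)$ ($\mathsf{cf}$ = complex class functions): for $I\subseteq[n]$, $I^c=[n]\setminus I$, let $\mathrm{UL}_I=\{g\in\mathrm{UT}_n:(g-1_n)_{i,j}\ne0\text{ only if }(i,j)\in I\times I\cup I^c\times I^c\}$, $\mathrm{UR}_I=\{g:(g-1_n)_{i,j}\ne0\text{ only if }(i,j)\in I\times I^c\}$, $\mathrm{UP}_I=\{g:(g-1_n)_{i,j}=0\text{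 for }(i,j)\in I^c\times I\}=\mathrm{UL}_I\ltimes\mathrm{UR}_I$ ($\mathrm{UP}_{[i]}=\mathrm{UT}_n$). With $\mathrm{cano}_I:I\to[|I|]$ order-preserving, $\mathrm{UL}_I\cong\mathrm{UT}_{|I|}\times\mathrm{UT}_{|I^c|}$ by relabelling blocks, inducing $\mathrm{st}_{(I,I^c)}:\mathsf{cf}(\mathrm{UL}_I)\to\mathsf{cf}(\mathrm{UT}_{|I|})\otimes\mathsf{cf}(\mathrm{UT}_{|I^c|})$. Product $\mu=\bigoplus_{n\ge i\ge0}\mathrm{Inf}^{\mathrm{UT}_n}_{\mathrm{UL}_{[i]}}\circ\mathrm{st}^{ -1}_{([i],[i]^c)}$ with $\mathrm{Inf}\psi(lr)=\psi(l)$; coproduct $\Delta=\bigoplus_n\sum_{I\subseteq[n]}\mathrm{st}_{(I,I^c)}\circ\mathrm{Def}^{\mathrm{UP}_I}_{\mathrm{UL}_I}\circ\mathrm{Res}^{\mathrm{UT}_n}_{\mathrm{UP}_I}$ with $\mathrm{Def}\psi(g)=\frac1{|\mathrm{UR}_I|}\sum_{x\in\mathrm{UR}_I}\psi(gx)$. Guay-Paquet's Hopf algebra $\mathsf{IG}(t)=\bigoplus_n\mathsf{IG}_n(t)$ is the free graded $\mathbb{C}[t]$-module with basis $\{\mathrm{inc}(\pi):\pi\in\mathcal{NO}_n\}$ in degree $n$ (formal symbols for incomparability graphs). For $\pi\in\mathcal{NO}_n,\rho\in\mathcal{NO}_m$, the shifted ordinal sum is $\pi\star_n\rho=\pi\sqcup\rho'\sqcup([n]\times([n+m]\setminus[n]))$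 with $\rho'=\{(i+n,j+n):(i,j)\in\rho\}$. For $I\subseteq[n]$, $\pi|^{sh}_I=\{(\mathrm{cano}_I(i),\mathrm{cano}_I(j)):(i,j)\in\pi, i,j\in I\}\in\mathcal{NO}_{|I|}$, and $\mathrm{asc}_I(\pi)=|\{(i,j)\in I\times I^c: i<j,(i,j)\notin\pi\}|$. Product: $\mu(\mathrm{inc}(\pi)\otimes\mathrm{inc}(\rho))=\mathrm{inc}(\pi\star_n\rho)$; coproduct: $\Delta(\mathrm{inc}(\pi))=\sum_{I\subseteq[n]}t^{\mathrm{asc}_I(\pi)}\mathrm{inc}(\pi|^{sh}_I)\otimes\mathrm{inc}(\pi|^{sh}_{I^c})$, both $\mathbb{C}[t]$-linear; this is a graded connected $\mathbb{C}[t]$-Hopf algebra, and $\mathsf{IG}(q^{ -1})$ is the $\mathbb{C}$-Hopf algebra obtained by setting $t=q^{ -1}$. -}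

module Defs where

open import Algebra using (CommutativeRing; Group)
open import Algebra.Apartness using (HeytingField; HeytingCommutativeRing)
import Algebra.Construct.DirectProduct as DirectProduct
open import Algebra.Module using (LeftModule)
open import Algebra.Module.Morphism.Structures using (module LeftModuleMorphisms)
import Algebra.Module.Construct.TensorUnit as TensorUnit
import Algebra.Morphism.Structures as MorphismStructures
import Algebra.Properties.Group as GroupProperties
import Algebra.Properties.Ring as RingProperties
import Algebra.Properties.Semiring.Mult as Mult
import Algebra.Properties.CommutativeMonoid.Sum as CommutativeMonoidSum
import Algebra.Properties.Semiring.Sum as Sum
open import Data.Bool.Base using (Bool; true; false; if_then_else_)
import Data.Bool.Properties as Bool
open import Data.Fin.Base as Fin using (Fin; zero; suc; splitAt; _↑ˡ_; _↑ʳ_)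
import Data.Fin.Properties as Fin
open import Data.Fin.Permutation using (Permutation)
open import Data.Fin.Subset using (Subset; inside; outside; ∣_∣; ∁)
open import Data.List.Base as List
  using (List; []; _∷_; _++_; map; concatMap; cartesianProductWith; cartesianProduct; allFin; filter; length; foldr)
open import Data.Nat.Base as ℕ using (ℕ; zero; suc; NonZero)
import Data.Nat.Properties as ℕ
open import Data.Product.Base as Product using (Σ; ∃; _×_; _,_; proj₁; proj₂)
open import Data.Product.Relation.Binary.Pointwise.NonDependent using (×-setoid)
open import Data.Sum.Base as ⊎ using (_⊎_; inj₁; inj₂)
open import Data.Vec.Base using ([]; _∷_)
open import Data.Empty using (⊥; ⊥-elim)
open import Data.Unit.Base using (⊤; tt)
open import Function.Base using (_∘_; id)
open import Function.Bundles using (Inverse; _↔_; _⇔_; mk⇔; mk↔ₛ′; module Equivalence)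
import Function.Construct.Composition as Compose
import Function.Construct.Symmetry as Symmetry
open import Function.Definitions using (Injective)
open import Level using (_⊔_; 0ℓ) renaming (suc to lsuc)
open import Relation.Binary.Bundles using (Setoid; DecSetoid)
open import Relation.Binary.Core using (Rel)
open import Relation.Binary.Definitions using (Decidable)
open import Relation.Binary.Structures using (IsDecPartialOrder)
open import Relation.Binary.PropositionalEquality as ≡ using (_≡_; _≢_)
import Relation.Binary.Reasoning.Setoid as SetoidReasoning
open import Relation.Nullary using (¬_; Dec; yes; no; does; contradiction)
open import Relation.Nullary.Decidable using (_×-dec_; _→-dec_; ¬?; does-⇔; map′)

module LinearAlgebra {r ℓr} (R : CommutativeRing r ℓr) where

  open CommutativeRing R renaming (Carrier to Scalar)
  private module S = SetoidReasoning

  R-module : LeftModule ring r ℓr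
  R-module = TensorUnit.leftModule

  module _ {m ℓ} (M : LeftModule ring m ℓ) where
    open LeftModule M

    minus-one : ∀ x → ((- 1#) *ₗ x) +ᴹ x ≈ᴹ 0ᴹ
    minus-one x = begin
      ((- 1#) *ₗ x) +ᴹ x           ≈⟨ +ᴹ-congˡ (*ₗ-identityˡ x) ⟨
      ((- 1#) *ₗ x) +ᴹ (1# *ₗ x)   ≈⟨ *ₗ-distribʳ x (- 1#) 1# ⟨
      (- 1# + 1#) *ₗ x             ≈⟨ *ₗ-cong (-‿inverseˡ 1#) ≈ᴹ-refl ⟩
      0# *ₗ x                      ≈⟨ *ₗ-zeroˡ x ⟩
      0ᴹ                           ∎
      where open S ≈ᴹ-setoid

  -- Finite formal sums of scaled generators; two sums are identified when
  -- a family of module-valued functionals cannot tell them apart.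
  module FormalSums
    {x i n ℓ} (X : Set x) (_·_ : Scalar → X → X)
    (I : Set i) (N : I → LeftModule ring n ℓ)
    (ev : ∀ k → X → LeftModule.Carrierᴹ (N k))
    (ev-· : ∀ k s y → LeftModule._≈ᴹ_ (N k) (ev k (s · y)) (LeftModule._*ₗ_ (N k) s (ev k y)))
    where

    private module N k = LeftModule (N k)

    total : ∀ k → List X → N.Carrierᴹ k
    total k []       = N.0ᴹ k
    total k (y ∷ ys) = N._+ᴹ_ k (ev k y) (total k ys)

    total-++ : ∀ k xs ys → N._≈ᴹ_ k (total k (xs ++ ys)) (N._+ᴹ_ k (total k xs) (total k ys))
    total-++ k []       ys = N.≈ᴹ-sym k (N.+ᴹ-identityˡ k _)
    total-++ k (x ∷ xs) ys = N.≈ᴹ-trans k (N.+ᴹ-congˡ k (total-++ k xs ys)) (N.≈ᴹ-sym k (N.+ᴹ-assoc k _ _ _))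

    total-· : ∀ k s xs → N._≈ᴹ_ k (total k (map (s ·_) xs)) (N._*ₗ_ k s (total k xs))
    total-· k s []       = N.≈ᴹ-sym k (N.*ₗ-zeroʳ k s)
    total-· k s (x ∷ xs) = N.≈ᴹ-trans k (N.+ᴹ-cong k (ev-· k s x) (total-· k s xs)) (N.≈ᴹ-sym k (N.*ₗ-distribˡ k s _ _))

    infix 4 _≋_
    _≋_ : Rel (List X) (i ⊔ ℓ)
    xs ≋ ys = ∀ k → N._≈ᴹ_ k (total k xs) (total k ys)

    private
      via-++ : ∀ k xs ys {z} → N._≈ᴹ_ k (N._+ᴹ_ k (total k xs) (total k ys)) z → N._≈ᴹ_ k (total k (xs ++ ys)) z
      via-++ k xs ys = N.≈ᴹ-trans k (total-++ k xs ys)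

      via-· : ∀ k s xs {z} → N._≈ᴹ_ k (N._*ₗ_ k s (total k xs)) z → N._≈ᴹ_ k (total k (map (s ·_) xs)) z
      via-· k s xs = N.≈ᴹ-trans k (total-· k s xs)

    leftModule : LeftModule ring x (i ⊔ ℓ)
    leftModule = record
      { Carrierᴹ = List X
      ; _≈ᴹ_ = _≋_
      ; _+ᴹ_ = _++_
      ; _*ₗ_ = λ s → map (s ·_)
      ; 0ᴹ = []
      ; -ᴹ_ = map ((- 1#) ·_)
      ; isLeftModule = record
        { isLeftSemimodule = record
          { +ᴹ-isCommutativeMonoid = record
            { isMonoid = record
              { isSemigroup = record
                { isMagma = record
                  { isEquivalence = record
                    { refl = λ k → N.≈ᴹ-refl k
                    ; sym = λ p k → N.≈ᴹ-sym k (p k)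
                    ; trans = λ p q k → N.≈ᴹ-trans k (p k) (q k)
                    }
                  ; ∙-cong = λ {xs} {xs′} {ys} {ys′} p q k →
                      via-++ k xs ys (N.≈ᴹ-trans k (N.+ᴹ-cong k (p k) (q k)) (N.≈ᴹ-sym k (total-++ k xs′ ys′)))
                  }
                ; assoc = λ xs ys zs k → via-++ k (xs ++ ys) zs
                    (N.≈ᴹ-trans k (N.+ᴹ-congʳ k (total-++ k xs ys)) (N.≈ᴹ-trans k (N.+ᴹ-assoc k _ _ _)
                      (N.≈ᴹ-sym k (via-++ k xs (ys ++ zs) (N.+ᴹ-congˡ k (total-++ k ys zs))))))
                }
              ; identity = (λ xs k → N.≈ᴹ-refl k) , (λ xs k → via-++ k xs [] (N.+ᴹ-identityʳ k _))
              }
            ; comm = λ xs ys k → via-++ k xs ys (N.≈ᴹ-trans k (N.+ᴹ-comm k _ _) (N.≈ᴹ-sym k (total-++ k ys xs)))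
            }
          ; isPreleftSemimodule = record
            { *ₗ-cong = λ {s} {s′} {xs} {ys} p q k →
                via-· k s xs (N.≈ᴹ-trans k (N.*ₗ-cong k p (q k)) (N.≈ᴹ-sym k (total-· k s′ ys)))
            ; *ₗ-zeroˡ = λ xs k → via-· k 0# xs (N.*ₗ-zeroˡ k _)
            ; *ₗ-distribʳ = λ xs s s′ k → via-· k (s + s′) xs (N.≈ᴹ-trans k (N.*ₗ-distribʳ k _ s s′)
                (N.≈ᴹ-sym k (via-++ k (map (s ·_) xs) (map (s′ ·_) xs) (N.+ᴹ-cong k (total-· k s xs) (total-· k s′ xs)))))
            ; *ₗ-identityˡ = λ xs k → via-· k 1# xs (N.*ₗ-identityˡ k _)
            ; *ₗ-assoc = λ s s′ xs k → via-· k (s * s′) xs (N.≈ᴹ-trans k (N.*ₗ-assoc k s s′ _)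
                (N.≈ᴹ-sym k (via-· k s (map (s′ ·_) xs) (N.*ₗ-congˡ k (total-· k s′ xs)))))
            ; *ₗ-zeroʳ = λ s k → N.≈ᴹ-refl k
            ; *ₗ-distribˡ = λ s xs ys k → via-· k s (xs ++ ys) (N.≈ᴹ-trans k (N.*ₗ-congˡ k (total-++ k xs ys))
                (N.≈ᴹ-trans k (N.*ₗ-distribˡ k s _ _)
                  (N.≈ᴹ-sym k (via-++ k (map (s ·_) xs) (map (s ·_) ys) (N.+ᴹ-cong k (total-· k s xs) (total-· k s ys))))))
            }
          }
        ; -ᴹ‿cong = λ {xs} {ys} p k → via-· k (- 1#) xs
            (N.≈ᴹ-trans k (N.*ₗ-congˡ k (p k)) (N.≈ᴹ-sym k (total-· k (- 1#) ys)))
        ; -ᴹ‿inverse = (λ xs k → inverseˡ xs k)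
                     , (λ xs k → via-++ k xs (map ((- 1#) ·_) xs) (N.≈ᴹ-trans k (N.+ᴹ-comm k _ _)
                         (N.≈ᴹ-trans k (N.≈ᴹ-sym k (total-++ k (map ((- 1#) ·_) xs) xs)) (inverseˡ xs k))))
        }
      }
      where
      inverseˡ : ∀ xs k → N._≈ᴹ_ k (total k (map ((- 1#) ·_) xs ++ xs)) (N.0ᴹ k)
      inverseˡ xs k = via-++ k (map ((- 1#) ·_) xs) xs
        (N.≈ᴹ-trans k (N.+ᴹ-congʳ k (total-· k (- 1#) xs)) (minus-one (N k) _))

  module _ {b ℓb} (B : DecSetoid b ℓb) where
    private module B = DecSetoid B

    coefficientOf : B.Carrier → Scalar × B.Carrier → Scalar
    coefficientOf β (s , β′) = if does (β′ B.≟ β) then s else 0#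

    private
      coefficient-· : ∀ β s y → coefficientOf β (Product.map₁ (s *_) y) ≈ s * coefficientOf β y
      coefficient-· β s (s′ , β′) with does (β′ B.≟ β)
      ... | true  = refl
      ... | false = sym (zeroʳ s)

    Free : LeftModule ring (r ⊔ b) (ℓr ⊔ b)
    Free = FormalSums.leftModule (Scalar × B.Carrier) (λ s → Product.map₁ (s *_))
             B.Carrier (λ _ → R-module) coefficientOf coefficient-·

  -- Elements of a direct sum are lists of homogeneous elements together with
  -- their degrees; equality is equality of all homogeneous components.
  module _ {m ℓ} (M : ℕ → LeftModule ring m ℓ) where
    private module M n = LeftModule (M n)

    Homogeneous : Set m
    Homogeneous = ∃ M.Carrierᴹ

    scale : Scalar → Homogeneous → Homogeneous
    scale s (n , x) = n , M._*ₗ_ n s x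

    component : ∀ n → Homogeneous → M.Carrierᴹ n
    component n (k , x) with k ℕ.≟ n
    ... | yes ≡.refl = x
    ... | no  _      = M.0ᴹ n

    private
      component-scale : ∀ n s y → M._≈ᴹ_ n (component n (scale s y)) (M._*ₗ_ n s (component n y))
      component-scale n s (k , x) with k ℕ.≟ n
      ... | yes ≡.refl = M.≈ᴹ-refl n
      ... | no  _      = M.≈ᴹ-sym n (M.*ₗ-zeroʳ n s)

    ⨁ : LeftModule ring m ℓ
    ⨁ = FormalSums.leftModule Homogeneous scale ℕ M component component-scale

    degreePart : ∀ n → LeftModule.Carrierᴹ ⨁ → M.Carrierᴹ n
    degreePart = FormalSums.total Homogeneous scale ℕ M component component-scale

    homogeneous : ∀ n → M.Carrierᴹ n → LeftModule.Carrierᴹ ⨁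
    homogeneous n x = List.[ n , x ]

  module _ {m₁ ℓ₁ m₂ ℓ₂} (M : LeftModule ring m₁ ℓ₁) (N : LeftModule ring m₂ ℓ₂) where
    private
      module M = LeftModule M
      module N = LeftModule N

    infixr 7 _⊗_
    Tensors : Set (m₁ ⊔ m₂)
    Tensors = List (M.Carrierᴹ × N.Carrierᴹ)

    scaleˡ : Scalar → M.Carrierᴹ × N.Carrierᴹ → M.Carrierᴹ × N.Carrierᴹ
    scaleˡ s = Product.map₁ (s M.*ₗ_)

    -- The congruence presenting M ⊗ N as a commutative monoid; it is a group
    -- since (- 1 · x) ⊗ y is inverse to x ⊗ y.
    data TensorEq : Rel Tensors (r ⊔ m₁ ⊔ m₂ ⊔ ℓ₁ ⊔ ℓ₂) where
      ⊗-refl     : ∀ {t} → TensorEq t t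
      ⊗-sym      : ∀ {t u} → TensorEq t u → TensorEq u t
      ⊗-trans    : ∀ {t u v} → TensorEq t u → TensorEq u v → TensorEq t v
      ⊗-cong     : ∀ {t t′ u u′} → TensorEq t t′ → TensorEq u u′ → TensorEq (t ++ u) (t′ ++ u′)
      ⊗-comm     : ∀ t u → TensorEq (t ++ u) (u ++ t)
      ⊗-pair     : ∀ {x x′ y y′} → x M.≈ᴹ x′ → y N.≈ᴹ y′ → TensorEq List.[ x , y ] List.[ x′ , y′ ]
      ⊗-distribʳ : ∀ x x′ y → TensorEq List.[ x M.+ᴹ x′ , y ] ((x , y) ∷ (x′ , y) ∷ [])
      ⊗-distribˡ : ∀ x y y′ → TensorEq List.[ x , y N.+ᴹ y′ ] ((x , y) ∷ (x , y′) ∷ [])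
      ⊗-balanced : ∀ s x y → TensorEq List.[ s M.*ₗ x , y ] List.[ x , s N.*ₗ y ]
      ⊗-zeroˡ    : ∀ y → TensorEq List.[ M.0ᴹ , y ] []

    private
      distrib-scale : ∀ s s′ x y → TensorEq List.[ (s + s′) M.*ₗ x , y ] ((s M.*ₗ x , y) ∷ (s′ M.*ₗ x , y) ∷ [])
      distrib-scale s s′ x y = ⊗-trans (⊗-pair (M.*ₗ-distribʳ x s s′) N.≈ᴹ-refl) (⊗-distribʳ _ _ _)

      termwise : ∀ {f g : M.Carrierᴹ × N.Carrierᴹ → M.Carrierᴹ × N.Carrierᴹ} →
                 (∀ p → TensorEq List.[ f p ] List.[ g p ]) → ∀ t → TensorEq (map f t) (map g t)
      termwise h []      = ⊗-refl
      termwise h (p ∷ t) = ⊗-cong (h p) (termwise h t)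

      scale-cong : ∀ s {t u} → TensorEq t u → TensorEq (map (scaleˡ s) t) (map (scaleˡ s) u)
      scale-cong s ⊗-refl             = ⊗-refl
      scale-cong s (⊗-sym p)          = ⊗-sym (scale-cong s p)
      scale-cong s (⊗-trans p q)      = ⊗-trans (scale-cong s p) (scale-cong s q)
      scale-cong s (⊗-cong {t} {t′} {u} {u′} p q) =
        ≡.subst₂ TensorEq (≡.sym (map-++ t u)) (≡.sym (map-++ t′ u′)) (⊗-cong (scale-cong s p) (scale-cong s q))
        where open import Data.List.Properties using () renaming (map-++ to map-++′)
              map-++ = map-++′ (scaleˡ s)
      scale-cong s (⊗-comm t u)    =
        ≡.subst₂ TensorEq (≡.sym (map-++ t u)) (≡.sym (map-++ u t)) (⊗-comm (map (scaleˡ s) t) (map (scaleˡ s) u))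
        where open import Data.List.Properties using () renaming (map-++ to map-++′)
              map-++ = map-++′ (scaleˡ s)
      scale-cong s (⊗-pair p q)       = ⊗-pair (M.*ₗ-congˡ p) q
      scale-cong s (⊗-distribʳ x x′ y) = ⊗-trans (⊗-pair (M.*ₗ-distribˡ s x x′) N.≈ᴹ-refl) (⊗-distribʳ _ _ _)
      scale-cong s (⊗-distribˡ x y y′) = ⊗-distribˡ _ _ _
      scale-cong s (⊗-balanced s′ x y) =
        ⊗-trans (⊗-pair (M.≈ᴹ-trans (M.≈ᴹ-sym (M.*ₗ-assoc s s′ x)) (M.≈ᴹ-trans (M.*ₗ-cong (*-comm s s′) M.≈ᴹ-refl) (M.*ₗ-assoc s′ s x))) N.≈ᴹ-refl)
              (⊗-balanced s′ (s M.*ₗ x) y)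
      scale-cong s (⊗-zeroˡ y)        = ⊗-trans (⊗-pair (M.*ₗ-zeroʳ s) N.≈ᴹ-refl) (⊗-zeroˡ y)

      interleave : ∀ s s′ t → TensorEq (map (scaleˡ (s + s′)) t) (map (scaleˡ s) t ++ map (scaleˡ s′) t)
      interleave s s′ []            = ⊗-refl
      interleave s s′ ((x , y) ∷ t) =
        ⊗-trans (⊗-cong (distrib-scale s s′ x y) (interleave s s′ t))
          (⊗-cong {List.[ s M.*ₗ x , y ]} ⊗-refl
            (≡.subst₂ TensorEq ≡.refl (++-assoc (map (scaleˡ s) t) List.[ s′ M.*ₗ x , y ] _)
              (⊗-cong (⊗-comm List.[ s′ M.*ₗ x , y ] (map (scaleˡ s) t)) ⊗-refl)))
        where open import Data.List.Properties using (++-assoc)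

      vanish : ∀ t → TensorEq (map (scaleˡ 0#) t) []
      vanish []            = ⊗-refl
      vanish ((x , y) ∷ t) = ⊗-cong (⊗-trans (⊗-pair (M.*ₗ-zeroˡ x) N.≈ᴹ-refl) (⊗-zeroˡ y)) (vanish t)

      identity : ∀ t → TensorEq (map (scaleˡ 1#) t) t
      identity []            = ⊗-refl
      identity ((x , y) ∷ t) = ⊗-cong (⊗-pair (M.*ₗ-identityˡ x) N.≈ᴹ-refl) (identity t)

      compose : ∀ s s′ t → TensorEq (map (scaleˡ (s * s′)) t) (map (scaleˡ s) (map (scaleˡ s′) t))
      compose s s′ []            = ⊗-refl
      compose s s′ ((x , y) ∷ t) = ⊗-cong (⊗-pair (M.*ₗ-assoc s s′ x) N.≈ᴹ-refl) (compose s s′ t)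

      cong-scalar : ∀ {s s′} → s ≈ s′ → ∀ t → TensorEq (map (scaleˡ s) t) (map (scaleˡ s′) t)
      cong-scalar p = termwise (λ _ → ⊗-pair (M.*ₗ-cong p M.≈ᴹ-refl) N.≈ᴹ-refl)

      inverseˡ : ∀ t → TensorEq (map (scaleˡ (- 1#)) t ++ t) []
      inverseˡ t = ⊗-trans (⊗-cong ⊗-refl (⊗-sym (identity t)))
        (⊗-trans (⊗-sym (interleave (- 1#) 1# t)) (⊗-trans (cong-scalar (-‿inverseˡ 1#) t) (vanish t)))

    _⊗_ : LeftModule ring (m₁ ⊔ m₂) (r ⊔ m₁ ⊔ m₂ ⊔ ℓ₁ ⊔ ℓ₂)
    _⊗_ = record
      { Carrierᴹ = Tensors
      ; _≈ᴹ_ = TensorEq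
      ; _+ᴹ_ = _++_
      ; _*ₗ_ = λ s → map (scaleˡ s)
      ; 0ᴹ = []
      ; -ᴹ_ = map (scaleˡ (- 1#))
      ; isLeftModule = record
        { isLeftSemimodule = record
          { +ᴹ-isCommutativeMonoid = record
            { isMonoid = record
              { isSemigroup = record
                { isMagma = record
                  { isEquivalence = record { refl = ⊗-refl ; sym = ⊗-sym ; trans = ⊗-trans }
                  ; ∙-cong = ⊗-cong
                  }
                ; assoc = λ t u v → ≡.subst (TensorEq _) (++-assoc t u v) ⊗-refl
                }
              ; identity = (λ t → ⊗-refl) , (λ t → ≡.subst (TensorEq _) (++-identityʳ t) ⊗-refl)
              }
            ; comm = ⊗-comm
            }
          ; isPreleftSemimodule = record
            { *ₗ-cong = λ {s} {s′} {t} {u} p q → ⊗-trans (cong-scalar p t) (scale-cong s′ q)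
            ; *ₗ-zeroˡ = vanish
            ; *ₗ-distribʳ = λ t s s′ → interleave s s′ t
            ; *ₗ-identityˡ = identity
            ; *ₗ-assoc = compose
            ; *ₗ-zeroʳ = λ s → ⊗-refl
            ; *ₗ-distribˡ = λ s t u → ≡.subst (TensorEq _) (map-++ (scaleˡ s) t u) ⊗-refl
            }
          }
        ; -ᴹ‿cong = scale-cong (- 1#)
        ; -ᴹ‿inverse = inverseˡ , (λ t → ⊗-trans (⊗-comm t _) (inverseˡ t))
        }
      }
      where open import Data.List.Properties using (++-assoc; ++-identityʳ; map-++)

  -- The antipode of a Hopf algebra is determined by the remaining data, and
  -- every bialgebra homomorphism between Hopf algebras commutes with the
  -- antipodes, so neither appears below.
  record RawHopfAlgebra a ℓ : Set (r ⊔ ℓr ⊔ lsuc (a ⊔ ℓ)) where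
    field
      space          : LeftModule ring a ℓ
      multiplication : LeftModule.Carrierᴹ (space ⊗ space) → LeftModule.Carrierᴹ space
      unit           : Scalar → LeftModule.Carrierᴹ space
      comultiplication : LeftModule.Carrierᴹ space → LeftModule.Carrierᴹ (space ⊗ space)
      counit         : LeftModule.Carrierᴹ space → Scalar
    open LeftModule space public

  module _ {a ℓa b ℓb} (A : RawHopfAlgebra a ℓa) (B : RawHopfAlgebra b ℓb) where
    private
      module A = RawHopfAlgebra A
      module B = RawHopfAlgebra B
    open LeftModuleMorphisms A.rawLeftModule B.rawLeftModule

    record IsHopfAlgebraHomomorphism (φ : A.Carrierᴹ → B.Carrierᴹ) :
        Set (r ⊔ a ⊔ b ⊔ ℓa ⊔ ℓb ⊔ ℓr) where
      φ⊗φ : LeftModule.Carrierᴹ (A.space ⊗ A.space) → LeftModule.Carrierᴹ (B.space ⊗ B.space)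
      φ⊗φ = map (Product.map φ φ)

      field
        isLeftModuleHomomorphism : IsLeftModuleHomomorphism φ
        multiplication-homo   : ∀ t → φ (A.multiplication t) B.≈ᴹ B.multiplication (φ⊗φ t)
        unit-homo             : ∀ s → φ (A.unit s) B.≈ᴹ B.unit s
        comultiplication-homo : ∀ x → LeftModule._≈ᴹ_ (B.space ⊗ B.space)
                                  (B.comultiplication (φ x)) (φ⊗φ (A.comultiplication x))
        counit-homo           : ∀ x → B.counit (φ x) ≈ A.counit x

    record IsInjectiveHopfAlgebraHomomorphism (φ : A.Carrierᴹ → B.Carrierᴹ) :
        Set (r ⊔ a ⊔ b ⊔ ℓa ⊔ ℓb ⊔ ℓr) where
      field
        isHopfAlgebraHomomorphism : IsHopfAlgebraHomomorphism φ
        injective                 : Injective A._≈ᴹ_ B._≈ᴹ_ φ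

record Finite {a ℓ} (S : Setoid a ℓ) : Set (a ⊔ ℓ) where
  field
    size        : ℕ
    enumeration : Inverse S (≡.setoid (Fin size))
  open Setoid S
  open Inverse enumeration public using () renaming (to to index; from to element)
  private module E = Inverse enumeration

  element-index : ∀ x → element (index x) ≈ x
  element-index x = E.inverseʳ ≡.refl

  index-injective : ∀ {x y} → index x ≡ index y → x ≈ y
  index-injective {x} {y} p = trans (sym (element-index x)) (E.inverseʳ p)

  infix 4 _≟_
  _≟_ : Decidable _≈_
  x ≟ y = map′ index-injective E.to-cong (index x Fin.≟ index y)

  size-nonZero : Carrier → NonZero size
  size-nonZero x = Fin.nonZeroIndex (index x)

module _ {a ℓ b ℓ′} {S : Setoid a ℓ} {T : Setoid b ℓ′} where

  transport-finite : Inverse S T → Finite T → Finite S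
  transport-finite S↔T T-finite = record
    { size = Finite.size T-finite
    ; enumeration = Compose.inverse S↔T (Finite.enumeration T-finite)
    }

  ×-finite : Finite S → Finite T → Finite (×-setoid S T)
  ×-finite S-finite T-finite = record
    { size = S.size ℕ.* T.size
    ; enumeration = record
      { to = λ (x , y) → Fin.combine (S.index x) (T.index y)
      ; from = λ i → Product.map S.element T.element (Fin.remQuot T.size i)
      ; to-cong = λ (p , q) → ≡.cong₂ Fin.combine (Inverse.to-cong S.enumeration p) (Inverse.to-cong T.enumeration q)
      ; from-cong = λ { ≡.refl → Setoid.refl S , Setoid.refl T }
      ; inverse = (λ { {i} (p , q) → ≡.trans
                       (≡.cong₂ Fin.combine (Inverse.inverseˡ S.enumeration p) (Inverse.inverseˡ T.enumeration q))
                       (Fin.combine-remQuot {S.size} T.size i) })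
                , (λ { {x , y} ≡.refl →
                       Inverse.inverseʳ S.enumeration (≡.cong proj₁ (Fin.remQuot-combine (S.index x) (T.index y)))
                     , Inverse.inverseʳ T.enumeration (≡.cong proj₂ (Fin.remQuot-combine (S.index x) (T.index y))) })
      }
    }
    where
    module S = Finite S-finite
    module T = Finite T-finite

Π-setoid : ∀ {a ℓ n} → (Fin n → Setoid a ℓ) → Setoid a ℓ
Π-setoid S = record
  { Carrier = ∀ i → Setoid.Carrier (S i)
  ; _≈_ = λ f g → ∀ i → Setoid._≈_ (S i) (f i) (g i)
  ; isEquivalence = record
    { refl = λ i → Setoid.refl (S i)
    ; sym = λ p i → Setoid.sym (S i) (p i)
    ; trans = λ p q i → Setoid.trans (S i) (p i) (q i)
    }
  }

Π-finite : ∀ {a ℓ n} {S : Fin n → Setoid a ℓ} → (∀ i → Finite (S i)) → Finite (Π-setoid S)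
Π-finite {n = zero} S-finite = record
  { size = 1
  ; enumeration = record
    { to = λ _ → zero
    ; from = λ _ ()
    ; to-cong = λ _ → ≡.refl
    ; from-cong = λ _ ()
    ; inverse = (λ { {zero} _ → ≡.refl }) , (λ _ ())
    }
  }
Π-finite {n = suc n} {S} S-finite =
  transport-finite
    (record
      { to = λ f → f zero , f ∘ suc
      ; from = λ { (x , f) zero → x ; (x , f) (suc i) → f i }
      ; to-cong = λ p → p zero , p ∘ suc
      ; from-cong = λ { (p , q) zero → p ; (p , q) (suc i) → q i }
      ; inverse = (λ p → p zero , p ∘ suc)
                , (λ { (p , q) zero → p ; (p , q) (suc i) → q i })
      })
    (×-finite (S-finite zero) (Π-finite (S-finite ∘ suc)))

record FiniteField c ℓ₁ ℓ₂ : Set (lsuc (c ⊔ ℓ₁ ⊔ ℓ₂)) where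
  field
    heytingField : HeytingField c ℓ₁ ℓ₂
  commutativeRing : CommutativeRing c ℓ₁
  commutativeRing = HeytingCommutativeRing.commutativeRing (HeytingField.heytingCommutativeRing heytingField)
  open CommutativeRing commutativeRing public
  field
    finite : Finite setoid
  open Finite finite public using (_≟_) renaming (size to order)

  instance
    order-nonZero : NonZero order
    order-nonZero = Finite.size-nonZero finite 0#

-- The scalars of class functions: any field of characteristic zero, such as ℂ,
-- will do.
record CharacteristicZeroField c ℓ₁ ℓ₂ : Set (lsuc (c ⊔ ℓ₁ ⊔ ℓ₂)) where
  field
    heytingField : HeytingField c ℓ₁ ℓ₂
  commutativeRing : CommutativeRing c ℓ₁
  commutativeRing = HeytingCommutativeRing.commutativeRing (HeytingField.heytingCommutativeRing heytingField)
  open CommutativeRing commutativeRing public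
  open HeytingField heytingField public using (_#_; #⇒invertible)
  open Mult semiring public using () renaming (_×_ to _·ℕ_)
  field
    characteristicZero : ∀ n .{{_ : NonZero n}} → (n ·ℕ 1#) # 0#

  1/_ : ∀ n .{{_ : NonZero n}} → Carrier
  1/ n = proj₁ (#⇒invertible (characteristicZero n))

  1/-inverse : ∀ n .{{_ : NonZero n}} → (1/ n) * (n ·ℕ 1#) ≈ 1#
  1/-inverse n = trans (*-congˡ (sym n-0)) (proj₁ (proj₂ (#⇒invertible (characteristicZero n))))
    where
    n-0 : (n ·ℕ 1#) - 0# ≈ n ·ℕ 1#
    n-0 = trans (+-congˡ (RingProperties.-0#≈0# ring)) (+-identityʳ _)

module _ {g ℓg} (G : Group g ℓg) where
  private module G = Group G

  conjugation : G.Carrier → Inverse G.setoid G.setoid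
  conjugation z = record
    { to = λ x → z G.∙ x G.∙ z G.⁻¹
    ; from = λ x → z G.⁻¹ G.∙ x G.∙ z
    ; to-cong = λ p → G.∙-congʳ (G.∙-congˡ p)
    ; from-cong = λ p → G.∙-congʳ (G.∙-congˡ p)
    ; inverse = (λ {x} {y} p → G.trans (G.∙-congʳ (G.∙-congˡ p)) (cancel z (z G.⁻¹) x (G.inverseʳ z)))
              , (λ {x} {y} p → G.trans (G.∙-congʳ (G.∙-congˡ p)) (cancel (z G.⁻¹) z x (G.inverseˡ z)))
    }
    where
    cancel : ∀ u v x → u G.∙ v G.≈ G.ε → u G.∙ (v G.∙ x G.∙ u) G.∙ v G.≈ x
    cancel u v x p = begin
      u G.∙ (v G.∙ x G.∙ u) G.∙ v     ≈⟨ G.∙-congʳ (G.assoc _ _ _) ⟨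
      u G.∙ (v G.∙ x) G.∙ u G.∙ v     ≈⟨ G.assoc _ _ _ ⟩
      u G.∙ (v G.∙ x) G.∙ (u G.∙ v)   ≈⟨ G.∙-cong (G.sym (G.assoc _ _ _)) p ⟩
      u G.∙ v G.∙ x G.∙ G.ε           ≈⟨ G.identityʳ _ ⟩
      u G.∙ v G.∙ x                   ≈⟨ G.∙-congʳ p ⟩
      G.ε G.∙ x                       ≈⟨ G.identityˡ x ⟩
      x                               ∎
      where open SetoidReasoning G.setoid

  translation : G.Carrier → Inverse G.setoid G.setoid
  translation z = record
    { to = z G.∙_
    ; from = z G.⁻¹ G.∙_
    ; to-cong = G.∙-congˡ
    ; from-cong = G.∙-congˡ
    ; inverse = (λ p → G.trans (G.∙-congˡ p) (cancel (G.inverseʳ z)))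
              , (λ p → G.trans (G.∙-congˡ p) (cancel (G.inverseˡ z)))
    }
    where
    cancel : ∀ {u v x} → u G.∙ v G.≈ G.ε → u G.∙ (v G.∙ x) G.≈ x
    cancel p = G.trans (G.sym (G.assoc _ _ _)) (G.trans (G.∙-congʳ p) (G.identityˡ _))

module _ {g ℓg} (G : Group g ℓg) where
  open Group G

  conjugation-∙ : ∀ z x y → (z ∙ x ∙ z ⁻¹) ∙ (z ∙ y ∙ z ⁻¹) ≈ z ∙ (x ∙ y) ∙ z ⁻¹
  conjugation-∙ z x y = begin
    (z ∙ x ∙ z ⁻¹) ∙ (z ∙ y ∙ z ⁻¹)     ≈⟨ assoc _ _ _ ⟨
    z ∙ x ∙ z ⁻¹ ∙ (z ∙ y) ∙ z ⁻¹       ≈⟨ ∙-congʳ (assoc _ _ _) ⟩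
    z ∙ x ∙ (z ⁻¹ ∙ (z ∙ y)) ∙ z ⁻¹     ≈⟨ ∙-congʳ (∙-congˡ (Inverse.inverseʳ (translation G z) refl)) ⟩
    z ∙ x ∙ y ∙ z ⁻¹                    ≈⟨ ∙-congʳ (assoc _ _ _) ⟩
    z ∙ (x ∙ y) ∙ z ⁻¹                  ∎
    where open SetoidReasoning setoid

module _ {g ℓg h ℓh} (G : Group g ℓg) (H : Group h ℓh) where
  private
    module G = Group G
    module H = Group H
  open MorphismStructures.MagmaMorphisms G.rawMagma H.rawMagma

  homo-⁻¹ : ∀ {f} → IsMagmaHomomorphism f → ∀ x → f (x G.⁻¹) H.≈ f x H.⁻¹
  homo-⁻¹ {f} f-homo x = GroupProperties.inverseˡ-unique H _ _
    (H.trans (H.sym (f.homo _ _)) (H.trans (f.⟦⟧-cong (G.inverseˡ x)) f-unit))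
    where
    module f = IsMagmaHomomorphism f-homo
    f-unit : f G.ε H.≈ H.ε
    f-unit = GroupProperties.identityʳ-unique H (f G.ε) (f G.ε)
               (H.trans (H.sym (f.homo _ _)) (f.⟦⟧-cong (G.identityˡ G.ε)))

module ClassFunctions {c ℓ₁ ℓ₂} (K : CharacteristicZeroField c ℓ₁ ℓ₂) where

  open CharacteristicZeroField K hiding (zero)
  open LinearAlgebra commutativeRing
  open Sum semiring using (sum; sum-cong-≋; sum-permute)

  record ClassFunction {g ℓ} (G : Group g ℓ) : Set (c ⊔ ℓ₁ ⊔ g ⊔ ℓ) where
    private module G = Group G
    field
      ⟦_⟧       : G.Carrier → Carrier
      cong      : ∀ {x y} → x G.≈ y → ⟦ x ⟧ ≈ ⟦ y ⟧
      conjugate : ∀ x y → ⟦ x G.∙ y G.∙ x G.⁻¹ ⟧ ≈ ⟦ y ⟧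

  open ClassFunction public

  cf : ∀ {g ℓ} → Group g ℓ → LeftModule ring (c ⊔ ℓ₁ ⊔ g ⊔ ℓ) (ℓ₁ ⊔ g)
  cf G = record
    { Carrierᴹ = ClassFunction G
    ; _≈ᴹ_ = λ ψ χ → ∀ x → ⟦ ψ ⟧ x ≈ ⟦ χ ⟧ x
    ; _+ᴹ_ = λ ψ χ → record
      { ⟦_⟧ = λ x → ⟦ ψ ⟧ x + ⟦ χ ⟧ x
      ; cong = λ p → +-cong (cong ψ p) (cong χ p)
      ; conjugate = λ x y → +-cong (conjugate ψ x y) (conjugate χ x y)
      }
    ; _*ₗ_ = λ s ψ → record
      { ⟦_⟧ = λ x → s * ⟦ ψ ⟧ x
      ; cong = λ p → *-congˡ (cong ψ p)
      ; conjugate = λ x y → *-congˡ (conjugate ψ x y)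
      }
    ; 0ᴹ = record { ⟦_⟧ = λ _ → 0# ; cong = λ _ → refl ; conjugate = λ _ _ → refl }
    ; -ᴹ_ = λ ψ → record
      { ⟦_⟧ = λ x → - ⟦ ψ ⟧ x
      ; cong = λ p → -‿cong (cong ψ p)
      ; conjugate = λ x y → -‿cong (conjugate ψ x y)
      }
    ; isLeftModule = record
      { isLeftSemimodule = record
        { +ᴹ-isCommutativeMonoid = record
          { isMonoid = record
            { isSemigroup = record
              { isMagma = record
                { isEquivalence = record
                  { refl = λ _ → refl
                  ; sym = λ p x → sym (p x)
                  ; trans = λ p q x → trans (p x) (q x)
                  }
                ; ∙-cong = λ p q x → +-cong (p x) (q x)
                }
              ; assoc = λ _ _ _ _ → +-assoc _ _ _
              }
            ; identity = (λ _ _ → +-identityˡ _) , (λ _ _ → +-identityʳ _)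
            }
          ; comm = λ _ _ _ → +-comm _ _
          }
        ; isPreleftSemimodule = record
          { *ₗ-cong = λ p q x → *-cong p (q x)
          ; *ₗ-zeroˡ = λ _ _ → zeroˡ _
          ; *ₗ-distribʳ = λ _ _ _ _ → distribʳ _ _ _
          ; *ₗ-identityˡ = λ _ _ → *-identityˡ _
          ; *ₗ-assoc = λ _ _ _ _ → *-assoc _ _ _
          ; *ₗ-zeroʳ = λ _ _ → zeroʳ _
          ; *ₗ-distribˡ = λ _ _ _ _ → distribˡ _ _ _
          }
        }
      ; -ᴹ‿cong = λ p x → -‿cong (p x)
      ; -ᴹ‿inverse = (λ _ _ → -‿inverseˡ _) , (λ _ _ → -‿inverseʳ _)
      }
    }

  module _ {g ℓg h ℓh} {G : Group g ℓg} {H : Group h ℓh} where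
    private
      module G = Group G
      module H = Group H
    open MorphismStructures.MagmaMorphisms G.rawMagma H.rawMagma

    pullback : ∀ {f} → IsMagmaHomomorphism f → ClassFunction H → ClassFunction G
    pullback {f} f-homo ψ = record
      { ⟦_⟧ = λ x → ⟦ ψ ⟧ (f x)
      ; cong = λ p → cong ψ (f.⟦⟧-cong p)
      ; conjugate = λ x y → trans
          (cong ψ (H.trans (f.homo _ _) (H.∙-cong (f.homo _ _) (homo-⁻¹ G H f-homo x))))
          (conjugate ψ (f x) (f y))
      }
      where
      module f = IsMagmaHomomorphism f-homo

  module _ {a ℓ} {S : Setoid a ℓ} (S-finite : Finite S) where
    private module S = Setoid S
    open Finite S-finite

    ∑ : (S.Carrier → Carrier) → Carrier
    ∑ f = sum (λ i → f (element i))

    ∑ᴹ : ∀ {m ℓm} (M : LeftModule ring m ℓm) → (S.Carrier → LeftModule.Carrierᴹ M) → LeftModule.Carrierᴹ M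
    ∑ᴹ M f = CommutativeMonoidSum.sum (LeftModule.+ᴹ-commutativeMonoid M) (λ i → f (element i))

    average : S.Carrier → (S.Carrier → Carrier) → Carrier
    average x f = (1/_ size {{size-nonZero x}}) * ∑ f

    ∑-cong : ∀ {f h} → (∀ x → f x ≈ h x) → ∑ f ≈ ∑ h
    ∑-cong {f} {h} p = sum-cong-≋ {size} {f ∘ element} {h ∘ element} (λ i → p (element i))

    *-distribˡ-∑ : ∀ s (f : S.Carrier → Carrier) → s * ∑ f ≈ ∑ (λ x → s * f x)
    *-distribˡ-∑ s f = Sum.*-distribˡ-sum semiring {size} s (f ∘ element)

    ∑-reindex : ∀ (f : S.Carrier → Carrier) → (∀ {x y} → x S.≈ y → f x ≈ f y) → (σ : Inverse S S) → ∑ (f ∘ Inverse.to σ) ≈ ∑ f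
    ∑-reindex f f-cong σ = sym (trans (sum-permute (f ∘ element) π)
      (sum-cong-≋ {size} {λ i → f (element (Inverse.to π i))} {λ i → f (Inverse.to σ (element i))}
        (λ i → f-cong (element-index _))))
      where
      π : Permutation size size
      π = Compose.inverse (Compose.inverse (Symmetry.inverse enumeration) σ) enumeration

    ∑-delta : ∀ (f : S.Carrier → Carrier) → (∀ {x y} → x S.≈ y → f x ≈ f y) → ∀ y → ∑ (λ x → if does (x ≟ y) then f x else 0#) ≈ f y
    ∑-delta f f-cong y = trans (sum-single {size} (λ i → term (element i)) (index y) off) on-diagonal
      where
      open Sum semiring using (sum-remove; sum-replicate-zero)
      term : S.Carrier → Carrier
      term x = if does (x ≟ y) then f x else 0#
      sum-single : ∀ {n} (t : Fin n → Carrier) i → (∀ j → j ≢ i → t j ≈ 0#) → sum t ≈ t i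
      sum-single {suc n} t i off = trans (sum-remove {i = i} t) (trans (+-congˡ (trans
        (sum-cong-≋ {n} {λ j → t (Fin.punchIn i j)} {λ _ → 0#}
          (λ j → off (Fin.punchIn i j) (Fin.punchInᵢ≢i i j))) (sum-replicate-zero n))) (+-identityʳ _))
      case-no : ∀ {p s} {P : Set p} (P? : Dec P) → ¬ P → (if does P? then s else 0#) ≈ 0#
      case-no (no _)  ¬p = refl
      case-no (yes p) ¬p = contradiction p ¬p
      case-yes : ∀ {p s s′} {P : Set p} (P? : Dec P) → P → s ≈ s′ → (if does P? then s else 0#) ≈ s′
      case-yes (yes _) p q = q
      case-yes (no ¬p) p q = contradiction p ¬p
      off : ∀ j → j ≢ index y → term (element j) ≈ 0#
      off j j≢ = case-no (element j ≟ y) λ p →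
        j≢ (≡.trans (≡.sym (Inverse.inverseˡ enumeration S.refl)) (Inverse.to-cong enumeration p))
      on-diagonal : term (element (index y)) ≈ f y
      on-diagonal = case-yes (element (index y) ≟ y) (element-index y) (f-cong (element-index y))

    average-constant : ∀ y s → average y (λ _ → s) ≈ s
    average-constant y s = begin
      (1/ size) * sum {size} (λ _ → s)        ≈⟨ *-congˡ (sum-replicate size) ⟩
      (1/ size) * (size ·ℕ s)                 ≈⟨ *-congˡ (×-congʳ size (*-identityˡ s)) ⟨
      (1/ size) * (size ·ℕ (1# * s))          ≈⟨ *-congˡ (×-assoc-* size 1# s) ⟨
      (1/ size) * ((size ·ℕ 1#) * s)          ≈⟨ *-assoc _ _ _ ⟨
      (1/ size) * (size ·ℕ 1#) * s            ≈⟨ *-congʳ (1/-inverse size) ⟩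
      1# * s                                  ≈⟨ *-identityˡ s ⟩
      s                                       ∎
      where
      open SetoidReasoning setoid
      open Sum semiring using (sum-replicate)
      open Mult semiring using (×-assoc-*; ×-congʳ)
      instance
        nonZero : NonZero size
        nonZero = size-nonZero y

  ∑-swap : ∀ {a ℓ b ℓ′} {S : Setoid a ℓ} {T : Setoid b ℓ′} (S-finite : Finite S) (T-finite : Finite T)
           (f : Setoid.Carrier S → Setoid.Carrier T → Carrier) →
           ∑ S-finite (λ x → ∑ T-finite (f x)) ≈ ∑ T-finite (λ y → ∑ S-finite (λ x → f x y))
  ∑-swap S-finite T-finite f = Sum.∑-comm semiring {S.size} {T.size} (λ i j → f (S.element i) (T.element j))
    where
    module S = Finite S-finite
    module T = Finite T-finite

  module _ {g ℓg} (G : Group g ℓg) (G-finite : Finite (Group.setoid G)) where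
    private module G = Group G
    open Finite G-finite

    does-≟ : ∀ {x y x′ y′} → (x G.≈ y → x′ G.≈ y′) → (x′ G.≈ y′ → x G.≈ y) → does (x ≟ y) ≡ does (x′ ≟ y′)
    does-≟ p q = does-⇔ (mk⇔ p q) (_ ≟ _) (_ ≟ _)

    indicator : Bool → Carrier
    indicator b = if b then 1# else 0#

    -- y ↦ |G|⁻¹ · #{ x | x g x⁻¹ = y }, the indicator function of the
    -- conjugacy class of g divided by the size of that class.
    classAverage : G.Carrier → ClassFunction G
    classAverage g = record
      { ⟦_⟧ = λ y → average G-finite G.ε (term y)
      ; cong = λ p → *-congˡ (∑-cong G-finite λ x → reflexive (≡.cong indicator
          (does-≟ {x G.∙ g G.∙ x G.⁻¹} (λ q → G.trans q p) (λ q → G.trans q (G.sym p)))))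
      ; conjugate = λ z y → *-congˡ (trans (sym (∑-reindex G-finite (term (z G.∙ y G.∙ z G.⁻¹)) (term-cong (z G.∙ y G.∙ z G.⁻¹)) (translation G z)))
          (∑-cong G-finite λ x → reflexive (≡.cong indicator (does-≟
            (λ q → injective z (G.trans (G.sym (twist z x)) q))
            (λ q → G.trans (twist z x) (Inverse.to-cong (conjugation G z) q))))))
      }
      where
      term : G.Carrier → G.Carrier → Carrier
      term y x = indicator (does (x G.∙ g G.∙ x G.⁻¹ ≟ y))
      term-cong : ∀ y {x x′} → x G.≈ x′ → term y x ≈ term y x′
      term-cong y p = reflexive (≡.cong indicator (does-≟ (G.trans (G.sym same)) (G.trans same)))
        where same = G.∙-cong (G.∙-congʳ p) (G.⁻¹-cong p)
      twist : ∀ z x → (z G.∙ x) G.∙ g G.∙ (z G.∙ x) G.⁻¹ G.≈ z G.∙ (x G.∙ g G.∙ x G.⁻¹) G.∙ z G.⁻¹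
      twist z x = begin
        z G.∙ x G.∙ g G.∙ (z G.∙ x) G.⁻¹          ≈⟨ G.∙-congˡ (GroupProperties.⁻¹-anti-homo-∙ G z x) ⟩
        z G.∙ x G.∙ g G.∙ (x G.⁻¹ G.∙ z G.⁻¹)     ≈⟨ G.assoc _ _ _ ⟨
        z G.∙ x G.∙ g G.∙ x G.⁻¹ G.∙ z G.⁻¹       ≈⟨ G.∙-congʳ (G.∙-congʳ (G.assoc _ _ _)) ⟩
        z G.∙ (x G.∙ g) G.∙ x G.⁻¹ G.∙ z G.⁻¹     ≈⟨ G.∙-congʳ (G.assoc _ _ _) ⟩
        z G.∙ (x G.∙ g G.∙ x G.⁻¹) G.∙ z G.⁻¹     ∎
        where open SetoidReasoning G.setoid
      injective : ∀ z {x y} → z G.∙ x G.∙ z G.⁻¹ G.≈ z G.∙ y G.∙ z G.⁻¹ → x G.≈ y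
      injective z {x} {y} p = G.trans (G.sym (Inverse.inverseʳ (conjugation G z) G.refl))
                                      (Inverse.inverseʳ (conjugation G z) p)

    -- Every class function ψ equals ∑ g, ψ(g) · classAverage g.
    classAverage-expansion : ∀ (ψ : ClassFunction G) y → ∑ G-finite (λ g → ⟦ ψ ⟧ g * ⟦ classAverage g ⟧ y) ≈ ⟦ ψ ⟧ y
    classAverage-expansion ψ y = begin
      ∑ G-finite (λ g → ⟦ ψ ⟧ g * (|G|⁻¹ * ∑ G-finite (δ g)))
        ≈⟨ ∑-cong G-finite (λ g → rotate (⟦ ψ ⟧ g) |G|⁻¹ (∑ G-finite (δ g))) ⟩
      ∑ G-finite (λ g → |G|⁻¹ * (⟦ ψ ⟧ g * ∑ G-finite (δ g)))
        ≈⟨ *-distribˡ-∑ G-finite |G|⁻¹ (λ g → ⟦ ψ ⟧ g * ∑ G-finite (δ g)) ⟨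
      |G|⁻¹ * ∑ G-finite (λ g → ⟦ ψ ⟧ g * ∑ G-finite (δ g))
        ≈⟨ *-congˡ (∑-cong G-finite λ g → *-distribˡ-∑ G-finite (⟦ ψ ⟧ g) (δ g)) ⟩
      |G|⁻¹ * ∑ G-finite (λ g → ∑ G-finite (λ x → ⟦ ψ ⟧ g * δ g x))
        ≈⟨ *-congˡ (∑-swap G-finite G-finite (λ g x → ⟦ ψ ⟧ g * δ g x)) ⟩
      |G|⁻¹ * ∑ G-finite (λ x → ∑ G-finite (λ g → ⟦ ψ ⟧ g * δ g x))
        ≈⟨ *-congˡ (∑-cong G-finite λ x → trans (∑-cong G-finite (pick x)) (∑-delta G-finite ⟦ ψ ⟧ (cong ψ) (x G.⁻¹ G.∙ y G.∙ x))) ⟩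
      |G|⁻¹ * ∑ G-finite (λ x → ⟦ ψ ⟧ (x G.⁻¹ G.∙ y G.∙ x))
        ≈⟨ *-congˡ (∑-cong G-finite λ x → trans (sym (conjugate ψ x _)) (cong ψ (Inverse.inverseˡ (conjugation G x) G.refl))) ⟩
      |G|⁻¹ * ∑ G-finite (λ x → ⟦ ψ ⟧ y)
        ≈⟨ average-constant G-finite G.ε (⟦ ψ ⟧ y) ⟩
      ⟦ ψ ⟧ y ∎
      where
      open SetoidReasoning setoid
      rotate : ∀ u v w → u * (v * w) ≈ v * (u * w)
      rotate u v w = trans (sym (*-assoc u v w)) (trans (*-congʳ (*-comm u v)) (*-assoc v u w))
      |G|⁻¹ = (1/_ size {{size-nonZero G.ε}})
      δ : G.Carrier → G.Carrier → Carrier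
      δ g x = indicator (does (x G.∙ g G.∙ x G.⁻¹ ≟ y))
      pick : ∀ x g → ⟦ ψ ⟧ g * δ g x ≈ (if does (g ≟ x G.⁻¹ G.∙ y G.∙ x) then ⟦ ψ ⟧ g else 0#)
      pick x g = select (does-≟ {x G.∙ g G.∙ x G.⁻¹} {y} {g} {x G.⁻¹ G.∙ y G.∙ x}
                   (λ q → G.sym (Inverse.inverseʳ (conjugation G x) (G.sym q)))
                   (λ q → Inverse.inverseˡ (conjugation G x) q))
        where
        select : ∀ {b b′ s} → b ≡ b′ → s * indicator b ≈ (if b′ then s else 0#)
        select {true}  ≡.refl = *-identityʳ _
        select {false} ≡.refl = zeroʳ _

  module _ {g ℓg h ℓh} (G : Group g ℓg) (H : Group h ℓh) where
    private
      module G = Group G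
      module H = Group H
      G×H = DirectProduct.group G H
      module cf-G×H = LeftModule (cf G×H)

    pure : ClassFunction G × ClassFunction H → ClassFunction G×H
    pure (ψ , χ) = record
      { ⟦_⟧ = λ (x , y) → ⟦ ψ ⟧ x * ⟦ χ ⟧ y
      ; cong = λ (p , q) → *-cong (cong ψ p) (cong χ q)
      ; conjugate = λ (x , x′) (y , y′) → *-cong (conjugate ψ x y) (conjugate χ x′ y′)
      }

    join : LeftModule.Carrierᴹ (cf G ⊗ cf H) → ClassFunction G×H
    join = foldr (λ t → pure t cf-G×H.+ᴹ_) cf-G×H.0ᴹ

    -- split is inverse to join (join-split and split-join below): averaging over
    -- conjugates turns point masses into class functions.
    module _ (G-finite : Finite G.setoid) (H-finite : Finite H.setoid) where
      private
        module GF = Finite G-finite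
        module HF = Finite H-finite
        module cf-G = LeftModule (cf G)
        module cf-H = LeftModule (cf H)
        module T = LeftModule (cf G ⊗ cf H)
        module ΣT = CommutativeMonoidSum T.+ᴹ-commutativeMonoid

      term : Carrier → G.Carrier → H.Carrier → T.Carrierᴹ
      term s x y = List.[ s cf-G.*ₗ classAverage G G-finite x , classAverage H H-finite y ]

      split : ClassFunction G×H → T.Carrierᴹ
      split ψ = ∑ᴹ G-finite (cf G ⊗ cf H) λ x → ∑ᴹ H-finite (cf G ⊗ cf H) λ y → term (⟦ ψ ⟧ (x , y)) x y

      join-++ : ∀ t u p → ⟦ join (t ++ u) ⟧ p ≈ ⟦ join t ⟧ p + ⟦ join u ⟧ p
      join-++ []      u p = sym (+-identityˡ _)
      join-++ (_ ∷ t) u p = trans (+-congˡ (join-++ t u p)) (sym (+-assoc _ _ _))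

      join-sum : ∀ {n} (t : Fin n → T.Carrierᴹ) p → ⟦ join (ΣT.sum t) ⟧ p ≈ sum (λ i → ⟦ join (t i) ⟧ p)
      join-sum {zero}  t p = refl
      join-sum {suc n} t p = trans (join-++ (t zero) (ΣT.sum (t ∘ suc)) p) (+-congˡ (join-sum (t ∘ suc) p))

      join-split : ∀ ψ → join (split ψ) cf-G×H.≈ᴹ ψ
      join-split ψ (x , y) = begin
        ⟦ join (split ψ) ⟧ (x , y)
          ≈⟨ join-sum {GF.size} (λ i → ∑ᴹ H-finite (cf G ⊗ cf H) (λ h → term (⟦ ψ ⟧ (GF.element i , h)) (GF.element i) h)) (x , y) ⟩
        ∑ G-finite (λ g → ⟦ join (∑ᴹ H-finite (cf G ⊗ cf H) (λ h → term (⟦ ψ ⟧ (g , h)) g h)) ⟧ (x , y))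
          ≈⟨ ∑-cong G-finite (λ g → join-sum {HF.size} (λ j → term (⟦ ψ ⟧ (g , HF.element j)) g (HF.element j)) (x , y)) ⟩
        ∑ G-finite (λ g → ∑ H-finite (λ h → ⟦ ψ ⟧ (g , h) * e g * e′ h + 0#))
          ≈⟨ ∑-cong G-finite (λ g → ∑-cong H-finite λ h → trans (+-identityʳ _) (shuffle (⟦ ψ ⟧ (g , h)) (e g) (e′ h))) ⟩
        ∑ G-finite (λ g → ∑ H-finite (λ h → e g * (⟦ ψ ⟧ (g , h) * e′ h)))
          ≈⟨ ∑-cong G-finite (λ g → *-distribˡ-∑ H-finite (e g) (λ h → ⟦ ψ ⟧ (g , h) * e′ h)) ⟨
        ∑ G-finite (λ g → e g * ∑ H-finite (λ h → ⟦ ψ ⟧ (g , h) * e′ h))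
          ≈⟨ ∑-cong G-finite (λ g → trans (*-congˡ (classAverage-expansion H H-finite (restrictʳ g) y)) (*-comm (e g) _)) ⟩
        ∑ G-finite (λ g → ⟦ ψ ⟧ (g , y) * e g)
          ≈⟨ classAverage-expansion G G-finite restrictˡ x ⟩
        ⟦ ψ ⟧ (x , y) ∎
        where
        open SetoidReasoning setoid
        e : G.Carrier → Carrier
        e g = ⟦ classAverage G G-finite g ⟧ x
        e′ : H.Carrier → Carrier
        e′ h = ⟦ classAverage H H-finite h ⟧ y
        shuffle : ∀ u v w → u * v * w ≈ v * (u * w)
        shuffle u v w = trans (*-congʳ (*-comm u v)) (*-assoc v u w)
        restrictʳ : G.Carrier → ClassFunction H
        restrictʳ g = record
          { ⟦_⟧ = λ h → ⟦ ψ ⟧ (g , h)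
          ; cong = λ p → cong ψ (G.refl , p)
          ; conjugate = λ z h → trans
              (cong ψ (G.sym (G.trans (G.∙-cong (G.identityˡ g) (GroupProperties.ε⁻¹≈ε G)) (G.identityʳ g)) , H.refl))
              (conjugate ψ (G.ε , z) (g , h))
          }
        restrictˡ : ClassFunction G
        restrictˡ = record
          { ⟦_⟧ = λ g → ⟦ ψ ⟧ (g , y)
          ; cong = λ p → cong ψ (p , H.refl)
          ; conjugate = λ z g → trans
              (cong ψ (G.refl , H.sym (H.trans (H.∙-cong (H.identityˡ y) (GroupProperties.ε⁻¹≈ε H)) (H.identityʳ y))))
              (conjugate ψ (z , H.ε) (g , y))
          }

      inner : ClassFunction G×H → Fin GF.size → T.Carrierᴹ
      inner ψ i = ∑ᴹ H-finite (cf G ⊗ cf H) λ y → term (⟦ ψ ⟧ (GF.element i , y)) (GF.element i) y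

      ∑∑-cong : (t u : G.Carrier → H.Carrier → T.Carrierᴹ) → (∀ x y → t x y T.≈ᴹ u x y) →
                ∑ᴹ G-finite (cf G ⊗ cf H) (λ x → ∑ᴹ H-finite (cf G ⊗ cf H) (t x)) T.≈ᴹ
                ∑ᴹ G-finite (cf G ⊗ cf H) (λ x → ∑ᴹ H-finite (cf G ⊗ cf H) (u x))
      ∑∑-cong t u p = ΣT.sum-cong-≋ {GF.size} {λ i → ∑ᴹ H-finite (cf G ⊗ cf H) (t (GF.element i))}
                        {λ i → ∑ᴹ H-finite (cf G ⊗ cf H) (u (GF.element i))} λ i →
                      ΣT.sum-cong-≋ {HF.size} {λ j → t (GF.element i) (HF.element j)}
                        {λ j → u (GF.element i) (HF.element j)} λ j → p _ _

      term-cong : ∀ {s s′} x y → s ≈ s′ → term s x y T.≈ᴹ term s′ x y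
      term-cong x y p = ⊗-pair (λ _ → *-congʳ p) (λ _ → refl)

      term-0 : ∀ x y → term 0# x y T.≈ᴹ []
      term-0 x y = ⊗-trans (⊗-pair {x′ = cf-G.0ᴹ} (λ _ → zeroˡ _) (λ _ → refl)) (⊗-zeroˡ (classAverage H H-finite y))

      term-+ : ∀ s s′ x y → term (s + s′) x y T.≈ᴹ term s x y ++ term s′ x y
      term-+ s s′ x y = ⊗-trans
        (⊗-pair {x′ = (s cf-G.*ₗ classAverage G G-finite x) cf-G.+ᴹ (s′ cf-G.*ₗ classAverage G G-finite x)}
          (λ _ → distribʳ _ _ _) (λ _ → refl))
        (⊗-distribʳ _ _ _)

      term-* : ∀ s s′ x y → term (s * s′) x y T.≈ᴹ
               List.[ s cf-G.*ₗ classAverage G G-finite x , s′ cf-H.*ₗ classAverage H H-finite y ]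
      term-* s s′ x y = ⊗-trans
        (⊗-pair {x′ = s′ cf-G.*ₗ (s cf-G.*ₗ classAverage G G-finite x)}
          (λ _ → trans (*-congʳ (*-comm s s′)) (*-assoc s′ s _)) (λ _ → refl))
        (⊗-balanced s′ _ _)

      zeroʳ-⊗ : ∀ ψ → List.[ ψ , cf-H.0ᴹ ] T.≈ᴹ []
      zeroʳ-⊗ ψ = ⊗-trans (⊗-pair {y′ = 0# cf-H.*ₗ cf-H.0ᴹ} (λ _ → refl) (λ _ → sym (zeroʳ 0#)))
        (⊗-trans (⊗-sym (⊗-balanced 0# ψ cf-H.0ᴹ))
          (⊗-trans (⊗-pair {x′ = cf-G.0ᴹ} (λ _ → zeroˡ _) (λ _ → refl)) (⊗-zeroˡ cf-H.0ᴹ)))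

      sumˡ : ∀ {n} (ψ : Fin n → ClassFunction G) χ →
             ΣT.sum (λ i → List.[ ψ i , χ ]) T.≈ᴹ List.[ CommutativeMonoidSum.sum cf-G.+ᴹ-commutativeMonoid ψ , χ ]
      sumˡ {zero}  ψ χ = ⊗-sym (⊗-zeroˡ χ)
      sumˡ {suc n} ψ χ = ⊗-trans (⊗-cong {t = List.[ ψ zero , χ ]} ⊗-refl (sumˡ (ψ ∘ suc) χ)) (⊗-sym (⊗-distribʳ _ _ _))

      sumʳ : ∀ {n} ψ (χ : Fin n → ClassFunction H) →
             ΣT.sum (λ i → List.[ ψ , χ i ]) T.≈ᴹ List.[ ψ , CommutativeMonoidSum.sum cf-H.+ᴹ-commutativeMonoid χ ]
      sumʳ {zero}  ψ χ = ⊗-sym (zeroʳ-⊗ ψ)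
      sumʳ {suc n} ψ χ = ⊗-trans (⊗-cong {t = List.[ ψ , χ zero ]} ⊗-refl (sumʳ ψ (χ ∘ suc))) (⊗-sym (⊗-distribˡ _ _ _))

      expansion : ∀ {a ℓ} (L : Group a ℓ) (L-finite : Finite (Group.setoid L)) (ψ : ClassFunction L) →
                  LeftModule._≈ᴹ_ (cf L) (∑ᴹ L-finite (cf L) (λ x → LeftModule._*ₗ_ (cf L) (⟦ ψ ⟧ x) (classAverage L L-finite x))) ψ
      expansion L L-finite ψ y = trans
        (pointwise λ i → LeftModule._*ₗ_ (cf L) (⟦ ψ ⟧ (Finite.element L-finite i)) (classAverage L L-finite (Finite.element L-finite i)))
        (classAverage-expansion L L-finite ψ y)
        where
        pointwise : ∀ {n} (f : Fin n → ClassFunction L) →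
                    ⟦ CommutativeMonoidSum.sum (LeftModule.+ᴹ-commutativeMonoid (cf L)) f ⟧ y ≈ sum (λ i → ⟦ f i ⟧ y)
        pointwise {zero}  f = refl
        pointwise {suc n} f = +-congˡ (pointwise (f ∘ suc))

      split-cong : ∀ ψ χ → ψ cf-G×H.≈ᴹ χ → split ψ T.≈ᴹ split χ
      split-cong ψ χ p = ∑∑-cong (λ x y → term (⟦ ψ ⟧ (x , y)) x y) (λ x y → term (⟦ χ ⟧ (x , y)) x y)
        (λ x y → term-cong x y (p (x , y)))

      split-+ : ∀ ψ χ → split (ψ cf-G×H.+ᴹ χ) T.≈ᴹ split ψ ++ split χ
      split-+ ψ χ = ⊗-trans
        (ΣT.sum-cong-≋ {GF.size} {inner (ψ cf-G×H.+ᴹ χ)} {λ i → inner ψ i ++ inner χ i} λ i → ⊗-trans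
          (ΣT.sum-cong-≋ {HF.size} {λ j → f (ψ cf-G×H.+ᴹ χ) i j} {λ j → f ψ i j ++ f χ i j} λ j → term-+ _ _ _ _)
          (ΣT.∑-distrib-+ (f ψ i) (f χ i)))
        (ΣT.∑-distrib-+ (inner ψ) (inner χ))
        where
        f : ClassFunction G×H → Fin GF.size → Fin HF.size → T.Carrierᴹ
        f ψ i j = term (⟦ ψ ⟧ (GF.element i , HF.element j)) (GF.element i) (HF.element j)

      split-0 : split cf-G×H.0ᴹ T.≈ᴹ []
      split-0 = ⊗-trans (∑∑-cong (term 0#) (λ _ _ → []) term-0)
        (⊗-trans (ΣT.sum-cong-≋ {GF.size} {λ _ → ΣT.sum {HF.size} (λ _ → [])} {λ _ → []} λ _ → ΣT.sum-replicate-zero HF.size)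
                 (ΣT.sum-replicate-zero GF.size))

      split-pure : ∀ ψ χ → split (pure (ψ , χ)) T.≈ᴹ List.[ ψ , χ ]
      split-pure ψ χ = ⊗-trans
        (∑∑-cong (λ x y → term (⟦ ψ ⟧ x * ⟦ χ ⟧ y) x y) (λ x y → List.[ left x , right y ]) (λ x y → term-* _ _ x y))
        (⊗-trans
          (ΣT.sum-cong-≋ {GF.size} {λ i → ΣT.sum (λ j → List.[ left (GF.element i) , right (HF.element j) ])}
            {λ i → List.[ left (GF.element i) , _ ]} (λ i → sumʳ (left (GF.element i)) (λ j → right (HF.element j))))
          (⊗-trans (sumˡ (λ i → left (GF.element i)) _)
            (⊗-pair (expansion G G-finite ψ) (expansion H H-finite χ))))
        where
        left : G.Carrier → ClassFunction G
        left x = ⟦ ψ ⟧ x cf-G.*ₗ classAverage G G-finite x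
        right : H.Carrier → ClassFunction H
        right y = ⟦ χ ⟧ y cf-H.*ₗ classAverage H H-finite y

      split-join : ∀ t → split (join t) T.≈ᴹ t
      split-join []            = split-0
      split-join ((ψ , χ) ∷ t) = ⊗-trans (split-+ (pure (ψ , χ)) (join t)) (⊗-cong (split-pure ψ χ) (split-join t))

-- A subset I of [n] with a elements and a complement with b elements. The
-- bijection sends k to inj₁ (cano_I k) for k ∈ I and to inj₂ (cano_{Iᶜ} k)
-- for k ∉ I.
record Split (n a b : ℕ) : Set where
  field
    cano   : Fin n ↔ (Fin a ⊎ Fin b)
  open Inverse cano public using (to; from; strictlyInverseˡ; strictlyInverseʳ)
  field
    monoˡ : ∀ {i j} → i Fin.< j → from (inj₁ i) Fin.< from (inj₁ j)
    monoʳ : ∀ {i j} → i Fin.< j → from (inj₂ i) Fin.< from (inj₂ j)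

  member : Fin n → Bool
  member k = ⊎.[ (λ _ → true) , (λ _ → false) ]′ (to k)

  embedˡ : Fin a → Fin n
  embedˡ i = from (inj₁ i)

  embedʳ : Fin b → Fin n
  embedʳ i = from (inj₂ i)

  member-embedˡ : ∀ i → member (embedˡ i) ≡ true
  member-embedˡ i rewrite strictlyInverseˡ (inj₁ i) = ≡.refl

  member-embedʳ : ∀ i → member (embedʳ i) ≡ false
  member-embedʳ i rewrite strictlyInverseˡ (inj₂ i) = ≡.refl

  embedˡ-injective : ∀ {i j} → embedˡ i ≡ embedˡ j → i ≡ j
  embedˡ-injective {i} {j} p with ≡.refl ← ≡.trans (≡.sym (strictlyInverseˡ (inj₁ i))) (≡.trans (≡.cong to p) (strictlyInverseˡ (inj₁ j))) = ≡.refl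

  embedʳ-injective : ∀ {i j} → embedʳ i ≡ embedʳ j → i ≡ j
  embedʳ-injective {i} {j} p with ≡.refl ← ≡.trans (≡.sym (strictlyInverseˡ (inj₂ i))) (≡.trans (≡.cong to p) (strictlyInverseˡ (inj₂ j))) = ≡.refl

module _ {m n} (f : Fin m → Fin n) (f-mono : ∀ {i j} → i Fin.< j → f i Fin.< f j) where
  private
    ≤-cases : ∀ {i j : Fin m} → i Fin.≤ j → i Fin.< j ⊎ i ≡ j
    ≤-cases p = ⊎.map₂ Fin.toℕ-injective (ℕ.m≤n⇒m<n∨m≡n p)

  mono-≤ : ∀ {i j} → i Fin.≤ j → f i Fin.≤ f j
  mono-≤ {i} {j} p = ⊎.[ (λ q → ℕ.<⇒≤ (f-mono {i} {j} q)) , (λ { ≡.refl → ℕ.≤-refl }) ]′ (≤-cases p)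

  reflect-≤ : ∀ {i j} → f i Fin.≤ f j → i Fin.≤ j
  reflect-≤ {i} {j} p = ℕ.≮⇒≥ λ q → ℕ.<⇒≱ (f-mono {j} {i} q) p

  reflect-< : ∀ {i j} → f i Fin.< f j → i Fin.< j
  reflect-< {i} {j} p = ℕ.≰⇒> λ q → ℕ.<⇒≱ p (mono-≤ {j} {i} q)

prefixSplit : ∀ a b → Split (a ℕ.+ b) a b
prefixSplit a b = record
  { cano = Fin.+↔⊎
  ; monoˡ = λ {i} {j} p → ≡.subst₂ ℕ._<_ (≡.sym (Fin.toℕ-↑ˡ i b)) (≡.sym (Fin.toℕ-↑ˡ j b)) p
  ; monoʳ = λ {i} {j} p → ≡.subst₂ ℕ._<_ (≡.sym (Fin.toℕ-↑ʳ a i)) (≡.sym (Fin.toℕ-↑ʳ a j)) (ℕ.+-monoʳ-< a p)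
  }

subsetSplit : ∀ {n} (I : Subset n) → Split n ∣ I ∣ ∣ ∁ I ∣
subsetSplit [] = record
  { cano = mk↔ₛ′ (λ ()) (λ { (inj₁ ()) ; (inj₂ ()) }) (λ { (inj₁ ()) ; (inj₂ ()) }) (λ ())
  ; monoˡ = λ { {()} }
  ; monoʳ = λ { {()} }
  }
subsetSplit (inside ∷ I) = record
  { cano = mk↔ₛ′ to from to-from from-to
  ; monoˡ = λ { {zero} {suc j} _ → ℕ.s≤s ℕ.z≤n ; {suc i} {suc j} p → ℕ.s≤s (I.monoˡ (ℕ.s≤s⁻¹ p)) }
  ; monoʳ = λ p → ℕ.s≤s (I.monoʳ p)
  }
  where
  module I = Split (subsetSplit I)
  to : Fin _ → Fin _ ⊎ Fin _
  to zero    = inj₁ zero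
  to (suc k) = ⊎.map₁ suc (I.to k)
  from : Fin _ ⊎ Fin _ → Fin _
  from (inj₁ zero)    = zero
  from (inj₁ (suc i)) = suc (I.from (inj₁ i))
  from (inj₂ j)       = suc (I.from (inj₂ j))
  to-from : ∀ x → to (from x) ≡ x
  to-from (inj₁ zero)    = ≡.refl
  to-from (inj₁ (suc i)) = ≡.cong (⊎.map₁ suc) (I.strictlyInverseˡ (inj₁ i))
  to-from (inj₂ j)       = ≡.cong (⊎.map₁ suc) (I.strictlyInverseˡ (inj₂ j))
  from-suc : ∀ x → from (⊎.map₁ suc x) ≡ suc (I.from x)
  from-suc (inj₁ i) = ≡.refl
  from-suc (inj₂ j) = ≡.refl
  from-to : ∀ k → from (to k) ≡ k
  from-to zero    = ≡.refl
  from-to (suc k) = ≡.trans (from-suc (I.to k)) (≡.cong suc (I.strictlyInverseʳ k))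
subsetSplit (outside ∷ I) = record
  { cano = mk↔ₛ′ to from to-from from-to
  ; monoˡ = λ p → ℕ.s≤s (I.monoˡ p)
  ; monoʳ = λ { {zero} {suc j} _ → ℕ.s≤s ℕ.z≤n ; {suc i} {suc j} p → ℕ.s≤s (I.monoʳ (ℕ.s≤s⁻¹ p)) }
  }
  where
  module I = Split (subsetSplit I)
  to : Fin _ → Fin _ ⊎ Fin _
  to zero    = inj₂ zero
  to (suc k) = ⊎.map₂ suc (I.to k)
  from : Fin _ ⊎ Fin _ → Fin _
  from (inj₁ i)       = suc (I.from (inj₁ i))
  from (inj₂ zero)    = zero
  from (inj₂ (suc j)) = suc (I.from (inj₂ j))
  to-from : ∀ x → to (from x) ≡ x
  to-from (inj₁ i)       = ≡.cong (⊎.map₂ suc) (I.strictlyInverseˡ (inj₁ i))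
  to-from (inj₂ zero)    = ≡.refl
  to-from (inj₂ (suc j)) = ≡.cong (⊎.map₂ suc) (I.strictlyInverseˡ (inj₂ j))
  from-suc : ∀ x → from (⊎.map₂ suc x) ≡ suc (I.from x)
  from-suc (inj₁ i) = ≡.refl
  from-suc (inj₂ j) = ≡.refl
  from-to : ∀ k → from (to k) ≡ k
  from-to zero    = ≡.refl
  from-to (suc k) = ≡.trans (from-suc (I.to k)) (≡.cong suc (I.strictlyInverseʳ k))

subsets : ∀ n → List (Subset n)
subsets zero    = List.[ [] ]
subsets (suc n) = map (inside ∷_) (subsets n) ++ map (outside ∷_) (subsets n)

record NaturalUnitIntervalOrder (n : ℕ) : Set₁ where
  infix 4 _≼_
  field
    _≼_               : Rel (Fin n) 0ℓ
    isDecPartialOrder : IsDecPartialOrder _≡_ _≼_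
    natural           : ∀ {i j} → i ≼ j → i Fin.≤ j
    interval          : ∀ {i j k l} → j ≼ k → j ≢ k → i Fin.≤ j → k Fin.≤ l → i ≼ l
  open IsDecPartialOrder isDecPartialOrder public
    using (isPartialOrder) renaming (refl to ≼-refl; trans to ≼-trans; antisym to ≼-antisym; _≤?_ to _≼?_)

open NaturalUnitIntervalOrder

orderDecSetoid : ℕ → DecSetoid (lsuc 0ℓ) 0ℓ
orderDecSetoid n = record
  { Carrier = NaturalUnitIntervalOrder n
  ; _≈_ = λ π ρ → ∀ i j → _≼_ π i j ⇔ _≼_ ρ i j
  ; isDecEquivalence = record
    { isEquivalence = record
      { refl = λ _ _ → mk⇔ id id
      ; sym = λ p i j → mk⇔ (E.from (p i j)) (E.to (p i j))
      ; trans = λ p q i j → mk⇔ (E.to (q i j) ∘ E.to (p i j)) (E.from (p i j) ∘ E.from (q i j))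
      }
    ; _≟_ = λ π ρ → Fin.all? λ i → Fin.all? λ j →
        map′ (λ (f , g) → mk⇔ f g) (λ e → E.to e , E.from e)
          ((_≼?_ π i j →-dec _≼?_ ρ i j) ×-dec (_≼?_ ρ i j →-dec _≼?_ π i j))
    }
  }
  where module E = Equivalence

restrict : ∀ {m n} (f : Fin m → Fin n) → (∀ {i j} → i Fin.< j → f i Fin.< f j) →
           NaturalUnitIntervalOrder n → NaturalUnitIntervalOrder m
restrict f f-mono π = record
  { _≼_ = λ i j → _≼_ π (f i) (f j)
  ; isDecPartialOrder = record
    { isPartialOrder = record
      { isPreorder = record
        { isEquivalence = ≡.isEquivalence
        ; reflexive = λ { ≡.refl → ≼-refl π }
        ; trans = ≼-trans π
        }
      ; antisym = λ p q → injective (≼-antisym π p q)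
      }
    ; _≟_ = Fin._≟_
    ; _≤?_ = λ i j → _≼?_ π (f i) (f j)
    }
  ; natural = λ p → reflect-≤ f f-mono (natural π p)
  ; interval = λ p j≢k q r → interval π p (j≢k ∘ injective) (mono-≤ f f-mono q) (mono-≤ f f-mono r)
  }
  where
  injective : ∀ {i j} → f i ≡ f j → i ≡ j
  injective p = Fin.≤-antisym (reflect-≤ f f-mono (ℕ.≤-reflexive (≡.cong Fin.toℕ p)))
                              (reflect-≤ f f-mono (ℕ.≤-reflexive (≡.cong Fin.toℕ (≡.sym p))))

infixr 6 _⋆_
_⋆_ : ∀ {n m} → NaturalUnitIntervalOrder n → NaturalUnitIntervalOrder m → NaturalUnitIntervalOrder (n ℕ.+ m)
_⋆_ {n} {m} π ρ = record
  { _≼_ = λ i j → splitAt n i ≤⋆ splitAt n j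
  ; isDecPartialOrder = record
    { isPartialOrder = record
      { isPreorder = record
        { isEquivalence = ≡.isEquivalence
        ; reflexive = λ { {i} ≡.refl → ≤⋆-refl (splitAt n i) }
        ; trans = λ {i} {j} {k} → ≤⋆-trans (splitAt n i) (splitAt n j) (splitAt n k)
        }
      ; antisym = λ {i} {j} p q → splitAt-injective (≤⋆-antisym (splitAt n i) (splitAt n j) p q)
      }
    ; _≟_ = Fin._≟_
    ; _≤?_ = λ i j → ≤⋆? (splitAt n i) (splitAt n j)
    }
  ; natural = λ {i} {j} p → ≡.subst₂ Fin._≤_ (Fin.join-splitAt n m i) (Fin.join-splitAt n m j)
      (≤⋆-natural (splitAt n i) (splitAt n j) p)
  ; interval = λ {i} {j} {k} {l} p j≢k q r →
      ≤⋆-interval (splitAt n i) (splitAt n j) (splitAt n k) (splitAt n l) p (j≢k ∘ splitAt-injective)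
        (≡.subst₂ Fin._≤_ (≡.sym (Fin.join-splitAt n m i)) (≡.sym (Fin.join-splitAt n m j)) q)
        (≡.subst₂ Fin._≤_ (≡.sym (Fin.join-splitAt n m k)) (≡.sym (Fin.join-splitAt n m l)) r)
  }
  where
  infix 4 _≤⋆_
  _≤⋆_ : Rel (Fin n ⊎ Fin m) 0ℓ
  inj₁ i ≤⋆ inj₁ j = _≼_ π i j
  inj₁ i ≤⋆ inj₂ j = ⊤
  inj₂ i ≤⋆ inj₁ j = ⊥
  inj₂ i ≤⋆ inj₂ j = _≼_ ρ i j

  ≤⋆? : Decidable _≤⋆_
  ≤⋆? (inj₁ i) (inj₁ j) = _≼?_ π i j
  ≤⋆? (inj₁ i) (inj₂ j) = yes tt
  ≤⋆? (inj₂ i) (inj₁ j) = no id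
  ≤⋆? (inj₂ i) (inj₂ j) = _≼?_ ρ i j

  ≤⋆-refl : ∀ x → x ≤⋆ x
  ≤⋆-refl (inj₁ i) = ≼-refl π
  ≤⋆-refl (inj₂ i) = ≼-refl ρ

  ≤⋆-trans : ∀ x y z → x ≤⋆ y → y ≤⋆ z → x ≤⋆ z
  ≤⋆-trans (inj₁ i) (inj₁ j) (inj₁ k) p q = ≼-trans π p q
  ≤⋆-trans (inj₁ i) (inj₁ j) (inj₂ k) p q = tt
  ≤⋆-trans (inj₁ i) (inj₂ j) (inj₂ k) p q = tt
  ≤⋆-trans (inj₂ i) (inj₂ j) (inj₂ k) p q = ≼-trans ρ p q

  ≤⋆-antisym : ∀ x y → x ≤⋆ y → y ≤⋆ x → x ≡ y
  ≤⋆-antisym (inj₁ i) (inj₁ j) p q = ≡.cong inj₁ (≼-antisym π p q)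
  ≤⋆-antisym (inj₂ i) (inj₂ j) p q = ≡.cong inj₂ (≼-antisym ρ p q)

  splitAt-injective : ∀ {i j} → splitAt n i ≡ splitAt n j → i ≡ j
  splitAt-injective {i} {j} p =
    ≡.trans (≡.sym (Fin.join-splitAt n m i)) (≡.trans (≡.cong (Fin.join n m) p) (Fin.join-splitAt n m j))

  _≤ʲ_ : Rel (Fin n ⊎ Fin m) 0ℓ
  x ≤ʲ y = Fin.join n m x Fin.≤ Fin.join n m y

  ˡ-mono : ∀ {i j} → i Fin.≤ j → inj₁ i ≤ʲ inj₁ j
  ˡ-mono {i} {j} = mono-≤ (Split.embedˡ (prefixSplit n m)) (Split.monoˡ (prefixSplit n m))

  ˡ-reflect : ∀ {i j} → inj₁ i ≤ʲ inj₁ j → i Fin.≤ j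
  ˡ-reflect = reflect-≤ (Split.embedˡ (prefixSplit n m)) (Split.monoˡ (prefixSplit n m))

  ʳ-mono : ∀ {i j} → i Fin.≤ j → inj₂ i ≤ʲ inj₂ j
  ʳ-mono = mono-≤ (Split.embedʳ (prefixSplit n m)) (Split.monoʳ (prefixSplit n m))

  ʳ-reflect : ∀ {i j} → inj₂ i ≤ʲ inj₂ j → i Fin.≤ j
  ʳ-reflect = reflect-≤ (Split.embedʳ (prefixSplit n m)) (Split.monoʳ (prefixSplit n m))

  ˡ<ʳ : ∀ i j → Fin.join n m (inj₁ i) Fin.< Fin.join n m (inj₂ j)
  ˡ<ʳ i j = ≡.subst₂ ℕ._<_ (≡.sym (Fin.toℕ-↑ˡ i m)) (≡.sym (Fin.toℕ-↑ʳ n j)) (ℕ.m≤n⇒m≤n+o _ (Fin.toℕ<n i))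

  ≤⋆-natural : ∀ x y → x ≤⋆ y → x ≤ʲ y
  ≤⋆-natural (inj₁ i) (inj₁ j) p = ˡ-mono (natural π p)
  ≤⋆-natural (inj₁ i) (inj₂ j) p = ℕ.<⇒≤ (ˡ<ʳ i j)
  ≤⋆-natural (inj₂ i) (inj₂ j) p = ʳ-mono (natural ρ p)

  ≤⋆-interval : ∀ x y z w → y ≤⋆ z → (y ≡ z → ⊥) → x ≤ʲ y → z ≤ʲ w → x ≤⋆ w
  ≤⋆-interval (inj₁ i) _        _        (inj₂ l) p y≢z q r = tt
  ≤⋆-interval (inj₁ i) (inj₁ j) (inj₁ k) (inj₁ l) p y≢z q r =
    interval π p (y≢z ∘ ≡.cong inj₁) (ˡ-reflect q) (ˡ-reflect r)
  ≤⋆-interval (inj₂ i) (inj₂ j) (inj₂ k) (inj₂ l) p y≢z q r =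
    interval ρ p (y≢z ∘ ≡.cong inj₂) (ʳ-reflect q) (ʳ-reflect r)
  ≤⋆-interval (inj₁ i) _        (inj₂ k) (inj₁ l) p y≢z q r = contradiction r (ℕ.<⇒≱ (ˡ<ʳ l k))
  ≤⋆-interval (inj₂ i) _        (inj₂ k) (inj₁ l) p y≢z q r = contradiction r (ℕ.<⇒≱ (ˡ<ʳ l k))
  ≤⋆-interval (inj₂ i) (inj₁ j) _        _        p y≢z q r = contradiction q (ℕ.<⇒≱ (ˡ<ʳ j i))

empty : NaturalUnitIntervalOrder 0
empty = record
  { _≼_ = λ ()
  ; isDecPartialOrder = record
    { isPartialOrder = record
      { isPreorder = record
        { isEquivalence = ≡.isEquivalence
        ; reflexive = λ { {()} }
        ; trans = λ { {()} }
        }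
      ; antisym = λ { {()} }
      }
    ; _≟_ = Fin._≟_
    ; _≤?_ = λ ()
    }
  ; natural = λ { {()} }
  ; interval = λ { {()} }
  }

restrictˡ : ∀ {n a b} → Split n a b → NaturalUnitIntervalOrder n → NaturalUnitIntervalOrder a
restrictˡ I = restrict (Split.embedˡ I) (Split.monoˡ I)

restrictʳ : ∀ {n a b} → Split n a b → NaturalUnitIntervalOrder n → NaturalUnitIntervalOrder b
restrictʳ I = restrict (Split.embedʳ I) (Split.monoʳ I)

asc : ∀ {n a b} → Split n a b → NaturalUnitIntervalOrder n → ℕ
asc {n} I π = length (filter
  (λ (i , j) → (Split.member I i Bool.≟ true) ×-dec (Split.member I j Bool.≟ false)
    ×-dec (i Fin.<? j) ×-dec ¬? (_≼?_ π i j))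
  (cartesianProduct (allFin n) (allFin n)))

-- Guay-Paquet's Hopf algebra of incomparability graphs over R, with the
-- indeterminate specialised to t ∈ R.
module IncomparabilityGraphs {r ℓr} (R : CommutativeRing r ℓr) (t : CommutativeRing.Carrier R) where

  open CommutativeRing R
  open LinearAlgebra R
  open import Algebra.Properties.Semiring.Exp semiring using (_^_)

  IGₙ : ℕ → LeftModule ring (lsuc 0ℓ ⊔ r) (lsuc 0ℓ ⊔ ℓr)
  IGₙ n = Free (orderDecSetoid n)

  inc : ∀ {n} → NaturalUnitIntervalOrder n → LeftModule.Carrierᴹ (IGₙ n)
  inc π = List.[ 1# , π ]

  IG-space : LeftModule ring (lsuc 0ℓ ⊔ r) (lsuc 0ℓ ⊔ ℓr)
  IG-space = ⨁ IGₙ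

  product : ∀ {n m} → LeftModule.Carrierᴹ (IGₙ n) → LeftModule.Carrierᴹ (IGₙ m) → LeftModule.Carrierᴹ (IGₙ (n ℕ.+ m))
  product = cartesianProductWith λ (s , π) (s′ , ρ) → s * s′ , π ⋆ ρ

  basisCoproduct : ∀ {n} → NaturalUnitIntervalOrder n → LeftModule.Carrierᴹ (IG-space ⊗ IG-space)
  basisCoproduct {n} π = map
    (λ I → let S = subsetSplit I in
        LeftModule._*ₗ_ IG-space (t ^ asc S π) (homogeneous IGₙ ∣ I ∣ (inc (restrictˡ S π)))
      , homogeneous IGₙ ∣ ∁ I ∣ (inc (restrictʳ S π)))
    (subsets n)

  coproduct : ∀ {n} → LeftModule.Carrierᴹ (IGₙ n) → LeftModule.Carrierᴹ (IG-space ⊗ IG-space)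
  coproduct = concatMap λ (s , π) → LeftModule._*ₗ_ (IG-space ⊗ IG-space) s (basisCoproduct π)

  IG : RawHopfAlgebra (lsuc 0ℓ ⊔ r) (lsuc 0ℓ ⊔ ℓr)
  IG = record
    { space = IG-space
    ; multiplication = concatMap λ (x , y) →
        cartesianProductWith (λ (n , u) (m , v) → n ℕ.+ m , product u v) x y
    ; unit = λ s → homogeneous IGₙ 0 List.[ s , empty ]
    ; comultiplication = concatMap λ (_ , u) → coproduct u
    ; counit = λ x → foldr (λ (s , _) c → s + c) 0# (degreePart IGₙ 0 x)
    }

module UnipotentGroups {c ℓ₁ ℓ₂} (F : FiniteField c ℓ₁ ℓ₂) where

  open FiniteField F hiding (zero; _≟_; order-nonZero)
  open Sum semiring using (sum; sum-cong-≋; sum-permute; sum-replicate-zero; ∑-comm; *-distribˡ-sum; *-distribʳ-sum)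

  Matrix : ℕ → Set c
  Matrix n = Fin n → Fin n → Carrier

  1ₘ : ∀ {n} → Matrix n
  1ₘ i j = if does (i Fin.≟ j) then 1# else 0#

  infixl 7 _·_
  _·_ : ∀ {n} → Matrix n → Matrix n → Matrix n
  (g · h) i k = sum λ j → g i j * h j k

  sum-cong : ∀ {n} (f h : Fin n → Carrier) → (∀ i → f i ≈ h i) → sum f ≈ sum h
  sum-cong {n} f h p = sum-cong-≋ {n} {f} {h} p

  sum-zero : ∀ {n} (f : Fin n → Carrier) → (∀ i → f i ≈ 0#) → sum f ≈ 0#
  sum-zero {n} f p = trans (sum-cong f (λ _ → 0#) p) (sum-replicate-zero n)

  1ₘ-off : ∀ {n} (i j : Fin n) → i ≢ j → 1ₘ i j ≈ 0#
  1ₘ-off i j i≢j with i Fin.≟ j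
  ... | yes p = contradiction p i≢j
  ... | no _  = refl

  1ₘ-embed : ∀ {m n} (f : Fin m → Fin n) → (∀ {i j} → f i ≡ f j → i ≡ j) → ∀ i j → 1ₘ (f i) (f j) ≈ 1ₘ i j
  1ₘ-embed f f-injective i j with i Fin.≟ j | f i Fin.≟ f j
  ... | yes p | yes q = refl
  ... | no ¬p | no ¬q = refl
  ... | yes p | no ¬q = contradiction (≡.cong f p) ¬q
  ... | no ¬p | yes q = contradiction (f-injective q) ¬p

  sum-1ˡ : ∀ {n} i (f : Fin n → Carrier) → sum (λ j → 1ₘ i j * f j) ≈ f i
  sum-1ˡ zero    f = trans (+-cong (*-identityˡ _) (sum-zero (λ j → 0# * f (suc j)) λ j → zeroˡ _)) (+-identityʳ _)
  sum-1ˡ (suc i) f = trans (+-cong (zeroˡ _) (sum-1ˡ i (f ∘ suc))) (+-identityˡ _)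

  sum-1ʳ : ∀ {n} i (f : Fin n → Carrier) → sum (λ j → f j * 1ₘ j i) ≈ f i
  sum-1ʳ zero    f = trans (+-cong (*-identityʳ _) (sum-zero (λ j → f (suc j) * 0#) λ j → zeroʳ _)) (+-identityʳ _)
  sum-1ʳ (suc i) f = trans (+-cong (zeroʳ _) (sum-1ʳ i (f ∘ suc))) (+-identityˡ _)

  ·-assoc : ∀ {n} (g h k : Matrix n) i l → ((g · h) · k) i l ≈ (g · (h · k)) i l
  ·-assoc {n} g h k i l = begin
    sum (λ j → sum (λ m → g i m * h m j) * k j l)
      ≈⟨ sum-cong (λ j → sum (λ m → g i m * h m j) * k j l) (λ j → sum (λ m → g i m * (h m j * k j l))) (λ j →
           trans (*-distribʳ-sum (k j l) (λ m → g i m * h m j))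
                 (sum-cong (λ m → g i m * h m j * k j l) (λ m → g i m * (h m j * k j l)) λ m → *-assoc _ _ _)) ⟩
    sum (λ j → sum (λ m → g i m * (h m j * k j l)))
      ≈⟨ ∑-comm (λ j m → g i m * (h m j * k j l)) ⟩
    sum (λ m → sum (λ j → g i m * (h m j * k j l)))
      ≈⟨ sum-cong (λ m → g i m * sum (λ j → h m j * k j l)) (λ m → sum (λ j → g i m * (h m j * k j l)))
           (λ m → *-distribˡ-sum (g i m) (λ j → h m j * k j l)) ⟨
    sum (λ m → g i m * sum (λ j → h m j * k j l)) ∎
    where open SetoidReasoning setoid

  record Pattern (n : ℕ) : Set₁ where
    infix 4 _∼_ _∼?_
    field
      _∼_        : Rel (Fin n) 0ℓ
      _∼?_       : Decidable _∼_
      transitive : ∀ {i j k} → i Fin.< j → j Fin.< k → i ∼ j → j ∼ k → i ∼ k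

  open Pattern

  -- Matrices g with (g - 1)ᵢⱼ ≠ 0 only if i < j and i ∼ j; the condition is
  -- stated in contrapositive form, equality in F and _∼_ being decidable.
  record PatternMatrix {n} (P : Pattern n) : Set (c ⊔ ℓ₁) where
    field
      entry   : Matrix n
      offPattern : ∀ i j → ¬ (i Fin.< j × _∼_ P i j) → entry i j ≈ 1ₘ i j

  open PatternMatrix public

  infixl 7 _∙ₚ_
  _∙ₚ_ : ∀ {n} {P : Pattern n} → PatternMatrix P → PatternMatrix P → PatternMatrix P
  _∙ₚ_ {n} {P} g h = record
    { entry = entry g · entry h
    ; offPattern = λ i k ¬ik → trans
        (sum-cong (λ j → entry g i j * entry h j k) (λ j → 1ₘ i j * 1ₘ j k) (λ j → step i j k ¬ik))
        (sum-1ˡ i (λ j → 1ₘ j k))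
    }
    where
    step : ∀ i j k → ¬ (i Fin.< k × _∼_ P i k) → entry g i j * entry h j k ≈ 1ₘ i j * 1ₘ j k
    step i j k ¬ik with (i Fin.<? j) ×-dec (_∼?_ P i j) | (j Fin.<? k) ×-dec (_∼?_ P j k)
    ... | no ¬ij | no ¬jk = *-cong (offPattern g i j ¬ij) (offPattern h j k ¬jk)
    ... | yes (i<j , ij) | yes (j<k , jk) = contradiction (ℕ.<-trans i<j j<k , transitive P i<j j<k ij jk) ¬ik
    ... | yes ij | no ¬jk = trans (*-congˡ (trans (offPattern h j k ¬jk) jk≈0)) (trans (zeroʳ _) (sym (trans (*-congˡ jk≈0) (zeroʳ _))))
      where jk≈0 = 1ₘ-off j k (λ { ≡.refl → ¬ik ij })
    ... | no ¬ij | yes jk = trans (*-congʳ (trans (offPattern g i j ¬ij) ij≈0)) (trans (zeroˡ _) (sym (trans (*-congʳ ij≈0) (zeroˡ _))))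
      where ij≈0 = 1ₘ-off i j (λ { ≡.refl → ¬ik jk })

  1ₚ : ∀ {n} {P : Pattern n} → PatternMatrix P
  1ₚ = record { entry = 1ₘ ; offPattern = λ _ _ _ → refl }

  tailPattern : ∀ {n} → Pattern (suc n) → Pattern n
  tailPattern P = record
    { _∼_ = λ i j → _∼_ P (suc i) (suc j)
    ; _∼?_ = λ i j → _∼?_ P (suc i) (suc j)
    ; transitive = λ p q → transitive P (ℕ.s≤s p) (ℕ.s≤s q)
    }

  tailMatrix : ∀ {n} {P : Pattern (suc n)} → PatternMatrix P → PatternMatrix (tailPattern P)
  tailMatrix g = record
    { entry = λ i j → entry g (suc i) (suc j)
    ; offPattern = λ i j ¬ij → offPattern g (suc i) (suc j) (λ (p , q) → ¬ij (ℕ.s≤s⁻¹ p , q))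
    }

  infix 8 _⁻¹ₚ
  _⁻¹ₚ : ∀ {n} {P : Pattern n} → PatternMatrix P → PatternMatrix P
  _⁻¹ₚ {zero}      g = record { entry = λ () ; offPattern = λ () }
  _⁻¹ₚ {suc n} {P} g = record { entry = inv ; offPattern = off }
    where
    g′ = tailMatrix g ⁻¹ₚ
    inv : Matrix (suc n)
    inv zero    zero    = 1#
    inv zero    (suc k) = - sum (λ j → entry g zero (suc j) * entry g′ j k)
    inv (suc i) zero    = 0#
    inv (suc i) (suc k) = entry g′ i k
    off : ∀ i k → ¬ (i Fin.< k × _∼_ P i k) → inv i k ≈ 1ₘ i k
    off zero    zero    _   = refl
    off zero    (suc k) ¬0k = trans (-‿cong (sum-zero (λ j → entry g zero (suc j) * entry g′ j k) vanish)) (RingProperties.-0#≈0# ring)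
      where
      vanish : ∀ j → entry g zero (suc j) * entry g′ j k ≈ 0#
      vanish j with _∼?_ P zero (suc j)
      ... | no ¬0j = trans (*-congʳ (offPattern g zero (suc j) (λ (_ , p) → ¬0j p))) (zeroˡ _)
      ... | yes 0j = trans (*-congˡ (trans (offPattern g′ j k
            (λ (j<k , jk) → ¬0k (ℕ.s≤s ℕ.z≤n , transitive P (ℕ.s≤s ℕ.z≤n) (ℕ.s≤s j<k) 0j jk)))
            (1ₘ-off j k λ { ≡.refl → ¬0k (ℕ.s≤s ℕ.z≤n , 0j) }))) (zeroʳ _)
    off (suc i) zero    _   = refl
    off (suc i) (suc k) ¬ik = offPattern g′ i k (λ (p , q) → ¬ik (ℕ.s≤s p , q))

  ⁻¹ₚ-inverseʳ : ∀ {n} {P : Pattern n} (g : PatternMatrix P) i k → (entry g · entry (g ⁻¹ₚ)) i k ≈ 1ₘ i k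
  ⁻¹ₚ-inverseʳ {suc n} {P} g zero zero =
    trans (+-cong (trans (*-identityʳ _) (offPattern g zero zero (λ { (() , _) }))) (sum-zero (λ j → entry g zero (suc j) * 0#) λ j → zeroʳ _)) (+-identityʳ 1#)
  ⁻¹ₚ-inverseʳ {suc n} {P} g zero (suc k) =
    trans (+-congʳ (trans (*-congʳ (offPattern g zero zero (λ { (() , _) }))) (*-identityˡ _))) (-‿inverseˡ _)
  ⁻¹ₚ-inverseʳ {suc n} {P} g (suc i) zero =
    trans (+-cong (trans (*-congʳ (offPattern g (suc i) zero (λ { (() , _) }))) (zeroˡ _)) (sum-zero (λ j → entry g (suc i) (suc j) * 0#) λ j → zeroʳ _)) (+-identityʳ 0#)
  ⁻¹ₚ-inverseʳ {suc n} {P} g (suc i) (suc k) =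
    trans (+-cong (trans (*-congʳ (offPattern g (suc i) zero (λ { (() , _) }))) (zeroˡ _)) (⁻¹ₚ-inverseʳ (tailMatrix g) i k)) (+-identityˡ _)

  PatternGroup : ∀ {n} → Pattern n → Group (c ⊔ ℓ₁) ℓ₁
  PatternGroup {n} P = record
    { Carrier = PatternMatrix P
    ; _≈_ = _≋_
    ; _∙_ = _∙ₚ_
    ; ε = 1ₚ
    ; _⁻¹ = _⁻¹ₚ
    ; isGroup = record
      { isMonoid = record
        { isSemigroup = record
          { isMagma = record
            { isEquivalence = record
              { refl = λ _ _ → refl
              ; sym = λ p i j → sym (p i j)
              ; trans = λ p q i j → trans (p i j) (q i j)
              }
            ; ∙-cong = λ {x} {y} {u} {v} → ∙-cong x y u v
            }
          ; assoc = assoc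
          }
        ; identity = identityˡ , identityʳ
        }
      ; inverse = inverseˡ , inverseʳ
      ; ⁻¹-cong = λ {x} {y} p → begin
          x ⁻¹ₚ                    ≈⟨ identityʳ (x ⁻¹ₚ) ⟨
          x ⁻¹ₚ ∙ₚ 1ₚ              ≈⟨ ∙-cong (x ⁻¹ₚ) (x ⁻¹ₚ) 1ₚ (x ∙ₚ y ⁻¹ₚ) (λ _ _ → refl) (λ i j → trans (sym (inverseʳ y i j)) (∙-cong y x (y ⁻¹ₚ) (y ⁻¹ₚ) (λ i j → sym (p i j)) (λ _ _ → refl) i j)) ⟩
          x ⁻¹ₚ ∙ₚ (x ∙ₚ y ⁻¹ₚ)    ≈⟨ assoc (x ⁻¹ₚ) x (y ⁻¹ₚ) ⟨
          x ⁻¹ₚ ∙ₚ x ∙ₚ y ⁻¹ₚ      ≈⟨ ∙-cong (x ⁻¹ₚ ∙ₚ x) 1ₚ (y ⁻¹ₚ) (y ⁻¹ₚ) (inverseˡ x) (λ _ _ → refl) ⟩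
          1ₚ ∙ₚ y ⁻¹ₚ              ≈⟨ identityˡ (y ⁻¹ₚ) ⟩
          y ⁻¹ₚ                    ∎
      }
    }
    where
    _≋_ : Rel (PatternMatrix P) ℓ₁
    g ≋ h = ∀ i j → entry g i j ≈ entry h i j
    S : Setoid (c ⊔ ℓ₁) ℓ₁
    S = record
      { Carrier = PatternMatrix P
      ; _≈_ = _≋_
      ; isEquivalence = record
        { refl = λ _ _ → refl
        ; sym = λ p i j → sym (p i j)
        ; trans = λ p q i j → trans (p i j) (q i j)
        }
      }
    open SetoidReasoning S
    ∙-cong : ∀ x y u v → x ≋ y → u ≋ v → (x ∙ₚ u) ≋ (y ∙ₚ v)
    ∙-cong x y u v p q i k = sum-cong (λ j → entry x i j * entry u j k) (λ j → entry y i j * entry v j k) λ j → *-cong (p i j) (q j k)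
    assoc : ∀ x y z → (x ∙ₚ y ∙ₚ z) ≋ (x ∙ₚ (y ∙ₚ z))
    assoc x y z = ·-assoc (entry x) (entry y) (entry z)
    identityˡ : ∀ x → (1ₚ ∙ₚ x) ≋ x
    identityˡ x i k = sum-1ˡ i (λ j → entry x j k)
    identityʳ : ∀ x → (x ∙ₚ 1ₚ) ≋ x
    identityʳ x i k = sum-1ʳ k (λ j → entry x i j)
    inverseʳ : ∀ x → (x ∙ₚ x ⁻¹ₚ) ≋ 1ₚ
    inverseʳ x = ⁻¹ₚ-inverseʳ x
    inverseˡ : ∀ x → (x ⁻¹ₚ ∙ₚ x) ≋ 1ₚ
    inverseˡ x = begin
      y ∙ₚ x                  ≈⟨ identityʳ (y ∙ₚ x) ⟨
      y ∙ₚ x ∙ₚ 1ₚ            ≈⟨ ∙-cong (y ∙ₚ x) (y ∙ₚ x) (y ∙ₚ z) 1ₚ (λ _ _ → refl) (inverseʳ y) ⟨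
      y ∙ₚ x ∙ₚ (y ∙ₚ z)      ≈⟨ assoc (y ∙ₚ x) y z ⟨
      y ∙ₚ x ∙ₚ y ∙ₚ z        ≈⟨ ∙-cong (y ∙ₚ x ∙ₚ y) (y ∙ₚ (x ∙ₚ y)) z z (assoc y x y) (λ _ _ → refl) ⟩
      y ∙ₚ (x ∙ₚ y) ∙ₚ z      ≈⟨ ∙-cong (y ∙ₚ (x ∙ₚ y)) (y ∙ₚ 1ₚ) z z (∙-cong y y (x ∙ₚ y) 1ₚ (λ _ _ → refl) (inverseʳ x)) (λ _ _ → refl) ⟩
      y ∙ₚ 1ₚ ∙ₚ z            ≈⟨ ∙-cong (y ∙ₚ 1ₚ) y z z (identityʳ y) (λ _ _ → refl) ⟩
      y ∙ₚ z                  ≈⟨ inverseʳ y ⟩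
      1ₚ                      ∎
      where
      y = x ⁻¹ₚ
      z = y ⁻¹ₚ

  module _ {n} (P : Pattern n) where
    private
      Cell : Fin n → Fin n → Setoid (c ⊔ ℓ₁) ℓ₁
      Cell i j = record
        { Carrier = Σ Carrier λ x → ¬ (i Fin.< j × _∼_ P i j) → x ≈ 1ₘ i j
        ; _≈_ = λ (x , _) (y , _) → x ≈ y
        ; isEquivalence = record { refl = refl ; sym = sym ; trans = trans }
        }

      Cell-finite : ∀ i j → Finite (Cell i j)
      Cell-finite i j with (i Fin.<? j) ×-dec (_∼?_ P i j)
      ... | yes p = transport-finite
        (record
          { to = proj₁
          ; from = λ x → x , λ ¬p → contradiction p ¬p
          ; to-cong = id
          ; from-cong = id
          ; inverse = id , id
          })
        finite
      ... | no ¬p = record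
        { size = 1
        ; enumeration = record
          { to = λ _ → zero
          ; from = λ _ → 1ₘ i j , λ _ → refl
          ; to-cong = λ _ → ≡.refl
          ; from-cong = λ _ → refl
          ; inverse = (λ { {zero} _ → ≡.refl }) , (λ { {x , q} _ → sym (q ¬p) })
          }
        }

    PatternGroup-finite : Finite (Group.setoid (PatternGroup P))
    PatternGroup-finite = transport-finite
      (record
        { to = λ g i j → entry g i j , offPattern g i j
        ; from = λ f → record { entry = λ i j → proj₁ (f i j) ; offPattern = λ i j → proj₂ (f i j) }
        ; to-cong = id
        ; from-cong = id
        ; inverse = id , id
        })
      (Π-finite λ i → Π-finite λ j → Cell-finite i j)

  fullPattern : ∀ n → Pattern n
  fullPattern n = record { _∼_ = λ _ _ → ⊤ ; _∼?_ = λ _ _ → yes tt ; transitive = λ _ _ _ _ → tt }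

  UT : ℕ → Group (c ⊔ ℓ₁) ℓ₁
  UT n = PatternGroup (fullPattern n)

  UT-finite : ∀ n → Finite (Group.setoid (UT n))
  UT-finite n = PatternGroup-finite (fullPattern n)

  module _ {n} {P Q : Pattern n} (P⊆Q : ∀ {i j} → i Fin.< j → _∼_ P i j → _∼_ Q i j) where
    open MorphismStructures.MagmaMorphisms (Group.rawMagma (PatternGroup P)) (Group.rawMagma (PatternGroup Q))

    include : PatternMatrix P → PatternMatrix Q
    include g = record
      { entry = entry g
      ; offPattern = λ i j ¬ij → offPattern g i j (λ (p , q) → ¬ij (p , P⊆Q p q))
      }

    include-isHomomorphism : IsMagmaHomomorphism include
    include-isHomomorphism = record
      { isRelHomomorphism = record { cong = id }
      ; homo = λ _ _ _ _ → refl
      }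

  module Parabolic {n a b} (I : Split n a b) where

    open Split I

    levi radical parabolic : Pattern n
    levi = record
      { _∼_ = λ i j → member i ≡ member j
      ; _∼?_ = λ i j → member i Bool.≟ member j
      ; transitive = λ _ _ → ≡.trans
      }
    radical = record
      { _∼_ = λ i j → member i ≡ true × member j ≡ false
      ; _∼?_ = λ i j → (member i Bool.≟ true) ×-dec (member j Bool.≟ false)
      ; transitive = λ { _ _ (p , _) (_ , q) → p , q }
      }
    parabolic = record
      { _∼_ = λ i j → ¬ (member i ≡ false × member j ≡ true)
      ; _∼?_ = λ i j → ¬? ((member i Bool.≟ false) ×-dec (member j Bool.≟ true))
      ; transitive = λ {i} {j} {k} _ _ p q (r , s) → middle (member j) ≡.refl p q r s
      }
      where
      middle : ∀ {i j k} x → member j ≡ x → ¬ (member i ≡ false × member j ≡ true) →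
               ¬ (member j ≡ false × member k ≡ true) → member i ≡ false → member k ≡ true → ⊥
      middle true  e p q r s = p (r , e)
      middle false e p q r s = q (e , s)

    UL UR UP : Group (c ⊔ ℓ₁) ℓ₁
    UL = PatternGroup levi
    UR = PatternGroup radical
    UP = PatternGroup parabolic

    UR-finite : Finite (Group.setoid UR)
    UR-finite = PatternGroup-finite radical

    levi⊆parabolic : ∀ {i j} → i Fin.< j → _∼_ levi i j → _∼_ parabolic i j
    levi⊆parabolic _ e (p , q) with () ← ≡.trans (≡.sym p) (≡.trans e q)

    radical⊆parabolic : ∀ {i j} → i Fin.< j → _∼_ radical i j → _∼_ parabolic i j
    radical⊆parabolic _ (e , _) (p , _) with () ← ≡.trans (≡.sym e) p

    parabolic⊆full : ∀ {i j} → i Fin.< j → _∼_ parabolic i j → _∼_ (fullPattern n) i j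
    parabolic⊆full _ _ = tt

    private
      module UL = Group UL
      module UR = Group UR
      module UP = Group UP
      module UTa = Group (UT a)
      module UTb = Group (UT b)
      module UT×UT = Group (DirectProduct.group (UT a) (UT b))

      block : Bool → Bool → Carrier → Carrier
      block p q x = if does (p Bool.≟ q) then x else 0#

      block-cong : ∀ p q {x y} → x ≈ y → block p q x ≈ block p q y
      block-cong true  true  e = e
      block-cong true  false e = refl
      block-cong false true  e = refl
      block-cong false false e = e

      block-sum : ∀ {m} p q (f : Fin m → Carrier) → block p q (sum f) ≈ sum (λ i → block p q (f i))
      block-sum true  true  f = refl
      block-sum {m} true  false f = sym (sum-replicate-zero m)
      block-sum {m} false true  f = sym (sum-replicate-zero m)
      block-sum false false f = refl

      block-* : ∀ p q r {x y} → (p ≡ false → q ≡ true → x ≈ 0#) → (q ≡ false → r ≡ true → y ≈ 0#) →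
                block p r (x * y) ≈ block p q x * block q r y
      block-* true  true  true  u v = refl
      block-* true  true  false u v = sym (zeroʳ _)
      block-* true  false true  u v = trans (*-congˡ (v ≡.refl ≡.refl)) (trans (zeroʳ _) (sym (zeroˡ _)))
      block-* true  false false u v = sym (zeroˡ _)
      block-* false true  true  u v = sym (zeroˡ _)
      block-* false true  false u v = trans (*-congʳ (u ≡.refl ≡.refl)) (trans (zeroˡ _) (sym (zeroˡ _)))
      block-* false false true  u v = sym (zeroʳ _)
      block-* false false false u v = refl

      block-1ₘ : ∀ i j → block (member i) (member j) (1ₘ i j) ≈ 1ₘ i j
      block-1ₘ i j with member i Bool.≟ member j
      ... | yes _ = refl
      ... | no ¬p = sym (1ₘ-off i j (λ { ≡.refl → ¬p ≡.refl }))

      parabolic-zero : ∀ (g : UP.Carrier) {i j} → member i ≡ false → member j ≡ true → entry g i j ≈ 0#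
      parabolic-zero g {i} {j} p q = trans (offPattern g i j (λ (_ , r) → r (p , q)))
        (1ₘ-off i j λ { ≡.refl → contradiction (≡.trans (≡.sym p) q) λ () })

    -- The projection UP = UL ⋉ UR → UL, lr ↦ l; since xᵢⱼ = 1ᵢⱼ for i, j in the
    -- same block when x ∈ UR, the matrices lr and l have the same diagonal blocks.
    leviPart : UP.Carrier → UL.Carrier
    leviPart g = record
      { entry = λ i j → if does (member i Bool.≟ member j) then entry g i j else 0#
      ; offPattern = off
      }
      where
      off : ∀ i j → ¬ (i Fin.< j × member i ≡ member j) → block (member i) (member j) (entry g i j) ≈ 1ₘ i j
      off i j ¬ij with member i Bool.≟ member j
      ... | yes p = offPattern g i j (λ (q , _) → ¬ij (q , p))
      ... | no ¬p = sym (1ₘ-off i j (λ { ≡.refl → ¬p ≡.refl }))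

    leviPart-isHomomorphism : MorphismStructures.MagmaMorphisms.IsMagmaHomomorphism UP.rawMagma UL.rawMagma leviPart
    leviPart-isHomomorphism = record
      { isRelHomomorphism = record { cong = λ p i j → block-cong (member i) (member j) (p i j) }
      ; homo = λ g h i k → trans (block-sum (member i) (member k) (λ j → entry g i j * entry h j k))
          (sum-cong (λ j → block (member i) (member k) (entry g i j * entry h j k))
            (λ j → block (member i) (member j) (entry g i j) * block (member j) (member k) (entry h j k))
            λ j → block-* (member i) (member j) (member k) (parabolic-zero g) (parabolic-zero h))
      }

    private
      module leviPart = MorphismStructures.MagmaMorphisms.IsMagmaHomomorphism leviPart-isHomomorphism

      leviPart-radical : (x : UR.Carrier) → leviPart (include radical⊆parabolic x) UL.≈ UL.ε
      leviPart-radical x i j = trans (same (member i Bool.≟ member j)) (block-1ₘ i j)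
        where
        same : Dec (member i ≡ member j) → block (member i) (member j) (entry x i j) ≈ block (member i) (member j) (1ₘ i j)
        same (yes p) = block-cong (member i) (member j) (offPattern x i j
          (λ (_ , q , r) → contradiction (≡.trans (≡.sym q) (≡.trans p r)) λ ()))
        same (no ¬p) = off-block (member i) (member j) ¬p
          where
          off-block : ∀ p q {x y} → ¬ p ≡ q → block p q x ≈ block p q y
          off-block true  true  ¬e = contradiction ≡.refl ¬e
          off-block true  false ¬e = refl
          off-block false true  ¬e = refl
          off-block false false ¬e = contradiction ≡.refl ¬e

      toRadical : (g : UP.Carrier) → leviPart g UL.≈ UL.ε → UR.Carrier
      toRadical g p = record { entry = entry g ; offPattern = off }
        where
        off : ∀ i j → ¬ (i Fin.< j × member i ≡ true × member j ≡ false) → entry g i j ≈ 1ₘ i j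
        off i j ¬ij = cases (member i) (member j) ≡.refl ≡.refl (p i j)
          where
          cases : ∀ x y → member i ≡ x → member j ≡ y → block (member i) (member j) (entry g i j) ≈ 1ₘ i j → entry g i j ≈ 1ₘ i j
          cases true  true  e f h rewrite e | f = h
          cases false false e f h rewrite e | f = h
          cases true  false e f h = offPattern g i j (λ (q , _) → ¬ij (q , e , f))
          cases false true  e f h = offPattern g i j (λ (_ , r) → r (e , f))

      conjugate-radical : (u v : UP.Carrier) (x : UR.Carrier) → u UP.∙ v UP.≈ UP.ε →
                          leviPart (u UP.∙ include radical⊆parabolic x UP.∙ v) UL.≈ UL.ε
      conjugate-radical u v x p = begin
        leviPart (u UP.∙ x′ UP.∙ v)                    ≈⟨ leviPart.homo (u UP.∙ x′) v ⟩
        leviPart (u UP.∙ x′) UL.∙ v′                   ≈⟨ UL.∙-congʳ {v′} {leviPart (u UP.∙ x′)} {u′ UL.∙ leviPart x′} (leviPart.homo u x′) ⟩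
        u′ UL.∙ leviPart x′ UL.∙ v′                    ≈⟨ UL.∙-congʳ {v′} {u′ UL.∙ leviPart x′} {u′ UL.∙ UL.ε} (UL.∙-congˡ {u′} {leviPart x′} {UL.ε} (leviPart-radical x)) ⟩
        u′ UL.∙ UL.ε UL.∙ v′                           ≈⟨ UL.∙-congʳ {v′} {u′ UL.∙ UL.ε} {u′} (UL.identityʳ u′) ⟩
        u′ UL.∙ v′                                     ≈⟨ leviPart.homo u v ⟨
        leviPart (u UP.∙ v)                            ≈⟨ leviPart.⟦⟧-cong {u UP.∙ v} {UP.ε} p ⟩
        leviPart UP.ε                                  ≈⟨ block-1ₘ ⟩
        UL.ε                                           ∎
        where
        open SetoidReasoning UL.setoid
        x′ = include radical⊆parabolic x
        u′ = leviPart u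
        v′ = leviPart v

    radicalConjugation : UP.Carrier → Inverse UR.setoid UR.setoid
    radicalConjugation y = record
      { to = λ x → toRadical (y UP.∙ inc x UP.∙ y UP.⁻¹) (conjugate-radical y (y UP.⁻¹) x (UP.inverseʳ y))
      ; from = λ x → toRadical (y UP.⁻¹ UP.∙ inc x UP.∙ y) (conjugate-radical (y UP.⁻¹) y x (UP.inverseˡ y))
      ; to-cong = λ {u} {v} → conj.to-cong {inc u} {inc v}
      ; from-cong = λ {u} {v} → conj.from-cong {inc u} {inc v}
      ; inverse = (λ {u} {v} → conj.inverseˡ {inc u} {inc v}) , (λ {u} {v} → conj.inverseʳ {inc u} {inc v})
      }
      where
      inc : UR.Carrier → UP.Carrier
      inc = include radical⊆parabolic
      module conj = Inverse (conjugation UP y)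

    sum-splitAt : ∀ a b (f : Fin a ⊎ Fin b → Carrier) →
                  sum (λ i → f (splitAt a i)) ≈ sum (λ i → f (inj₁ i)) + sum (λ i → f (inj₂ i))
    sum-splitAt zero    b f = sym (+-identityˡ _)
    sum-splitAt (suc a) b f = trans (+-congˡ (sum-splitAt a b (f ∘ ⊎.map₁ suc))) (sym (+-assoc _ _ _))

    sum-blocks : (f : Fin n → Carrier) → sum f ≈ sum (λ i → f (embedˡ i)) + sum (λ i → f (embedʳ i))
    sum-blocks f = trans (sum-permute f π) (sum-splitAt a b (f ∘ from))
      where
      π : Permutation (a ℕ.+ b) n
      π = Compose.inverse Fin.+↔⊎ (Symmetry.inverse cano)

    levi-zero : ∀ (g : UL.Carrier) {i j x y} → member i ≡ x → member j ≡ y → x ≢ y → entry g i j ≈ 0#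
    levi-zero g {i} {j} p q x≢y = trans
      (offPattern g i j (λ (_ , r) → x≢y (≡.trans (≡.sym p) (≡.trans r q))))
      (1ₘ-off i j λ { ≡.refl → x≢y (≡.trans (≡.sym p) q) })

    -- blocks : UL ≅ UT_a × UT_b has glue as its inverse.
    blocks : UL.Carrier → UT×UT.Carrier
    blocks g = record
        { entry = λ i j → entry g (embedˡ i) (embedˡ j)
        ; offPattern = λ i j ¬ij → trans
            (offPattern g (embedˡ i) (embedˡ j) (λ (p , _) → ¬ij (reflect-< embedˡ monoˡ p , tt)))
            (1ₘ-embed embedˡ embedˡ-injective i j)
        }
      , record
        { entry = λ i j → entry g (embedʳ i) (embedʳ j)
        ; offPattern = λ i j ¬ij → trans
            (offPattern g (embedʳ i) (embedʳ j) (λ (p , _) → ¬ij (reflect-< embedʳ monoʳ p , tt)))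
            (1ₘ-embed embedʳ embedʳ-injective i j)
        }

    blocks-isHomomorphism : MorphismStructures.MagmaMorphisms.IsMagmaHomomorphism UL.rawMagma UT×UT.rawMagma blocks
    blocks-isHomomorphism = record
      { isRelHomomorphism = record { cong = λ p → (λ i j → p _ _) , (λ i j → p _ _) }
      ; homo = λ g h →
          (λ i k → trans (sum-blocks (λ j → entry g (embedˡ i) j * entry h j (embedˡ k)))
            (trans (+-congˡ (sum-zero (λ j → entry g (embedˡ i) (embedʳ j) * entry h (embedʳ j) (embedˡ k)) λ j → trans
                (*-congʳ (levi-zero g (member-embedˡ i) (member-embedʳ j) (λ ()))) (zeroˡ _)))
              (+-identityʳ _)))
        , (λ i k → trans (sum-blocks (λ j → entry g (embedʳ i) j * entry h j (embedʳ k)))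
            (trans (+-congʳ (sum-zero (λ j → entry g (embedʳ i) (embedˡ j) * entry h (embedˡ j) (embedʳ k)) λ j → trans
                (*-congʳ (levi-zero g (member-embedʳ i) (member-embedˡ j) (λ ()))) (zeroˡ _)))
              (+-identityˡ _)))
      }

    glued : UT×UT.Carrier → Fin a ⊎ Fin b → Fin a ⊎ Fin b → Carrier
    glued (g , h) (inj₁ i) (inj₁ j) = entry g i j
    glued (g , h) (inj₁ i) (inj₂ j) = 0#
    glued (g , h) (inj₂ i) (inj₁ j) = 0#
    glued (g , h) (inj₂ i) (inj₂ j) = entry h i j

    glued-to : ∀ x {i j s t} → to i ≡ s → to j ≡ t → glued x (to i) (to j) ≈ glued x s t
    glued-to x ≡.refl ≡.refl = refl

    glue : UT×UT.Carrier → UL.Carrier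
    glue x@(g , h) = record
      { entry = λ i j → glued x (to i) (to j)
      ; offPattern = λ i j ¬ij → ≡.subst₂ (λ i′ j′ → glued x (to i) (to j) ≈ 1ₘ i′ j′)
          (strictlyInverseʳ i) (strictlyInverseʳ j)
          (off (to i) (to j) λ (p , q) → ¬ij
            ( ≡.subst₂ Fin._<_ (strictlyInverseʳ i) (strictlyInverseʳ j) p
            , ≡.subst₂ (λ i′ j′ → member i′ ≡ member j′) (strictlyInverseʳ i) (strictlyInverseʳ j) q ))
      }
      where
      off : ∀ s t → ¬ (from s Fin.< from t × member (from s) ≡ member (from t)) → glued x s t ≈ 1ₘ (from s) (from t)
      off (inj₁ i) (inj₁ j) ¬ij = trans
        (offPattern g i j (λ (p , _) → ¬ij (monoˡ p , ≡.trans (member-embedˡ i) (≡.sym (member-embedˡ j)))))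
        (sym (1ₘ-embed embedˡ embedˡ-injective i j))
      off (inj₁ i) (inj₂ j) ¬ij = sym (1ₘ-off (embedˡ i) (embedʳ j) λ p → contradiction
        (≡.trans (≡.sym (member-embedˡ i)) (≡.trans (≡.cong member p) (member-embedʳ j))) λ ())
      off (inj₂ i) (inj₁ j) ¬ij = sym (1ₘ-off (embedʳ i) (embedˡ j) λ p → contradiction
        (≡.trans (≡.sym (member-embedʳ i)) (≡.trans (≡.cong member p) (member-embedˡ j))) λ ())
      off (inj₂ i) (inj₂ j) ¬ij = trans
        (offPattern h i j (λ (p , _) → ¬ij (monoʳ p , ≡.trans (member-embedʳ i) (≡.sym (member-embedʳ j)))))
        (sym (1ₘ-embed embedʳ embedʳ-injective i j))

    glue-isHomomorphism : MorphismStructures.MagmaMorphisms.IsMagmaHomomorphism UT×UT.rawMagma UL.rawMagma glue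
    glue-isHomomorphism = record
      { isRelHomomorphism = record { cong = λ {x} {y} p i j → glued-cong x y p (to i) (to j) }
      ; homo = λ x y i k → sym (trans
          (sum-blocks (λ j → glued x (to i) (to j) * glued y (to j) (to k)))
          (trans
            (+-cong
              (sum-cong (λ j → glued x (to i) (to (embedˡ j)) * glued y (to (embedˡ j)) (to k)) (λ j → glued x (to i) (inj₁ j) * glued y (inj₁ j) (to k))
                λ j → *-cong (glued-to x {i = i} ≡.refl (strictlyInverseˡ (inj₁ j))) (glued-to y {j = k} (strictlyInverseˡ (inj₁ j)) ≡.refl))
              (sum-cong (λ j → glued x (to i) (to (embedʳ j)) * glued y (to (embedʳ j)) (to k)) (λ j → glued x (to i) (inj₂ j) * glued y (inj₂ j) (to k))
                λ j → *-cong (glued-to x {i = i} ≡.refl (strictlyInverseˡ (inj₂ j))) (glued-to y {j = k} (strictlyInverseˡ (inj₂ j)) ≡.refl)))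
            (glued-∙ x y (to i) (to k))))
      }
      where
      glued-cong : ∀ x y → x UT×UT.≈ y → ∀ s t → glued x s t ≈ glued y s t
      glued-cong x y (p , q) (inj₁ i) (inj₁ j) = p i j
      glued-cong x y (p , q) (inj₁ i) (inj₂ j) = refl
      glued-cong x y (p , q) (inj₂ i) (inj₁ j) = refl
      glued-cong x y (p , q) (inj₂ i) (inj₂ j) = q i j
      glued-∙ : ∀ x y s t → sum (λ j → glued x s (inj₁ j) * glued y (inj₁ j) t)
                          + sum (λ j → glued x s (inj₂ j) * glued y (inj₂ j) t) ≈ glued (x UT×UT.∙ y) s t
      glued-∙ (g , _) (g′ , h′) (inj₁ i) (inj₁ k) =
        trans (+-congˡ (sum-zero {b} (λ _ → 0# * 0#) λ j → zeroˡ _)) (+-identityʳ _)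
      glued-∙ (g , _) (_ , h′) (inj₁ i) (inj₂ k) =
        trans (+-cong (sum-zero (λ j → entry g i j * 0#) λ j → zeroʳ _) (sum-zero (λ j → 0# * entry h′ j k) λ j → zeroˡ _)) (+-identityʳ _)
      glued-∙ (_ , h) (g′ , _) (inj₂ i) (inj₁ k) =
        trans (+-cong (sum-zero (λ j → 0# * entry g′ j k) λ j → zeroˡ _) (sum-zero (λ j → entry h i j * 0#) λ j → zeroʳ _)) (+-identityʳ _)
      glued-∙ (_ , h) (_ , h′) (inj₂ i) (inj₂ k) =
        trans (+-congʳ (sum-zero {a} (λ _ → 0# * 0#) λ j → zeroˡ _)) (+-identityˡ _)

  InUT : ∀ {n} → NaturalUnitIntervalOrder n → PatternMatrix (fullPattern n) → Set ℓ₁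
  InUT π g = ∀ i j → ¬ _≼_ π i j → entry g i j ≈ 1ₘ i j

  InUT? : ∀ {n} (π : NaturalUnitIntervalOrder n) g → Dec (InUT π g)
  InUT? π g = Fin.all? λ i → Fin.all? λ j → ¬? (_≼?_ π i j) →-dec (entry g i j F.≟ 1ₘ i j)
    where module F = FiniteField F

  module _ {n} (π : NaturalUnitIntervalOrder n) where
    private module G = Group (UT n)

    InUT-resp : ∀ {g h} → g G.≈ h → InUT π g → InUT π h
    InUT-resp p q i j ¬ij = trans (sym (p i j)) (q i j ¬ij)

    InUT-normal : ∀ x y g → x G.∙ y G.≈ G.ε → InUT π g → InUT π (x G.∙ g G.∙ y)
    InUT-normal x y g xy≈1 q i l ¬il = trans
      (sum-cong (λ k → (entry x · entry g) i k * entry y k l) (λ k → entry x i k * entry y k l) outer) (xy≈1 i l)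
      where
      lower : ∀ (h : G.Carrier) j k → ¬ j Fin.≤ k → entry h j k ≈ 0#
      lower h j k j≰k = trans (offPattern h j k (λ (p , _) → j≰k (ℕ.<⇒≤ p)))
        (1ₘ-off j k λ { ≡.refl → j≰k ℕ.≤-refl })
      inner : ∀ j k → k Fin.≤ l → entry x i j * entry g j k ≈ entry x i j * 1ₘ j k
      inner j k k≤l = cases (_≼?_ π j k) (j Fin.≟ k) (i Fin.≤? j)
        where
        cases : Dec (_≼_ π j k) → Dec (j ≡ k) → Dec (i Fin.≤ j) → entry x i j * entry g j k ≈ entry x i j * 1ₘ j k
        cases (no ¬jk) _        _         = *-congˡ (q j k ¬jk)
        cases (yes jk) (yes j≡k) _        = *-congˡ (offPattern g j k (λ (p , _) → ℕ.<-irrefl (≡.cong Fin.toℕ j≡k) p))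
        cases (yes jk) (no j≢k) (yes i≤j) = contradiction (interval π jk j≢k i≤j k≤l) ¬il
        cases (yes jk) (no j≢k) (no i≰j)  =
          trans (*-congʳ (lower x i j i≰j)) (trans (zeroˡ _) (sym (trans (*-congʳ (lower x i j i≰j)) (zeroˡ _))))
      outer : ∀ k → (entry x · entry g) i k * entry y k l ≈ entry x i k * entry y k l
      outer k with k Fin.≤? l
      ... | yes k≤l = *-congʳ (trans
        (sum-cong (λ j → entry x i j * entry g j k) (λ j → entry x i j * 1ₘ j k) λ j → inner j k k≤l)
        (sum-1ʳ k (entry x i)))
      ... | no k≰l = trans (*-congˡ (lower y k l k≰l)) (trans (zeroʳ _) (sym (trans (*-congˡ (lower y k l k≰l)) (zeroʳ _))))

module UnipotentClassFunctions
  {c ℓ₁ ℓ₂ k κ₁ κ₂} (F : FiniteField c ℓ₁ ℓ₂) (K : CharacteristicZeroField k κ₁ κ₂) where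

  open CharacteristicZeroField K hiding (zero)
  open LinearAlgebra commutativeRing
  open ClassFunctions K
  open UnipotentGroups F

  cfUT : ℕ → LeftModule ring (k ⊔ κ₁ ⊔ c ⊔ ℓ₁) (κ₁ ⊔ c ⊔ ℓ₁)
  cfUT n = cf (UT n)

  cfUT-space : LeftModule ring (k ⊔ κ₁ ⊔ c ⊔ ℓ₁) (κ₁ ⊔ c ⊔ ℓ₁)
  cfUT-space = ⨁ cfUT

  module _ {n a b} (I : Split n a b) where
    open Parabolic I
    private
      module UL = Group UL
      module UR = Group UR
      module UP = Group UP

    Res : ClassFunction (UT n) → ClassFunction UP
    Res = pullback (include-isHomomorphism parabolic⊆full)

    Inf : ClassFunction UL → ClassFunction UP
    Inf = pullback leviPart-isHomomorphism

    Def : ClassFunction UP → ClassFunction UL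
    Def ψ = record
      { ⟦_⟧ = λ l → average UR-finite UR.ε (f l)
      ; cong = λ {l} {l′} p → *-congˡ (∑-cong UR-finite λ x →
          cong ψ {lift l UP.∙ inc x} {lift l′ UP.∙ inc x} (UP.∙-congʳ {inc x} {lift l} {lift l′} p))
      ; conjugate = λ y l → *-congˡ (trans
          (sym (∑-reindex UR-finite (f (y UL.∙ l UL.∙ y UL.⁻¹)) (λ {u} {v} → f-cong (y UL.∙ l UL.∙ y UL.⁻¹) {u} {v}) (radicalConjugation (lift y))))
          (∑-cong UR-finite (step y l)))
      }
      where
      lift : UL.Carrier → UP.Carrier
      lift = include levi⊆parabolic
      inc : UR.Carrier → UP.Carrier
      inc = include radical⊆parabolic
      f : UL.Carrier → UR.Carrier → Carrier
      f l x = ⟦ ψ ⟧ (lift l UP.∙ inc x)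
      f-cong : ∀ l {x x′} → x UR.≈ x′ → f l x ≈ f l x′
      f-cong l {x} {x′} p = cong ψ {lift l UP.∙ inc x} {lift l UP.∙ inc x′} (UP.∙-congˡ {lift l} {inc x} {inc x′} p)
      step : ∀ y l x → f (y UL.∙ l UL.∙ y UL.⁻¹) (Inverse.to (radicalConjugation (lift y)) x) ≈ f l x
      step y l x = trans (cong ψ {lhs} {rhs} λ i j → lhs≈rhs i j) (conjugate ψ (lift y) (lift l UP.∙ inc x))
        where
        Y L X lhs rhs : UP.Carrier
        Y = lift y
        L = lift l
        X = inc x
        lhs = lift (y UL.∙ l UL.∙ y UL.⁻¹) UP.∙ inc (Inverse.to (radicalConjugation (lift y)) x)
        rhs = lift y UP.∙ (lift l UP.∙ inc x) UP.∙ lift y UP.⁻¹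
        lhs≈rhs : lhs UP.≈ rhs
        lhs≈rhs = UP.trans {lhs} {(Y UP.∙ L UP.∙ Y UP.⁻¹) UP.∙ (Y UP.∙ X UP.∙ Y UP.⁻¹)} {rhs}
          (UP.∙-congʳ {Y UP.∙ X UP.∙ Y UP.⁻¹} {lift (y UL.∙ l UL.∙ y UL.⁻¹)} {Y UP.∙ L UP.∙ Y UP.⁻¹}
            (UP.∙-congˡ {Y UP.∙ L} {lift (y UL.⁻¹)} {Y UP.⁻¹}
              (homo-⁻¹ UL UP (include-isHomomorphism levi⊆parabolic) y)))
          (conjugation-∙ UP Y L X)

    st : ClassFunction UL → LeftModule.Carrierᴹ (cfUT a ⊗ cfUT b)
    st ψ = split (UT a) (UT b) (UT-finite a) (UT-finite b) (pullback glue-isHomomorphism ψ)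

    st⁻¹ : LeftModule.Carrierᴹ (cfUT a ⊗ cfUT b) → ClassFunction UL
    st⁻¹ t = pullback blocks-isHomomorphism (join (UT a) (UT b) t)

  full⊆prefix : ∀ {a b} {i j : Fin (a ℕ.+ b)} → i Fin.< j → Pattern._∼_ (fullPattern (a ℕ.+ b)) i j →
                Pattern._∼_ (Parabolic.parabolic (prefixSplit a b)) i j
  full⊆prefix {a} {b} {i} {j} i<j _ (p , q) with splitAt a i in e | splitAt a j in e′
  ... | inj₁ _  | _       = contradiction p λ ()
  ... | inj₂ _  | inj₂ _  = contradiction q λ ()
  ... | inj₂ i′ | inj₁ j′ = ℕ.<-asym i<j (≡.subst₂ Fin._<_ (Fin.splitAt⁻¹-↑ˡ e′) (Fin.splitAt⁻¹-↑ʳ e)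
    (≡.subst₂ ℕ._<_ (≡.sym (Fin.toℕ-↑ˡ j′ b)) (≡.sym (Fin.toℕ-↑ʳ a i′)) (ℕ.m≤n⇒m≤n+o _ (Fin.toℕ<n j′))))

  -- UT_{a+b} is the parabolic subgroup UP_I of I = {1,…,a}.
  product : ∀ {a b} → LeftModule.Carrierᴹ (cfUT a ⊗ cfUT b) → ClassFunction (UT (a ℕ.+ b))
  product {a} {b} t = pullback (include-isHomomorphism (full⊆prefix {a} {b})) (Inf (prefixSplit a b) (st⁻¹ (prefixSplit a b) t))

  coproduct : ∀ {n} → ClassFunction (UT n) → LeftModule.Carrierᴹ (cfUT-space ⊗ cfUT-space)
  coproduct {n} ψ = concatMap
    (λ I → let S = subsetSplit I in
      map (Product.map (homogeneous cfUT ∣ I ∣) (homogeneous cfUT ∣ ∁ I ∣)) (st S (Def S (Res S ψ))))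
    (subsets n)

  cfUT-Hopf : RawHopfAlgebra (k ⊔ κ₁ ⊔ c ⊔ ℓ₁) (κ₁ ⊔ c ⊔ ℓ₁)
  cfUT-Hopf = record
    { space = cfUT-space
    ; multiplication = concatMap λ (x , y) →
        cartesianProductWith (λ (a , ψ) (b , χ) → a ℕ.+ b , product List.[ ψ , χ ]) x y
    ; unit = λ s → homogeneous cfUT 0 (record
        { ⟦_⟧ = λ _ → s
        ; cong = λ _ → refl
        ; conjugate = λ _ _ → refl
        })
    ; comultiplication = concatMap λ (_ , ψ) → coproduct ψ
    ; counit = λ x → ⟦ degreePart cfUT 0 x ⟧ (Group.ε (UT 0))
    }

  δ̄ : ∀ {n} → NaturalUnitIntervalOrder n → ClassFunction (UT n)
  δ̄ {n} π = record
    { ⟦_⟧ = λ g → if does (InUT? π g) then 1# else 0#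
    ; cong = λ {g} {h} p → equal {g} {h} (InUT-resp π {g} {h} p) (InUT-resp π {h} {g} (G.sym {g} {h} p))
    ; conjugate = λ x g → equal {x G.∙ g G.∙ x G.⁻¹} {g}
        (λ q → InUT-resp π {x G.⁻¹ G.∙ (x G.∙ g G.∙ x G.⁻¹) G.∙ x} {g}
          (Inverse.inverseʳ (conjugation (UT n) x) {g} {x G.∙ g G.∙ x G.⁻¹} (λ _ _ → CommutativeRing.refl (FiniteField.commutativeRing F)))
          (InUT-normal π (x G.⁻¹) x (x G.∙ g G.∙ x G.⁻¹) (G.inverseˡ x) q))
        (InUT-normal π x (x G.⁻¹) g (G.inverseʳ x))
    }
    where
    module G = Group (UT n)
    equal : ∀ {g h} → (InUT π g → InUT π h) → (InUT π h → InUT π g) →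
            (if does (InUT? π g) then 1# else 0#) ≈ (if does (InUT? π h) then 1# else 0#)
    equal {g} {h} p q = reflexive (≡.cong (λ b → if b then 1# else 0#) (does-⇔ (mk⇔ p q) (InUT? π g) (InUT? π h)))

  q⁻¹ : Carrier
  q⁻¹ = 1/ FiniteField.order F
    where open FiniteField F using (order-nonZero)

  open IncomparabilityGraphs commutativeRing q⁻¹ using (IG; IGₙ)

  incToδ̄ₙ : ∀ n → LeftModule.Carrierᴹ (IGₙ n) → ClassFunction (UT n)
  incToδ̄ₙ n = foldr (λ (s , π) ψ → (s *ₗ δ̄ π) +ᴹ ψ) 0ᴹ
    where open LeftModule (cfUT n)

  incToδ̄ : RawHopfAlgebra.Carrierᴹ IG → RawHopfAlgebra.Carrierᴹ cfUT-Hopf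
  incToδ̄ = map (λ (n , u) → n , incToδ̄ₙ n u)

{-# OPTIONS --safe #-}

-- Everything is read off from values at group elements. The matrix ζ_π with
-- ones exactly at π lies in UT(ρ) if and only if π ⊆ ρ, so the values of a
-- combination of the δ̄_ρ at the ζ_π are the sums of its coefficients over
-- up-sets, and Möbius inversion recovers the coefficients. An element of
-- UT_{n+m} lies in UT(π ⋆ ρ) if and only if its diagonal blocks lie in UT(π) and
-- UT(ρ), which gives multiplicativity. For l ∈ UL_I with blocks g, h and
-- x ∈ UR_I, the product lx lies in UT(π) if and only if g, h and x satisfy the
-- constraints imposed by π; those on x are the vanishing of asc_I(π)
-- independent entries, an event of probability q^{-asc_I(π)}.
module Submission where

open import Algebra using (AbelianGroup; CommutativeRing; Group)
open import Algebra.Apartness using (HeytingField)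
import Algebra.Construct.DirectProduct as DirectProduct
open import Algebra.Module using (LeftModule)
open import Algebra.Module.Morphism.Structures using (module LeftModuleMorphisms)
import Algebra.Properties.CommutativeSemigroup as CommutativeSemigroupProperties
import Algebra.Properties.Group as GroupProperties
import Algebra.Properties.Ring as RingProperties
import Algebra.Properties.Semiring.Exp as Exp
import Algebra.Properties.Semiring.Mult as Mult
import Algebra.Properties.Semiring.Sum as Sum
open import Data.Bool.Base using (Bool; true; false; if_then_else_; _∧_; not)
import Data.Bool.Properties as Bool
open import Data.Fin.Base as Fin using (Fin)
import Data.Fin.Properties as Fin
open import Data.Fin.Subset using (Subset; ∣_∣; ∁)
open import Data.List.Base as List
  using (List; []; _∷_; _++_; map; concatMap; cartesianProductWith; cartesianProduct; allFin; filter; length; foldr)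
open import Data.List.Membership.Propositional using (_∈_)
open import Data.List.Membership.Propositional.Properties
  using (∈-cartesianProduct⁺; ∈-allFin; ∈-filter⁺; ∈-filter⁻)
open import Data.List.Properties using (++-assoc; map-++; map-∘)
open import Data.List.Relation.Unary.All as All using (All; []; _∷_)
open import Data.List.Relation.Unary.AllPairs using ([]; _∷_)
open import Data.List.Relation.Unary.Any using (here; there)
open import Data.List.Relation.Unary.Unique.Propositional using (Unique)
open import Data.List.Relation.Unary.Unique.Propositional.Properties using (cartesianProduct⁺; allFin⁺; filter⁺)
open import Data.Nat.Base as ℕ using (ℕ; NonZero)
open import Data.Nat.Induction using (<-wellFounded)
import Data.Nat.Properties as ℕ
open import Data.Product.Base as Product using (∃₂; _×_; _,_; proj₁; proj₂)
open import Data.Product.Properties using (≡-dec)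
open import Data.Sum.Base using (inj₁; inj₂)
open import Data.Unit.Base using (tt)
open import Function.Base using (_∘_; id)
open import Function.Bundles using (Inverse; _⇔_; mk⇔; module Equivalence)
open import Induction.WellFounded using (Acc; acc)
open import Level using (_⊔_)
open import Relation.Binary.Bundles using (DecSetoid; Setoid)
open import Relation.Binary.PropositionalEquality as ≡ using (_≡_; _≢_)
import Relation.Binary.Reasoning.Setoid as SetoidReasoning
open import Relation.Nullary using (¬_; Dec; yes; no; does; contradiction)
open import Relation.Nullary.Decidable
  using (_×-dec_; _→-dec_; ¬?; dec-true; dec-false; decidable-stable; does-⇔)
open import Relation.Unary using (Pred; Decidable)

open import Defs
open NaturalUnitIntervalOrder

-- Two notions of equality shape the argument. An element of the free module is a list of scaled
-- orders, and lists are equal when all coefficients agree; a map that folds such a list has to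
-- respect this. Evaluating the image at a group element sums the coefficients of the orders that
-- satisfy a Boolean predicate, and this sum is determined by the coefficients inside the predicate.
-- Möbius inversion uses the same fact on up-sets. Equality in a tensor product is an inductively
-- generated congruence and offers no pointwise test. For class functions, `join` and `split`
-- identify the tensor product with functions on a product of groups, so the coproduct identity is
-- checked on values and then carried back. The off-diagonal entries of lx are sums of products of
-- entries of l and x, so the conditions on x cannot be read off entry by entry. But lx and l have
-- the same diagonal blocks, so lx in UT(π) forces l into UT(π), and then x as well because UT(π) is
-- a group.

-- Sums of coefficients in a free module

module FreeModule {r ℓr b ℓb} (R : CommutativeRing r ℓr) (B : DecSetoid b ℓb) where

  open CommutativeRing R renaming (Carrier to Scalar)
  open LinearAlgebra R
  private
    module B = DecSetoid B
    module Free = LeftModule (Free B)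

  weight : (B.Carrier → Bool) → Scalar × B.Carrier → Scalar
  weight p (s , β) = if p β then s else 0#

  weight-* : ∀ p s y → weight p (Product.map₁ (s *_) y) ≈ s * weight p y
  weight-* p s (s′ , β) with p β
  ... | true  = refl
  ... | false = sym (zeroʳ s)

  private
    module Mass = FormalSums (Scalar × B.Carrier) (λ s → Product.map₁ (s *_))
                    (B.Carrier → Bool) (λ _ → R-module) weight weight-*

  mass : (B.Carrier → Bool) → List (Scalar × B.Carrier) → Scalar
  mass = Mass.total

  mass-++ : ∀ p u v → mass p (u ++ v) ≈ mass p u + mass p v
  mass-++ = Mass.total-++

  -- The implicit `h` stands for any proof of compatibility with scaling: the one inside `Free` is
  -- private, and `total` computes independently of it.
  total≡mass : ∀ {h} β u →
    FormalSums.total (Scalar × B.Carrier) (λ s → Product.map₁ (s *_)) B.Carrier (λ _ → R-module) (coefficientOf B) h β u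
      ≡ mass (λ β′ → does (β′ B.≟ β)) u
  total≡mass β []            = ≡.refl
  total≡mass β ((s , _) ∷ u) = ≡.cong (_ +_) (total≡mass β u)

  coefficient-cong : ∀ u v → u Free.≈ᴹ v → ∀ β → mass (λ β′ → does (β′ B.≟ β)) u ≈ mass (λ β′ → does (β′ B.≟ β)) v
  coefficient-cong u v p β =
    trans (reflexive (≡.sym (total≡mass β u))) (trans (p β) (reflexive (total≡mass β v)))

  coefficient-reflect : ∀ u v → (∀ β → mass (λ β′ → does (β′ B.≟ β)) u ≈ mass (λ β′ → does (β′ B.≟ β)) v) → u Free.≈ᴹ v
  coefficient-reflect u v p β =
    trans (reflexive (total≡mass β u)) (trans (p β) (reflexive (≡.sym (total≡mass β v))))

  mass-≗ : ∀ {p p′} → (∀ β → p β ≡ p′ β) → ∀ u → mass p u ≈ mass p′ u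
  mass-≗ e []            = refl
  mass-≗ e ((s , β) ∷ u) rewrite e β = +-congˡ (mass-≗ e u)

  -- A coefficient collects all entries with equal basis elements, so only a predicate that does not
  -- separate equal elements has a mass determined by coefficients.
  Respects : (B.Carrier → Bool) → Set (b ⊔ ℓb)
  Respects p = ∀ β β′ → β B.≈ β′ → p β ≡ p β′

  infixl 6 _∖_
  _∖_ : (B.Carrier → Bool) → B.Carrier → B.Carrier → Bool
  (p ∖ β) β′ = p β′ ∧ not (does (β′ B.≟ β))

  ≟-respects : ∀ β → Respects (λ β′ → does (β′ B.≟ β))
  ≟-respects β x y e with x B.≟ β | y B.≟ β
  ... | yes p | yes q = ≡.refl
  ... | yes p | no ¬q = contradiction (B.trans (B.sym e) p) ¬q
  ... | no ¬p | yes q = contradiction (B.trans e q) ¬p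
  ... | no ¬p | no ¬q = ≡.refl

  ∖-respects : ∀ p β → Respects p → Respects (p ∖ β)
  ∖-respects p β resp x y e = ≡.cong₂ (λ b b′ → b ∧ not b′) (resp x y e) (≟-respects β x y e)

  ∖-true : ∀ p β β′ → (p ∖ β) β′ ≡ true → p β′ ≡ true × ¬ β′ B.≈ β
  ∖-true p β β′ e with p β′ | β′ B.≟ β
  ... | true | no ¬q = ≡.refl , ¬q

  mass-∖ : ∀ p → Respects p → ∀ β → p β ≡ true → ∀ u →
           mass p u ≈ mass (λ β′ → does (β′ B.≟ β)) u + mass (p ∖ β) u
  mass-∖ p resp β pβ []             = sym (+-identityˡ 0#)
  mass-∖ p resp β pβ ((s , β′) ∷ u) =
    trans (+-cong head (mass-∖ p resp β pβ u)) (interchange _ _ _ _)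
    where
    open CommutativeSemigroupProperties +-commutativeSemigroup using (interchange)
    head : weight p (s , β′) ≈ weight (λ β″ → does (β″ B.≟ β)) (s , β′) + weight (p ∖ β) (s , β′)
    head with β′ B.≟ β | p β′ in e
    ... | yes q | true  = sym (+-identityʳ s)
    ... | yes q | false = contradiction (≡.trans (≡.sym pβ) (≡.trans (resp β β′ (B.sym q)) e)) λ ()
    ... | no ¬q | true  = sym (+-identityˡ s)
    ... | no ¬q | false = sym (+-identityˡ 0#)

  weight-false : ∀ {p s β} → p β ≡ false → weight p (s , β) ≈ 0#
  weight-false {p} {s} {β} e rewrite e = refl

  mass-∷-false : ∀ {p s β} u → p β ≡ false → mass p ((s , β) ∷ u) ≈ mass p u
  mass-∷-false {p} {s} {β} u e = trans (+-congʳ (weight-false {p} {s} {β} e)) (+-identityˡ _)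

  -- Induction on u with p arbitrary: the generator at the head of u is split off from p.
  mass-vanish : ∀ p → Respects p → ∀ u →
                (∀ β → p β ≡ true → mass (λ β′ → does (β′ B.≟ β)) u ≈ 0#) → mass p u ≈ 0#
  mass-vanish p resp []            h = refl
  mass-vanish p resp ((s , β) ∷ u) h with p β in e
  ... | false = trans (+-identityˡ _) (mass-vanish p resp u λ β′ pβ′ →
          trans (sym (mass-∷-false u (dec-false (β B.≟ β′) λ q →
            contradiction (≡.trans (≡.sym e) (≡.trans (resp β β′ q) pβ′)) λ ()))) (h β′ pβ′))
  ... | true  = trans (≡.subst (λ x → (if x then s else 0#) + mass p u ≈ mass p ((s , β) ∷ u)) e refl)
          (trans (mass-∖ p resp β e ((s , β) ∷ u)) (trans (+-cong (h β e) rest) (+-identityˡ 0#)))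
    where
    rest : mass (p ∖ β) ((s , β) ∷ u) ≈ 0#
    rest = trans
      (mass-∷-false u (≡.cong₂ (λ x y → x ∧ not y) e (dec-true (β B.≟ β) B.refl)))
      (mass-vanish (p ∖ β) (∖-respects p β resp) u λ β′ q →
        let pβ′ , β′≉β = ∖-true p β β′ q in
        trans (sym (mass-∷-false u (dec-false (β B.≟ β′) (λ e′ → β′≉β (B.sym e′))))) (h β′ pβ′))

  mass-difference : ∀ p u v → mass p (u Free.+ᴹ Free.-ᴹ v) ≈ mass p u - mass p v
  mass-difference p u v = trans (mass-++ p u (Free.-ᴹ v))
    (+-congˡ (trans (Mass.total-· p (- 1#) v) (RingProperties.-1*x≈-x ring _)))

  -- Apply `mass-vanish` to the difference. Agreement is required on `p` alone because in Möbius
  -- inversion only the coefficients of strictly larger orders are known when this is invoked.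
  mass-determined : ∀ p → Respects p → ∀ u v →
    (∀ β → p β ≡ true → mass (λ β′ → does (β′ B.≟ β)) u ≈ mass (λ β′ → does (β′ B.≟ β)) v) → mass p u ≈ mass p v
  mass-determined p resp u v h = RingProperties.x∙y⁻¹≈ε⇒x≈y ring _ _
    (trans (sym (mass-difference p u v)) (mass-vanish p resp (u Free.+ᴹ Free.-ᴹ v) λ β pβ →
      trans (mass-difference (λ β′ → does (β′ B.≟ β)) u v) (trans (+-congʳ (h β pβ)) (-‿inverseʳ _))))

  mass-cong : ∀ p → Respects p → ∀ u v → u Free.≈ᴹ v → mass p u ≈ mass p v
  mass-cong p resp u v u≈v = mass-determined p resp u v λ β _ → coefficient-cong u v u≈v β

-- Inclusion of orders, and lists of ascents

module _ {a p q} {A : Set a} {P : Pred A p} {Q : Pred A q} (P? : Decidable P) (Q? : Decidable Q) where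

  length-filter-⊆ : (∀ {x} → P x → Q x) → ∀ xs → length (filter P? xs) ℕ.≤ length (filter Q? xs)
  length-filter-⊆ P⊆Q []       = ℕ.z≤n
  length-filter-⊆ P⊆Q (x ∷ xs) with P? x | Q? x
  ... | yes Px | yes Qx = ℕ.s≤s (length-filter-⊆ P⊆Q xs)
  ... | yes Px | no ¬Qx = contradiction (P⊆Q Px) ¬Qx
  ... | no _   | yes _  = ℕ.m≤n⇒m≤1+n (length-filter-⊆ P⊆Q xs)
  ... | no _   | no _   = length-filter-⊆ P⊆Q xs

  length-filter-⊂ : (∀ {x} → P x → Q x) → ∀ {x xs} → x ∈ xs → ¬ P x → Q x →
                    length (filter P? xs) ℕ.< length (filter Q? xs)
  length-filter-⊂ P⊆Q {x} {xs = .x ∷ xs} (here ≡.refl) ¬Px Qx with P? x | Q? x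
  ... | yes Px | _      = contradiction Px ¬Px
  ... | no _   | yes _  = ℕ.s≤s (length-filter-⊆ P⊆Q xs)
  ... | no _   | no ¬Qx = contradiction Qx ¬Qx
  length-filter-⊂ P⊆Q {xs = y ∷ _} (there x∈xs) ¬Px Qx with P? y | Q? y
  ... | yes Py | yes Qy = ℕ.s≤s (length-filter-⊂ P⊆Q x∈xs ¬Px Qx)
  ... | yes Py | no ¬Qy = contradiction (P⊆Q Py) ¬Qy
  ... | no _   | yes _  = ℕ.m≤n⇒m≤1+n (length-filter-⊂ P⊆Q x∈xs ¬Px Qx)
  ... | no _   | no _   = length-filter-⊂ P⊆Q x∈xs ¬Px Qx

module _ {n : ℕ} where

  infix 4 _⊑_ _⊑?_
  _⊑_ : NaturalUnitIntervalOrder n → NaturalUnitIntervalOrder n → Set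
  π ⊑ ρ = ∀ i j → _≼_ π i j → _≼_ ρ i j

  _⊑?_ : ∀ π ρ → Dec (π ⊑ ρ)
  π ⊑? ρ = Fin.all? λ i → Fin.all? λ j → _≼?_ π i j →-dec _≼?_ ρ i j

  ⋢⇒∃ : ∀ π ρ → ¬ π ⊑ ρ → ∃₂ λ i j → _≼_ π i j × ¬ _≼_ ρ i j
  ⋢⇒∃ π ρ ¬π⊑ρ
    with i , ¬i ← Fin.¬∀⟶∃¬ n _ (λ i → Fin.all? λ j → _≼?_ π i j →-dec _≼?_ ρ i j) ¬π⊑ρ
    with j , ¬ij ← Fin.¬∀⟶∃¬ n _ (λ j → _≼?_ π i j →-dec _≼?_ ρ i j) ¬i
    with _≼?_ π i j
  ... | yes p = i , j , p , λ q → ¬ij (λ _ → q)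
  ... | no ¬p = contradiction (λ p → contradiction p ¬p) ¬ij

  -- A measure that drops when the order grows strictly, so that well-founded induction on it
  -- proceeds from larger orders to smaller ones.
  incomparability : NaturalUnitIntervalOrder n → ℕ
  incomparability π = length (filter (λ (i , j) → ¬? (_≼?_ π i j)) (cartesianProduct (allFin n) (allFin n)))

  incomparability-⊏ : ∀ π ρ → π ⊑ ρ → ¬ ρ ⊑ π → incomparability ρ ℕ.< incomparability π
  incomparability-⊏ π ρ π⊑ρ ¬ρ⊑π with i , j , ρij , ¬πij ← ⋢⇒∃ ρ π ¬ρ⊑π =
    length-filter-⊂ _ _ (λ {(i , j)} ¬ρij πij → ¬ρij (π⊑ρ i j πij))
      (∈-cartesianProduct⁺ (∈-allFin i) (∈-allFin j)) (λ ¬ρij → ¬ρij ρij) ¬πij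

module _ {n a b : ℕ} (I : Split n a b) (π : NaturalUnitIntervalOrder n) where

  open Split I using (member)

  Ascent : Fin n × Fin n → Set
  Ascent (i , j) = member i ≡ true × member j ≡ false × i Fin.< j × ¬ _≼_ π i j

  -- The same conjunction, in the same nesting, as the filter in `asc`: this makes
  -- `length (ascents I π)` and `asc I π` definitionally equal.
  ascent? : Decidable Ascent
  ascent? (i , j) = (member i Bool.≟ true) ×-dec (member j Bool.≟ false) ×-dec (i Fin.<? j) ×-dec ¬? (_≼?_ π i j)

  -- The list whose length defines asc I π.
  ascents : List (Fin n × Fin n)
  ascents = filter ascent? (cartesianProduct (allFin n) (allFin n))

  Unique-ascents : Unique ascents
  Unique-ascents = filter⁺ ascent? (cartesianProduct⁺ (allFin⁺ n) (allFin⁺ n))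

  All-ascents : All Ascent ascents
  All-ascents = All.tabulate λ p → proj₂ (∈-filter⁻ ascent? {xs = cartesianProduct (allFin n) (allFin n)} p)

  ∈-ascents : ∀ {ij} → Ascent ij → ij ∈ ascents
  ∈-ascents = ∈-filter⁺ ascent? (∈-cartesianProduct⁺ (∈-allFin _) (∈-allFin _))

-- Möbius inversion over up-sets

module _ {r ℓr} (R : CommutativeRing r ℓr) (n : ℕ) where

  open CommutativeRing R
  open LinearAlgebra R
  open FreeModule R (orderDecSetoid n)
  private
    module O = DecSetoid (orderDecSetoid n)
    module Free = LeftModule (Free (orderDecSetoid n))

  ⊑-respects : ∀ π → Respects (λ ρ → does (π ⊑? ρ))
  ⊑-respects π ρ ρ′ e = does-⇔
    (mk⇔ (λ f i j x → Equivalence.to (e i j) (f i j x)) (λ f i j x → Equivalence.from (e i j) (f i j x)))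
    (π ⊑? ρ) (π ⊑? ρ′)

  -- Möbius inversion: the coefficient of π follows from the sum over all
  -- ρ ⊇ π and the coefficients of the strictly larger ρ.
  upset-masses-determine : ∀ u v →
    (∀ π → mass (λ ρ → does (π ⊑? ρ)) u ≈ mass (λ ρ → does (π ⊑? ρ)) v) → u Free.≈ᴹ v
  upset-masses-determine u v h = coefficient-reflect u v λ π → go π (<-wellFounded (incomparability π))
    where
    go : ∀ π → Acc ℕ._<_ (incomparability π) → mass (λ ρ → does (ρ O.≟ π)) u ≈ mass (λ ρ → does (ρ O.≟ π)) v
    go π (acc rec) = RingProperties.+-cancelʳ ring _ _ _
      (trans (sym (split u)) (trans (h π) (trans (split v) (+-congˡ (sym above)))))
      where
      p = λ ρ → does (π ⊑? ρ)
      split : ∀ w → mass p w ≈ mass (λ ρ → does (ρ O.≟ π)) w + mass (p ∖ π) w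
      split = mass-∖ p (⊑-respects π) π (dec-true (π ⊑? π) λ _ _ x → x)
      above : mass (p ∖ π) u ≈ mass (p ∖ π) v
      above = mass-determined (p ∖ π) (∖-respects p π (⊑-respects π)) u v λ ρ e →
        let pρ , ρ≉π = ∖-true p π ρ e
            π⊑ρ = witness (π ⊑? ρ) pρ
        in go ρ (rec (incomparability-⊏ π ρ π⊑ρ λ ρ⊑π → ρ≉π λ i j → mk⇔ (ρ⊑π i j) (π⊑ρ i j)))
        where
        witness : ∀ {a} {A : Set a} (A? : Dec A) → does A? ≡ true → A
        witness (yes x) _ = x

-- Membership in the subgroups UT(π)

module UnipotentSubgroups {c ℓ₁ ℓ₂} (F : FiniteField c ℓ₁ ℓ₂) where

  open FiniteField F hiding (zero; _≟_; order-nonZero)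
  open UnipotentGroups F
  open Pattern

  -- `1# - 0#` is invertible with inverse `1#`, so `1#` is apart from `0#`, and apartness is
  -- irreflexive.
  1≉0 : ¬ 1# ≈ 0#
  1≉0 1≈0 = HF.#-irrefl 1≈0 (HF.invertible⇒# (1# , trans (*-identityˡ _) 1-0≈1 , trans (*-identityʳ _) 1-0≈1))
    where
    module HF = HeytingField (FiniteField.heytingField F)
    1-0≈1 : 1# - 0# ≈ 1#
    1-0≈1 = trans (+-congˡ (RingProperties.-0#≈0# ring)) (+-identityʳ 1#)

  1ₘ-diagonal : ∀ {n} (i j : Fin n) → i ≡ j → 1ₘ i j ≈ 1#
  1ₘ-diagonal i j i≡j with i Fin.≟ j
  ... | yes _  = refl
  ... | no i≢j = contradiction i≡j i≢j

  module _ {n} (π : NaturalUnitIntervalOrder n) where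
    private module G = Group (UT n)

    -- Seen as a pattern group, UT(π) inherits closure under products and inverses from the
    -- construction for patterns; `corestrict` and `included` translate between the two
    -- descriptions.
    orderPattern : Pattern n
    orderPattern = record { _∼_ = _≼_ π ; _∼?_ = _≼?_ π ; transitive = λ _ _ → ≼-trans π }

    private
      inclusion : PatternMatrix orderPattern → G.Carrier
      inclusion = include {P = orderPattern} {Q = fullPattern n} (λ _ _ → tt)

      corestrict : (g : G.Carrier) → InUT π g → PatternMatrix orderPattern
      corestrict g g∈ = record { entry = entry g ; offPattern = off }
        where
        off : ∀ i j → ¬ (i Fin.< j × _≼_ π i j) → entry g i j ≈ 1ₘ i j
        off i j ¬ij with i Fin.<? j
        ... | yes i<j = g∈ i j (λ p → ¬ij (i<j , p))
        ... | no  i≮j = offPattern g i j (λ (i<j , _) → i≮j i<j)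

      included : (g : PatternMatrix orderPattern) → InUT π (inclusion g)
      included g i j ¬ij = offPattern g i j (λ (_ , p) → ¬ij p)

    InUT-∙ : ∀ g h → InUT π g → InUT π h → InUT π (g G.∙ h)
    InUT-∙ g h g∈ h∈ = included (corestrict g g∈ ∙ₚ corestrict h h∈)

    InUT-⁻¹ : ∀ g → InUT π g → InUT π (g G.⁻¹)
    InUT-⁻¹ g g∈ = InUT-resp π {inclusion (g′ ⁻¹ₚ)} {g G.⁻¹} same (included (g′ ⁻¹ₚ))
      where
      g′ = corestrict g g∈
      -- The inverse is computed recursively in two different pattern groups; multiplicativity of
      -- `inclusion` and uniqueness of inverses identify the results.
      same : inclusion (g′ ⁻¹ₚ) G.≈ g G.⁻¹
      same = G.trans {inclusion (g′ ⁻¹ₚ)} {inclusion g′ G.⁻¹} {g G.⁻¹}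
        (homo-⁻¹ (PatternGroup orderPattern) (UT n) (include-isHomomorphism {P = orderPattern} {Q = fullPattern n} (λ _ _ → tt)) g′)
        (G.⁻¹-cong {inclusion g′} {g} (λ _ _ → refl))

    InUT-cancelˡ : ∀ g h → InUT π g → InUT π (g G.∙ h) → InUT π h
    InUT-cancelˡ g h g∈ gh∈ = InUT-resp π {g G.⁻¹ G.∙ (g G.∙ h)} {h}
      (Inverse.inverseʳ (translation (UT n) g) {h} {g G.∙ h} (λ _ _ → refl))
      (InUT-∙ (g G.⁻¹) (g G.∙ h) (InUT-⁻¹ g g∈) gh∈)

    -- The zeta function of the incidence algebra of `π`; `natural` makes it upper triangular and
    -- reflexivity puts ones on the diagonal.
    zeta : G.Carrier
    zeta = record { entry = λ i j → if does (_≼?_ π i j) then 1# else 0# ; offPattern = off }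
      where
      off : ∀ i j → ¬ (i Fin.< j × _) → (if does (_≼?_ π i j) then 1# else 0#) ≈ 1ₘ i j
      off i j i≮j with _≼?_ π i j
      ... | yes p = sym (1ₘ-diagonal i j (Fin.≤-antisym (natural π p) (ℕ.≮⇒≥ λ i<j → i≮j (i<j , tt))))
      ... | no ¬p = sym (1ₘ-off i j λ { ≡.refl → ¬p (≼-refl π) })

    InUT-zeta : ∀ ρ → InUT ρ zeta ⇔ (π ⊑ ρ)
    InUT-zeta ρ = mk⇔ to from
      where
      to : InUT ρ zeta → π ⊑ ρ
      -- A pair of `π` outside `ρ` would have entry 1 by construction and 0 by membership, since
      -- reflexivity of `ρ` rules out the diagonal.
      to ζ∈ i j πij = decidable-stable (_≼?_ ρ i j) λ ¬ρij → 1≉0 (trans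
        (one πij) (trans (ζ∈ i j ¬ρij) (1ₘ-off i j λ { ≡.refl → ¬ρij (≼-refl ρ) })))
        where
        one : ∀ {i j} → _≼_ π i j → 1# ≈ (if does (_≼?_ π i j) then 1# else 0#)
        one {i} {j} πij with _≼?_ π i j
        ... | yes _   = refl
        ... | no ¬πij = contradiction πij ¬πij
      from : π ⊑ ρ → InUT ρ zeta
      from π⊑ρ i j ¬ρij with _≼?_ π i j
      ... | yes πij = contradiction (π⊑ρ i j πij) ¬ρij
      ... | no _    = sym (1ₘ-off i j λ { ≡.refl → ¬ρij (≼-refl ρ) })

  module _ {n a b} (I : Split n a b) where

    open Split I
    open Parabolic I
    private
      module UL = Group UL
      module UR = Group UR
      module UP = Group UP
      module G = Group (UT n)

    fromLevi : UL.Carrier → UP.Carrier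
    fromLevi = include levi⊆parabolic

    fromRadical : UR.Carrier → UP.Carrier
    fromRadical = include radical⊆parabolic

    toUT : UP.Carrier → G.Carrier
    toUT = include parabolic⊆full

    -- In the sum over `j`, either `j` lies in the common block of `i` and `k`, where `x` is the
    -- identity, or `l` vanishes at `i`, `j`.
    levi-radical-block : ∀ l x i k → member i ≡ member k → entry (fromLevi l UP.∙ fromRadical x) i k ≈ entry l i k
    levi-radical-block l x i k i∼k = trans
      (sum-cong (λ j → entry l i j * entry x j k) (λ j → entry l i j * 1ₘ j k) step) (sum-1ʳ k (entry l i))
      where
      step : ∀ j → entry l i j * entry x j k ≈ entry l i j * 1ₘ j k
      step j with member i Bool.≟ member j
      ... | yes i∼j = *-congˡ (offPattern x j k λ (_ , p , q) →
              contradiction (≡.trans (≡.sym p) (≡.trans (≡.sym i∼j) (≡.trans i∼k q))) λ ())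
      ... | no i≁j  = trans (*-congʳ l≈0) (trans (zeroˡ _) (sym (trans (*-congʳ l≈0) (zeroˡ _))))
        where
        l≈0 : entry l i j ≈ 0#
        l≈0 = levi-zero l {i} {j} ≡.refl ≡.refl i≁j

    module _ (π : NaturalUnitIntervalOrder n) where

      InUT-levi : ∀ g h → InUT (restrictˡ I π) g → InUT (restrictʳ I π) h → InUT π (toUT (fromLevi (glue (g , h))))
      InUT-levi g h g∈ h∈ i j ¬ij = ≡.subst₂ (λ i′ j′ → glued (g , h) (to i) (to j) ≈ 1ₘ i′ j′)
        (strictlyInverseʳ i) (strictlyInverseʳ j)
        (cases (to i) (to j) (≡.subst₂ (λ i′ j′ → ¬ _≼_ π i′ j′) (≡.sym (strictlyInverseʳ i)) (≡.sym (strictlyInverseʳ j)) ¬ij))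
        where
        distinct : ∀ {i′ j′} → member i′ ≡ true → member j′ ≡ false → i′ ≢ j′
        distinct p q ≡.refl = contradiction (≡.trans (≡.sym p) q) λ ()
        cases : ∀ s t → ¬ _≼_ π (from s) (from t) → glued (g , h) s t ≈ 1ₘ (from s) (from t)
        cases (inj₁ i) (inj₁ j) ¬ij = trans (g∈ i j ¬ij) (sym (1ₘ-embed embedˡ embedˡ-injective i j))
        cases (inj₁ i) (inj₂ j) ¬ij = sym (1ₘ-off (embedˡ i) (embedʳ j) (distinct (member-embedˡ i) (member-embedʳ j)))
        cases (inj₂ i) (inj₁ j) ¬ij = sym (1ₘ-off (embedʳ i) (embedˡ j) (distinct (member-embedˡ j) (member-embedʳ i) ∘ ≡.sym))
        cases (inj₂ i) (inj₂ j) ¬ij = trans (h∈ i j ¬ij) (sym (1ₘ-embed embedʳ embedʳ-injective i j))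

      -- From left to right, the diagonal blocks of the product give the conditions on `g` and `h`;
      -- these put `L` into UT(π), and cancelling it leaves `X`.
      InUT-levi-radical : ∀ g h x →
        InUT π (toUT (fromLevi (glue (g , h)) UP.∙ fromRadical x)) ⇔
        ((InUT (restrictˡ I π) g × InUT (restrictʳ I π) h) × InUT π (toUT (fromRadical x)))
      InUT-levi-radical g h x = mk⇔
        (λ lx∈ → let g∈ = left lx∈ ; h∈ = right lx∈ in (g∈ , h∈) , InUT-cancelˡ π L X (InUT-levi g h g∈ h∈) lx∈)
        (λ ((g∈ , h∈) , x∈) → InUT-∙ π L X (InUT-levi g h g∈ h∈) x∈)
        where
        l : UL.Carrier
        l = glue (g , h)
        L X : G.Carrier
        L = toUT (fromLevi l)
        X = toUT (fromRadical x)
        left : InUT π (toUT (fromLevi l UP.∙ fromRadical x)) → InUT (restrictˡ I π) g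
        left lx∈ i j ¬ij = trans (sym (glued-to (g , h) {embedˡ i} {embedˡ j} (strictlyInverseˡ (inj₁ i)) (strictlyInverseˡ (inj₁ j))))
          (trans (sym (levi-radical-block l x (embedˡ i) (embedˡ j) (≡.trans (member-embedˡ i) (≡.sym (member-embedˡ j)))))
            (trans (lx∈ (embedˡ i) (embedˡ j) ¬ij) (1ₘ-embed embedˡ embedˡ-injective i j)))
        right : InUT π (toUT (fromLevi l UP.∙ fromRadical x)) → InUT (restrictʳ I π) h
        right lx∈ i j ¬ij = trans (sym (glued-to (g , h) {embedʳ i} {embedʳ j} (strictlyInverseˡ (inj₂ i)) (strictlyInverseˡ (inj₂ j))))
          (trans (sym (levi-radical-block l x (embedʳ i) (embedʳ j) (≡.trans (member-embedʳ i) (≡.sym (member-embedʳ j)))))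
            (trans (lx∈ (embedʳ i) (embedʳ j) ¬ij) (1ₘ-embed embedʳ embedʳ-injective i j)))

      -- Pairs outside `π` that are not ascents lie off the radical pattern, where `x` agrees with
      -- the identity anyway.
      InUT-radical : ∀ x → InUT π (toUT (fromRadical x)) ⇔ All (λ (i , j) → entry x i j ≈ 0#) (ascents I π)
      InUT-radical x = mk⇔
        (λ x∈ → All.map (λ {(i , j)} (_ , _ , i<j , ¬ij) → trans (x∈ i j ¬ij) (1ₘ-off i j (Fin.<⇒≢ i<j))) (All-ascents I π))
        (λ zeros i j ¬ij → cases zeros i j ¬ij ((i Fin.<? j) ×-dec _∼?_ radical i j))
        where
        cases : All (λ (i , j) → entry x i j ≈ 0#) (ascents I π) → ∀ i j → ¬ _≼_ π i j → Dec (i Fin.< j × _∼_ radical i j) → entry x i j ≈ 1ₘ i j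
        cases zeros i j ¬ij (no ¬p) = offPattern x i j ¬p
        cases zeros i j ¬ij (yes (i<j , i∈ , j∉)) = trans
          (All.lookup zeros (∈-ascents I π (i∈ , j∉ , i<j , ¬ij)))
          (sym (1ₘ-off i j (Fin.<⇒≢ i<j)))

  module _ {n m} (π : NaturalUnitIntervalOrder n) (ρ : NaturalUnitIntervalOrder m) where
    private
      S = prefixSplit n m
    open Split S
    open Parabolic S

    -- `g` and `g′` are one matrix, seen in the unitriangular and in the parabolic group. The upper
    -- right rectangle lies entirely in `π ⋆ ρ` and the lower left one vanishes by triangularity, so
    -- only the diagonal blocks are tested.
    InUT-⋆ : ∀ (g : PatternMatrix (fullPattern (n ℕ.+ m))) (g′ : PatternMatrix parabolic) → (∀ i j → entry g i j ≈ entry g′ i j) →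
      InUT (π ⋆ ρ) g ⇔ (InUT π (proj₁ (blocks (leviPart g′))) × InUT ρ (proj₂ (blocks (leviPart g′))))
    InUT-⋆ g g′ g≈g′ = mk⇔ to′ from′
      where
      diagonal : ∀ i j → member i ≡ member j → entry g i j ≈ entry (leviPart g′) i j
      diagonal i j p with member i Bool.≟ member j
      ... | yes _ = g≈g′ i j
      ... | no ¬p = contradiction p ¬p
      diagonalˡ : ∀ i j → entry g (embedˡ i) (embedˡ j) ≈ entry (leviPart g′) (embedˡ i) (embedˡ j)
      diagonalˡ i j = diagonal _ _ (≡.trans (member-embedˡ i) (≡.sym (member-embedˡ j)))
      diagonalʳ : ∀ i j → entry g (embedʳ i) (embedʳ j) ≈ entry (leviPart g′) (embedʳ i) (embedʳ j)
      diagonalʳ i j = diagonal _ _ (≡.trans (member-embedʳ i) (≡.sym (member-embedʳ j)))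
      ⋆-embedˡ : ∀ i j → _≼_ (π ⋆ ρ) (embedˡ i) (embedˡ j) ≡ _≼_ π i j
      ⋆-embedˡ i j rewrite Fin.splitAt-↑ˡ n i m | Fin.splitAt-↑ˡ n j m = ≡.refl
      ⋆-embedʳ : ∀ i j → _≼_ (π ⋆ ρ) (embedʳ i) (embedʳ j) ≡ _≼_ ρ i j
      ⋆-embedʳ i j rewrite Fin.splitAt-↑ʳ n m i | Fin.splitAt-↑ʳ n m j = ≡.refl
      ⋆-embedˡʳ : ∀ i j → _≼_ (π ⋆ ρ) (embedˡ i) (embedʳ j)
      ⋆-embedˡʳ i j rewrite Fin.splitAt-↑ˡ n i m | Fin.splitAt-↑ʳ n m j = tt
      to′ : InUT (π ⋆ ρ) g → InUT π (proj₁ (blocks (leviPart g′))) × InUT ρ (proj₂ (blocks (leviPart g′)))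
      to′ g∈ =
          (λ i j ¬ij → trans (sym (diagonalˡ i j))
            (trans (g∈ _ _ (λ p → ¬ij (≡.subst id (⋆-embedˡ i j) p))) (1ₘ-embed embedˡ embedˡ-injective i j)))
        , (λ i j ¬ij → trans (sym (diagonalʳ i j))
            (trans (g∈ _ _ (λ p → ¬ij (≡.subst id (⋆-embedʳ i j) p))) (1ₘ-embed embedʳ embedʳ-injective i j)))
      from′ : InUT π (proj₁ (blocks (leviPart g′))) × InUT ρ (proj₂ (blocks (leviPart g′))) → InUT (π ⋆ ρ) g
      from′ (g∈ , h∈) i j ¬ij = ≡.subst₂ (λ i′ j′ → entry g i′ j′ ≈ 1ₘ i′ j′) (strictlyInverseʳ i) (strictlyInverseʳ j)
        (cases (to i) (to j) (≡.subst₂ (λ i′ j′ → ¬ _≼_ (π ⋆ ρ) i′ j′) (≡.sym (strictlyInverseʳ i)) (≡.sym (strictlyInverseʳ j)) ¬ij))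
        where
        cases : ∀ s t → ¬ _≼_ (π ⋆ ρ) (from s) (from t) → entry g (from s) (from t) ≈ 1ₘ (from s) (from t)
        cases (inj₁ i) (inj₁ j) ¬ij = trans (diagonalˡ i j)
          (trans (g∈ i j (λ p → ¬ij (≡.subst id (≡.sym (⋆-embedˡ i j)) p))) (sym (1ₘ-embed embedˡ embedˡ-injective i j)))
        cases (inj₁ i) (inj₂ j) ¬ij = contradiction (⋆-embedˡʳ i j) ¬ij
        cases (inj₂ i) (inj₁ j) ¬ij = offPattern g (embedʳ i) (embedˡ j) λ (r<l , _) → ℕ.<-asym r<l (l<r j i)
          where
          l<r : ∀ i j → embedˡ i Fin.< embedʳ j
          l<r i j = ≡.subst₂ ℕ._<_ (≡.sym (Fin.toℕ-↑ˡ i m)) (≡.sym (Fin.toℕ-↑ʳ n j)) (ℕ.m≤n⇒m≤n+o _ (Fin.toℕ<n i))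
        cases (inj₂ i) (inj₂ j) ¬ij = trans (diagonalʳ i j)
          (trans (h∈ i j (λ p → ¬ij (≡.subst id (≡.sym (⋆-embedʳ i j)) p))) (sym (1ₘ-embed embedʳ embedʳ-injective i j)))

-- Averages over finite sets and over the radical

module Averages {k κ₁ κ₂} (K : CharacteristicZeroField k κ₁ κ₂) where

  open CharacteristicZeroField K hiding (zero)
  open ClassFunctions K
  open CommutativeSemigroupProperties *-commutativeSemigroup using (x∙yz≈y∙xz)

  indicate : Bool → Carrier
  indicate p = if p then 1# else 0#

  indicate-∧ : ∀ p p′ → indicate (p ∧ p′) ≈ indicate p * indicate p′
  indicate-∧ true  p′ = sym (*-identityˡ _)
  indicate-∧ false p′ = sym (zeroˡ _)

  1/-cancel : ∀ m .{{_ : NonZero m}} x → (1/ m) * (m ·ℕ x) ≈ x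
  1/-cancel m x = begin
    (1/ m) * (m ·ℕ x)            ≈⟨ *-congˡ (×-congʳ m (*-identityˡ x)) ⟨
    (1/ m) * (m ·ℕ (1# * x))     ≈⟨ *-congˡ (×-assoc-* m 1# x) ⟨
    (1/ m) * ((m ·ℕ 1#) * x)     ≈⟨ *-assoc _ _ _ ⟨
    (1/ m) * (m ·ℕ 1#) * x       ≈⟨ *-congʳ (1/-inverse m) ⟩
    1# * x                       ≈⟨ *-identityˡ x ⟩
    x                            ∎
    where
    open SetoidReasoning setoid
    open Mult semiring using (×-assoc-*; ×-congʳ)

  module _ {a ℓ} {S : Setoid a ℓ} (S-finite : Finite S) (x : Setoid.Carrier S) where

    average-cong : ∀ {f h} → (∀ y → f y ≈ h y) → average S-finite x f ≈ average S-finite x h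
    average-cong p = *-congˡ (∑-cong S-finite p)

    average-+ : ∀ f h → average S-finite x (λ y → f y + h y) ≈ average S-finite x f + average S-finite x h
    average-+ f h = trans (*-congˡ (Sum.∑-distrib-+ semiring (f ∘ Finite.element S-finite) (h ∘ Finite.element S-finite))) (distribˡ _ _ _)

    average-* : ∀ s f → average S-finite x (λ y → s * f y) ≈ s * average S-finite x f
    average-* s f = trans (*-congˡ (sym (*-distribˡ-∑ S-finite s f))) (x∙yz≈y∙xz _ s _)

module RadicalAverages
  {c ℓ₁ ℓ₂ k κ₁ κ₂} (F : FiniteField c ℓ₁ ℓ₂) (K : CharacteristicZeroField k κ₁ κ₂)
  {n a b} (I : Split n a b) where

  open UnipotentGroups F
  open Parabolic I
  open ClassFunctions K
  open CharacteristicZeroField K hiding (zero)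
  open UnipotentClassFunctions F K using (q⁻¹)
  open Averages K
  open Exp semiring using (_^_)
  private
    module F = FiniteField F
    module UR = Group UR

  infix 4 _∈ᴿ
  _∈ᴿ : Fin n × Fin n → Set
  (i , j) ∈ᴿ = i Fin.< j × Pattern._∼_ radical i j

  shiftBy : Fin n × Fin n → F.Carrier → Fin n × Fin n → F.Carrier
  shiftBy p s p′ = if does (≡-dec Fin._≟_ Fin._≟_ p p′) then s else F.0#

  shiftBy-≡ : ∀ p s → shiftBy p s p F.≈ s
  shiftBy-≡ p s with ≡-dec Fin._≟_ Fin._≟_ p p
  ... | yes _  = F.refl
  ... | no p≢p = contradiction ≡.refl p≢p

  shiftBy-≢ : ∀ p s {p′} → p ≢ p′ → shiftBy p s p′ F.≈ F.0#
  shiftBy-≢ p s {p′} p≢p′ with ≡-dec Fin._≟_ Fin._≟_ p p′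
  ... | yes p≡p′ = contradiction p≡p′ p≢p′
  ... | no _     = F.refl

  shiftBy-cancel : ∀ p s p′ → shiftBy p s p′ F.+ shiftBy p (F.- s) p′ F.≈ F.0#
  shiftBy-cancel p s p′ with ≡-dec Fin._≟_ Fin._≟_ p p′
  ... | yes _ = F.-‿inverseʳ s
  ... | no _  = F.+-identityˡ F.0#

  -- Radical positions are free coordinates of UR, so one of them can be translated at will; `p∈`
  -- guarantees that no entry fixed by the pattern moves.
  shift : ∀ p → p ∈ᴿ → F.Carrier → UR.Carrier → UR.Carrier
  shift p p∈ s x = record
    { entry = λ i j → entry x i j F.+ shiftBy p s (i , j)
    ; offPattern = λ i j ¬ij → F.trans
        (F.+-cong (offPattern x i j ¬ij) (shiftBy-≢ p s λ { ≡.refl → ¬ij p∈ })) (F.+-identityʳ _)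
    }

  shift-inverse : ∀ p → p ∈ᴿ → F.Carrier → Inverse UR.setoid UR.setoid
  shift-inverse p p∈ s = record
    { to = shift p p∈ s
    ; from = shift p p∈ (F.- s)
    ; to-cong = λ e i j → F.+-congʳ (e i j)
    ; from-cong = λ e i j → F.+-congʳ (e i j)
    ; inverse =
        (λ {x} {y} e i j → F.trans (F.+-congʳ (e i j)) (F.trans (F.+-assoc _ _ _)
          (F.trans (F.+-congˡ (F.trans (F.+-comm _ _) (shiftBy-cancel p s (i , j)))) (F.+-identityʳ _))))
      , (λ {x} {y} e i j → F.trans (F.+-congʳ (e i j)) (F.trans (F.+-assoc _ _ _)
          (F.trans (F.+-congˡ (shiftBy-cancel p s (i , j))) (F.+-identityʳ _))))
    }

  Vanishes : List (Fin n × Fin n) → UR.Carrier → Set (ℓ₁)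
  Vanishes L x = All (λ (i , j) → entry x i j F.≈ F.0#) L

  vanishes? : ∀ L x → Dec (Vanishes L x)
  vanishes? L x = All.all? (λ (i , j) → entry x i j F.≟ F.0#) L

  vanishing : List (Fin n × Fin n) → UR.Carrier → Carrier
  vanishing L x = indicate (does (vanishes? L x))

  vanishing-cong : ∀ L {x y} → x UR.≈ y → vanishing L x ≈ vanishing L y
  vanishing-cong L {x} {y} e = reflexive (≡.cong indicate (does-⇔
    (mk⇔ (All.map λ {(i , j)} → F.trans (F.sym (e i j))) (All.map λ {(i , j)} → F.trans (e i j))) (vanishes? L x) (vanishes? L y)))

  Vanishes-shift : ∀ p (p∈ : p ∈ᴿ) {L} → All (p ≢_) L → ∀ s x →
    Vanishes (p ∷ L) (shift p p∈ s x) ⇔ (s F.≈ F.- entry x (proj₁ p) (proj₂ p) × Vanishes L x)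
  Vanishes-shift p p∈ {L} p∉L s x = mk⇔
    (λ { (z ∷ zs) → G.inverseʳ-unique _ _ (F.trans (F.+-congˡ (F.sym (shiftBy-≡ p s))) z) , unshift p∉L zs })
    (λ (e , zs) → F.trans (F.+-congˡ (F.trans (shiftBy-≡ p s) e)) (F.-‿inverseʳ _) ∷ reshift p∉L zs)
    where
    module G = GroupProperties F.+-group
    unshift : ∀ {L} → All (p ≢_) L → Vanishes L (shift p p∈ s x) → Vanishes L x
    unshift []          []       = []
    unshift (p≢ ∷ p∉) (z ∷ zs) = F.trans (F.sym (F.trans (F.+-congˡ (shiftBy-≢ p s p≢)) (F.+-identityʳ _))) z ∷ unshift p∉ zs
    reshift : ∀ {L} → All (p ≢_) L → Vanishes L x → Vanishes L (shift p p∈ s x)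
    reshift []          []       = []
    reshift (p≢ ∷ p∉) (z ∷ zs) = F.trans (F.trans (F.+-congˡ (shiftBy-≢ p s p≢)) (F.+-identityʳ _)) z ∷ reshift p∉ zs

  -- For fixed `x` exactly one `s` kills the entry at `p`, and the entries at `L` stay put. The
  -- right-hand side has the shape that `∑-delta` evaluates when summed over `s`.
  vanishing-shift : ∀ p (p∈ : p ∈ᴿ) {L} → All (p ≢_) L → ∀ s x →
    vanishing (p ∷ L) (shift p p∈ s x) ≈ (if does (s F.≟ (F.- entry x (proj₁ p) (proj₂ p))) then vanishing L x else 0#)
  vanishing-shift p p∈ {L} p∉L s x = trans
    (reflexive (≡.cong indicate (does-⇔ (Vanishes-shift p p∈ p∉L s x) (vanishes? (p ∷ L) (shift p p∈ s x))
      ((s F.≟ (F.- entry x (proj₁ p) (proj₂ p))) ×-dec vanishes? L x))))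
    (conjunction (does (s F.≟ (F.- entry x (proj₁ p) (proj₂ p)))) (does (vanishes? L x)))
    where
    conjunction : ∀ u v → indicate (u ∧ v) ≈ (if u then indicate v else 0#)
    conjunction true  v = refl
    conjunction false v = refl

  -- Translating the entry at p by s and summing over s ∈ F fills the fibres of x ↦ x_p.
  ∑-vanishing-∷ : ∀ p (p∈ : p ∈ᴿ) {L} → All (p ≢_) L →
    F.order ·ℕ ∑ UR-finite (vanishing (p ∷ L)) ≈ ∑ UR-finite (vanishing L)
  ∑-vanishing-∷ p p∈ {L} p∉L = begin
    F.order ·ℕ ∑ UR-finite (vanishing (p ∷ L))
      ≈⟨ Sum.sum-replicate semiring F.order ⟨
    ∑ F.finite (λ s → ∑ UR-finite (vanishing (p ∷ L)))
      ≈⟨ ∑-cong F.finite {λ s → ∑ UR-finite (λ x → vanishing (p ∷ L) (shift p p∈ s x))} {λ s → ∑ UR-finite (vanishing (p ∷ L))}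
           (λ s → ∑-reindex UR-finite (vanishing (p ∷ L)) (λ {x} {y} → vanishing-cong (p ∷ L) {x} {y}) (shift-inverse p p∈ s)) ⟨
    ∑ F.finite (λ s → ∑ UR-finite (λ x → vanishing (p ∷ L) (shift p p∈ s x)))
      ≈⟨ ∑-cong F.finite (λ s → ∑-cong UR-finite λ x → vanishing-shift p p∈ p∉L s x) ⟩
    ∑ F.finite (λ s → ∑ UR-finite (λ x → if does (s F.≟ at x) then vanishing L x else 0#))
      ≈⟨ ∑-swap F.finite UR-finite (λ s x → if does (s F.≟ at x) then vanishing L x else 0#) ⟩
    ∑ UR-finite (λ x → ∑ F.finite (λ s → if does (s F.≟ at x) then vanishing L x else 0#))
      ≈⟨ ∑-cong UR-finite (λ x → ∑-delta F.finite (λ _ → vanishing L x) (λ _ → refl) (at x)) ⟩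
    ∑ UR-finite (vanishing L) ∎
    where
    open SetoidReasoning setoid
    at : UR.Carrier → F.Carrier
    at x = F.- entry x (proj₁ p) (proj₂ p)

  private
    mean : (UR.Carrier → Carrier) → Carrier
    mean = average UR-finite UR.ε

  -- Each position costs one factor `q⁻¹`. `Unique` keeps the head out of the tail: a repeated
  -- position would add to the length without adding a condition.
  average-vanishing : ∀ L → Unique L → All _∈ᴿ L → mean (vanishing L) ≈ q⁻¹ ^ length L
  average-vanishing []      _          _          = average-constant UR-finite UR.ε 1#
  average-vanishing (p ∷ L) (p∉L ∷ uL) (p∈ ∷ L∈) = begin
    -- Inserting `q⁻¹` times the order of `F` produces the multiple of the sum that `∑-vanishing-∷`
    -- simplifies.
    w * ∑ UR-finite (vanishing (p ∷ L))                          ≈⟨ *-congˡ (1/-cancel F.order {{F.order-nonZero}} _) ⟨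
    w * (q⁻¹ * (F.order ·ℕ ∑ UR-finite (vanishing (p ∷ L))))     ≈⟨ *-congˡ (*-congˡ (∑-vanishing-∷ p p∈ p∉L)) ⟩
    w * (q⁻¹ * ∑ UR-finite (vanishing L))                        ≈⟨ x∙yz≈y∙xz w q⁻¹ _ ⟩
    q⁻¹ * mean (vanishing L)                                     ≈⟨ *-congˡ (average-vanishing L uL L∈) ⟩
    q⁻¹ * q⁻¹ ^ length L                                         ∎
    where
    open SetoidReasoning setoid
    open CommutativeSemigroupProperties *-commutativeSemigroup using (x∙yz≈y∙xz)
    w : Carrier
    w = 1/_ (Finite.size UR-finite) {{Finite.size-nonZero UR-finite UR.ε}}

-- Linear maps, tensor products and direct sums

module _ {r ℓr} (R : CommutativeRing r ℓr) where

  open CommutativeRing R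
  open LinearAlgebra R

  module _ {m₁ ℓ₁ m₂ ℓ₂} (M : LeftModule ring m₁ ℓ₁) (N : LeftModule ring m₂ ℓ₂) where

    private
      module M = LeftModule M
      module N = LeftModule N
    open LeftModuleMorphisms M.rawLeftModule N.rawLeftModule

    linear⇒isLeftModuleHomomorphism : ∀ {f} → (∀ {x y} → x M.≈ᴹ y → f x N.≈ᴹ f y) →
      (∀ x y → f (x M.+ᴹ y) N.≈ᴹ f x N.+ᴹ f y) → (∀ s x → f (s M.*ₗ x) N.≈ᴹ s N.*ₗ f x) →
      IsLeftModuleHomomorphism f
    linear⇒isLeftModuleHomomorphism {f} f-cong f-+ f-* = record
      { +ᴹ-isGroupHomomorphism = record
        { isMonoidHomomorphism = record
          { isMagmaHomomorphism = record
            { isRelHomomorphism = record { cong = f-cong }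
            ; homo = f-+
            }
          ; ε-homo = f-0
          }
        ; ⁻¹-homo = λ x → GroupProperties.inverseˡ-unique (AbelianGroup.group N.+ᴹ-abelianGroup) _ _
            (N.≈ᴹ-trans (N.≈ᴹ-sym (f-+ _ _)) (N.≈ᴹ-trans (f-cong (M.-ᴹ‿inverseˡ x)) f-0))
        }
      ; *ₗ-homo = f-*
      }
      where
      f-0 : f M.0ᴹ N.≈ᴹ N.0ᴹ
      f-0 = N.≈ᴹ-trans (f-cong (M.≈ᴹ-sym (M.*ₗ-zeroˡ M.0ᴹ))) (N.≈ᴹ-trans (f-* 0# M.0ᴹ) (N.*ₗ-zeroˡ _))

  module _ {m₁ ℓ₁ m₂ ℓ₂ m₃ ℓ₃ m₄ ℓ₄}
    {M : LeftModule ring m₁ ℓ₁} {N : LeftModule ring m₂ ℓ₂} {M′ : LeftModule ring m₃ ℓ₃} {N′ : LeftModule ring m₄ ℓ₄}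
    {f : LeftModule.Carrierᴹ M → LeftModule.Carrierᴹ M′} {g : LeftModule.Carrierᴹ N → LeftModule.Carrierᴹ N′}
    (f-homo : LeftModuleMorphisms.IsLeftModuleHomomorphism (LeftModule.rawLeftModule M) (LeftModule.rawLeftModule M′) f)
    (g-homo : LeftModuleMorphisms.IsLeftModuleHomomorphism (LeftModule.rawLeftModule N) (LeftModule.rawLeftModule N′) g)
    where

    private
      module M′ = LeftModule M′
      module N′ = LeftModule N′
      module f = LeftModuleMorphisms.IsLeftModuleHomomorphism f-homo
      module g = LeftModuleMorphisms.IsLeftModuleHomomorphism g-homo

    -- Linearity of `f` and `g` carries each generating relation to a derivable one. This moves an
    -- identity from a single bidegree into the tensor square of the direct sum.
    ⊗-map-cong : ∀ {t u} → TensorEq M N t u → TensorEq M′ N′ (map (Product.map f g) t) (map (Product.map f g) u)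
    ⊗-map-cong ⊗-refl = ⊗-refl
    ⊗-map-cong (⊗-sym p) = ⊗-sym (⊗-map-cong p)
    ⊗-map-cong (⊗-trans p q) = ⊗-trans (⊗-map-cong p) (⊗-map-cong q)
    ⊗-map-cong (⊗-cong {t} {t′} {u} {u′} p q) =
      ≡.subst₂ (TensorEq M′ N′) (≡.sym (map-++ _ t u)) (≡.sym (map-++ _ t′ u′)) (⊗-cong (⊗-map-cong p) (⊗-map-cong q))
    ⊗-map-cong (⊗-comm t u) =
      ≡.subst₂ (TensorEq M′ N′) (≡.sym (map-++ _ t u)) (≡.sym (map-++ _ u t)) (⊗-comm (map _ t) (map _ u))
    ⊗-map-cong (⊗-pair p q) = ⊗-pair (f.⟦⟧-cong p) (g.⟦⟧-cong q)
    ⊗-map-cong (⊗-distribʳ x x′ y) = ⊗-trans (⊗-pair (f.+ᴹ-homo x x′) N′.≈ᴹ-refl) (⊗-distribʳ _ _ _)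
    ⊗-map-cong (⊗-distribˡ x y y′) = ⊗-trans (⊗-pair M′.≈ᴹ-refl (g.+ᴹ-homo y y′)) (⊗-distribˡ _ _ _)
    ⊗-map-cong (⊗-balanced s x y) = ⊗-trans (⊗-pair (f.*ₗ-homo s x) N′.≈ᴹ-refl)
      (⊗-trans (⊗-balanced s _ _) (⊗-pair M′.≈ᴹ-refl (N′.≈ᴹ-sym (g.*ₗ-homo s y))))
    ⊗-map-cong (⊗-zeroˡ y) = ⊗-trans (⊗-pair f.0ᴹ-homo N′.≈ᴹ-refl) (⊗-zeroˡ _)

  module _ {m₁ ℓ₁ m₂ ℓ₂} {M : LeftModule ring m₁ ℓ₁} {N : LeftModule ring m₂ ℓ₂} where

    ⊗-concatMap-cong : ∀ {a} {A : Set a} {f g : A → Tensors M N} →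
      (∀ x → TensorEq M N (f x) (g x)) → ∀ xs → TensorEq M N (concatMap f xs) (concatMap g xs)
    ⊗-concatMap-cong h []       = ⊗-refl
    ⊗-concatMap-cong h (x ∷ xs) = ⊗-cong (h x) (⊗-concatMap-cong h xs)

    -- One step of an interchange of two summations: commutativity brings the terms `f x` to the
    -- front.
    ⊗-concatMap-∷ : ∀ {a} {A : Set a} (f : A → LeftModule.Carrierᴹ M × LeftModule.Carrierᴹ N) (g : A → Tensors M N) xs →
      TensorEq M N (concatMap (λ x → f x ∷ g x) xs) (map f xs ++ concatMap g xs)
    ⊗-concatMap-∷ f g []       = ⊗-refl
    ⊗-concatMap-∷ f g (x ∷ xs) = ⊗-cong {t = List.[ f x ]} ⊗-refl
      (⊗-trans (⊗-cong {t = g x} ⊗-refl (⊗-concatMap-∷ f g xs))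
        (≡.subst₂ (TensorEq M N) (++-assoc (g x) (map f xs) _) (++-assoc (map f xs) (g x) _)
          (⊗-cong (⊗-comm (g x) (map f xs)) ⊗-refl)))

  module DirectSum {m ℓ} (M : ℕ → LeftModule ring m ℓ) where

    private
      module M n = LeftModule (M n)
      module ⨁M = LeftModule (⨁ M)

    component-cong : ∀ k n {x y} → M._≈ᴹ_ n x y → M._≈ᴹ_ k (component M k (n , x)) (component M k (n , y))
    component-cong k n p with n ℕ.≟ k
    ... | yes ≡.refl = p
    ... | no _       = M.≈ᴹ-refl k

    component-+ : ∀ k n x y → M._≈ᴹ_ k (component M k (n , M._+ᴹ_ n x y)) (M._+ᴹ_ k (component M k (n , x)) (component M k (n , y)))
    component-+ k n x y with n ℕ.≟ k
    ... | yes ≡.refl = M.≈ᴹ-refl k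
    ... | no _       = M.≈ᴹ-sym k (M.+ᴹ-identityˡ k _)

    ∷-cong : ∀ n {x y xs ys} → M._≈ᴹ_ n x y → xs ⨁M.≈ᴹ ys → ((n , x) ∷ xs) ⨁M.≈ᴹ ((n , y) ∷ ys)
    ∷-cong n p q k = M.+ᴹ-cong k (component-cong k n p) (q k)

    homogeneous-isLeftModuleHomomorphism : ∀ n →
      LeftModuleMorphisms.IsLeftModuleHomomorphism (M.rawLeftModule n) ⨁M.rawLeftModule (homogeneous M n)
    homogeneous-isLeftModuleHomomorphism n = linear⇒isLeftModuleHomomorphism (M n) (⨁ M)
      (λ {x} {y} p → ∷-cong n {x} {y} {[]} {[]} p (⨁M.≈ᴹ-refl {[]}))
      (λ x y k → M.≈ᴹ-trans k (M.+ᴹ-congʳ k (component-+ k n x y)) (M.+ᴹ-assoc k _ _ _))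
      (λ s x → ⨁M.≈ᴹ-refl {List.[ scale M s (n , x) ]})

-- Linearity and injectivity of the map

module Morphism {c ℓ₁ ℓ₂ k κ₁ κ₂} (F : FiniteField c ℓ₁ ℓ₂) (K : CharacteristicZeroField k κ₁ κ₂) where

  open CharacteristicZeroField K hiding (zero)
  open LinearAlgebra commutativeRing
  open ClassFunctions K hiding (inner)
  open UnipotentGroups F hiding (sum-cong)
  open UnipotentClassFunctions F K
  open IncomparabilityGraphs commutativeRing q⁻¹ using (IG; IGₙ; IG-space; inc)
    renaming (product to IG-product; coproduct to IG-coproduct)
  open UnipotentSubgroups F
  open Averages K
  open Exp semiring using (_^_)
  open CommutativeSemigroupProperties *-commutativeSemigroup using (interchange)

  private
    module F = FiniteField F
    module IGₙ n = LeftModule (IGₙ n)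
    module cfUT n = LeftModule (cfUT n)
    module IG = RawHopfAlgebra IG
    module CF = RawHopfAlgebra cfUT-Hopf
    module ⨁cf = DirectSum commutativeRing cfUT

  module _ {n : ℕ} where

    open FreeModule commutativeRing (orderDecSetoid n)
    private module UT = Group (UT n)

    contains : UT.Carrier → NaturalUnitIntervalOrder n → Bool
    contains g π = does (InUT? π g)

    contains-respects : ∀ g → Respects (contains g)
    contains-respects g π ρ e = does-⇔
      (mk⇔ (λ h i j ¬ij → h i j (¬ij ∘ Equivalence.to (e i j))) (λ h i j ¬ij → h i j (¬ij ∘ Equivalence.from (e i j))))
      (InUT? π g) (InUT? ρ g)

    -- Through this identity `mass-cong` shows that the map is well defined, and the choice
    -- `g = zeta π` turns the predicate into an up-set.
    incToδ̄ₙ-mass : ∀ u g → ⟦ incToδ̄ₙ n u ⟧ g ≈ mass (contains g) u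
    incToδ̄ₙ-mass []            g = refl
    incToδ̄ₙ-mass ((s , π) ∷ u) g = +-cong (scaled (contains g π)) (incToδ̄ₙ-mass u g)
      where
      scaled : ∀ p → s * indicate p ≈ (if p then s else 0#)
      scaled true  = *-identityʳ s
      scaled false = zeroʳ s

    incToδ̄ₙ-cong : ∀ u v → IGₙ._≈ᴹ_ n u v → cfUT._≈ᴹ_ n (incToδ̄ₙ n u) (incToδ̄ₙ n v)
    incToδ̄ₙ-cong u v u≈v g = trans (incToδ̄ₙ-mass u g)
      (trans (mass-cong (contains g) (contains-respects g) u v u≈v) (sym (incToδ̄ₙ-mass v g)))

    incToδ̄ₙ-++ : ∀ u v → cfUT._≈ᴹ_ n (incToδ̄ₙ n (u ++ v)) (cfUT._+ᴹ_ n (incToδ̄ₙ n u) (incToδ̄ₙ n v))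
    incToδ̄ₙ-++ []      v g = sym (+-identityˡ _)
    incToδ̄ₙ-++ (_ ∷ u) v g = trans (+-congˡ (incToδ̄ₙ-++ u v g)) (sym (+-assoc _ _ _))

    incToδ̄ₙ-* : ∀ s u → cfUT._≈ᴹ_ n (incToδ̄ₙ n (IGₙ._*ₗ_ n s u)) (cfUT._*ₗ_ n s (incToδ̄ₙ n u))
    incToδ̄ₙ-* s []             g = sym (zeroʳ s)
    incToδ̄ₙ-* s ((s′ , π) ∷ u) g = trans (+-cong (*-assoc s s′ _) (incToδ̄ₙ-* s u g)) (sym (distribˡ s _ _))

    mass-zeta : ∀ π u → mass (λ ρ → does (π ⊑? ρ)) u ≈ ⟦ incToδ̄ₙ n u ⟧ (zeta π)
    mass-zeta π u = trans
      (mass-≗ (λ ρ → ≡.sym (does-⇔ (InUT-zeta π ρ) (InUT? ρ (zeta π)) (π ⊑? ρ))) u)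
      (sym (incToδ̄ₙ-mass u (zeta π)))

    incToδ̄ₙ-injective : ∀ u v → cfUT._≈ᴹ_ n (incToδ̄ₙ n u) (incToδ̄ₙ n v) → IGₙ._≈ᴹ_ n u v
    incToδ̄ₙ-injective u v p = upset-masses-determine commutativeRing n u v λ π →
      trans (mass-zeta π u) (trans (p (zeta π)) (sym (mass-zeta π v)))

  incToδ̄-component : ∀ j n u → cfUT._≈ᴹ_ j (component cfUT j (n , incToδ̄ₙ n u)) (incToδ̄ₙ j (component IGₙ j (n , u)))
  incToδ̄-component j n u with n ℕ.≟ j
  ... | yes ≡.refl = λ _ → refl
  ... | no _       = λ _ → refl

  incToδ̄-degreePart : ∀ j x → cfUT._≈ᴹ_ j (degreePart cfUT j (incToδ̄ x)) (incToδ̄ₙ j (degreePart IGₙ j x))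
  incToδ̄-degreePart j []            g = refl
  incToδ̄-degreePart j ((n , u) ∷ x) g = trans
    (+-cong (incToδ̄-component j n u g) (incToδ̄-degreePart j x g))
    (sym (incToδ̄ₙ-++ (component IGₙ j (n , u)) (degreePart IGₙ j x) g))

  incToδ̄-cong : ∀ {x y} → x IG.≈ᴹ y → incToδ̄ x CF.≈ᴹ incToδ̄ y
  incToδ̄-cong {x} {y} x≈y j g = trans (incToδ̄-degreePart j x g)
    (trans (incToδ̄ₙ-cong (degreePart IGₙ j x) (degreePart IGₙ j y) (x≈y j) g) (sym (incToδ̄-degreePart j y g)))

  incToδ̄-injective : ∀ {x y} → incToδ̄ x CF.≈ᴹ incToδ̄ y → x IG.≈ᴹ y
  incToδ̄-injective {x} {y} p j = incToδ̄ₙ-injective (degreePart IGₙ j x) (degreePart IGₙ j y) λ g →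
    trans (sym (incToδ̄-degreePart j x g)) (trans (p j g) (incToδ̄-degreePart j y g))

  incToδ̄-* : ∀ s x → incToδ̄ (s IG.*ₗ x) CF.≈ᴹ (s CF.*ₗ incToδ̄ x)
  incToδ̄-* s []            = CF.≈ᴹ-refl {[]}
  incToδ̄-* s ((n , u) ∷ x) = ⨁cf.∷-cong n
    {incToδ̄ₙ n (IGₙ._*ₗ_ n s u)} {cfUT._*ₗ_ n s (incToδ̄ₙ n u)} {incToδ̄ (s IG.*ₗ x)} {s CF.*ₗ incToδ̄ x} (incToδ̄ₙ-* s u) (incToδ̄-* s x)

  incToδ̄-isLeftModuleHomomorphism : LeftModuleMorphisms.IsLeftModuleHomomorphism IG.rawLeftModule CF.rawLeftModule incToδ̄
  incToδ̄-isLeftModuleHomomorphism = linear⇒isLeftModuleHomomorphism commutativeRing IG-space cfUT-space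
    (λ {x} {y} → incToδ̄-cong {x} {y})
    (λ x y → CF.≈ᴹ-reflexive (map-++ (λ (n , u) → n , incToδ̄ₙ n u) x y))
    incToδ̄-*

  -- Compatibility with product, unit and counit

  module _ {n m : ℕ} (g : PatternMatrix (fullPattern (n ℕ.+ m))) where

    open Parabolic (prefixSplit n m)

    parabolicPart : PatternMatrix parabolic
    parabolicPart = include (full⊆prefix {n} {m}) g

    gˡ : PatternMatrix (fullPattern n)
    gˡ = proj₁ (blocks (leviPart parabolicPart))

    gʳ : PatternMatrix (fullPattern m)
    gʳ = proj₂ (blocks (leviPart parabolicPart))

    δ̄-⋆ : ∀ π ρ → ⟦ δ̄ (π ⋆ ρ) ⟧ g ≈ ⟦ δ̄ π ⟧ gˡ * ⟦ δ̄ ρ ⟧ gʳ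
    δ̄-⋆ π ρ = trans
      (reflexive (≡.cong indicate (does-⇔ (InUT-⋆ π ρ g parabolicPart (λ _ _ → F.refl))
        (InUT? (π ⋆ ρ) g) (InUT? π gˡ ×-dec InUT? ρ gʳ))))
      (indicate-∧ (does (InUT? π gˡ)) (does (InUT? ρ gʳ)))

    incToδ̄ₙ-product : ∀ u v → ⟦ incToδ̄ₙ (n ℕ.+ m) (IG-product u v) ⟧ g ≈ ⟦ incToδ̄ₙ n u ⟧ gˡ * ⟦ incToδ̄ₙ m v ⟧ gʳ
    incToδ̄ₙ-product []            v = sym (zeroˡ _)
    incToδ̄ₙ-product ((s , π) ∷ u) v = trans (incToδ̄ₙ-++ (map _ v) (IG-product u v) g)
      (trans (+-cong (row v) (incToδ̄ₙ-product u v)) (sym (distribʳ _ _ _)))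
      where
      row : ∀ v → ⟦ incToδ̄ₙ (n ℕ.+ m) (map (λ (s′ , ρ) → s * s′ , π ⋆ ρ) v) ⟧ g ≈ s * ⟦ δ̄ π ⟧ gˡ * ⟦ incToδ̄ₙ m v ⟧ gʳ
      row []             = sym (zeroʳ _)
      row ((s′ , ρ) ∷ v) = trans
        (+-cong (trans (*-congˡ (δ̄-⋆ π ρ)) (interchange s s′ _ _)) (row v))
        (sym (distribˡ _ _ _))

  incToδ̄-++-cong : ∀ x y x′ y′ → incToδ̄ x CF.≈ᴹ x′ → incToδ̄ y CF.≈ᴹ y′ → incToδ̄ (x ++ y) CF.≈ᴹ (x′ ++ y′)
  incToδ̄-++-cong x y x′ y′ p q rewrite map-++ (λ (n , u) → n , incToδ̄ₙ n u) x y =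
    CF.+ᴹ-cong {incToδ̄ x} {x′} {incToδ̄ y} {y′} p q

  incToδ̄-multiplication : ∀ t → incToδ̄ (IG.multiplication t) CF.≈ᴹ CF.multiplication (map (Product.map incToδ̄ incToδ̄) t)
  incToδ̄-multiplication []            = CF.≈ᴹ-refl {[]}
  incToδ̄-multiplication ((x , y) ∷ t) = incToδ̄-++-cong
    (cartesianProductWith mul x y) (IG.multiplication t)
    (cartesianProductWith mul′ (incToδ̄ x) (incToδ̄ y)) (CF.multiplication (map (Product.map incToδ̄ incToδ̄) t))
    (outer x) (incToδ̄-multiplication t)
    where
    mul : Homogeneous IGₙ → Homogeneous IGₙ → Homogeneous IGₙ
    mul (n , u) (m , v) = n ℕ.+ m , IG-product u v
    mul′ : Homogeneous cfUT → Homogeneous cfUT → Homogeneous cfUT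
    mul′ (a , ψ) (b , χ) = a ℕ.+ b , product List.[ ψ , χ ]
    inner : ∀ n u y → incToδ̄ (map (mul (n , u)) y) CF.≈ᴹ map (mul′ (n , incToδ̄ₙ n u)) (incToδ̄ y)
    inner n u []            = CF.≈ᴹ-refl {[]}
    inner n u ((m , v) ∷ y) = ⨁cf.∷-cong (n ℕ.+ m) {incToδ̄ₙ (n ℕ.+ m) (IG-product u v)} {product List.[ incToδ̄ₙ n u , incToδ̄ₙ m v ]}
      {incToδ̄ (map (mul (n , u)) y)} {map (mul′ (n , incToδ̄ₙ n u)) (incToδ̄ y)}
      -- `join` folds a one-element list here, so the value of `product` carries a trailing `+ 0#`.
      (λ g → trans (incToδ̄ₙ-product g u v) (sym (+-identityʳ _))) (inner n u y)
    outer : ∀ x → incToδ̄ (cartesianProductWith mul x y) CF.≈ᴹ cartesianProductWith mul′ (incToδ̄ x) (incToδ̄ y)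
    outer []            = CF.≈ᴹ-refl {[]}
    outer ((n , u) ∷ x) = incToδ̄-++-cong
      (map (mul (n , u)) y) (cartesianProductWith mul x y)
      (map (mul′ (n , incToδ̄ₙ n u)) (incToδ̄ y)) (cartesianProductWith mul′ (incToδ̄ x) (incToδ̄ y))
      (inner n u y) (outer x)

  incToδ̄-unit : ∀ s → incToδ̄ (IG.unit s) CF.≈ᴹ CF.unit s
  -- With no indices to test, membership computes to `true`, so `δ̄ empty` has value `1#`; the fold
  -- adds a final `0#`.
  incToδ̄-unit s = ⨁cf.∷-cong 0 {incToδ̄ₙ 0 List.[ s , empty ]} {record { ⟦_⟧ = λ _ → s ; cong = λ _ → refl ; conjugate = λ _ _ → refl }} {[]} {[]} (λ g → trans (+-identityʳ _) (*-identityʳ s)) (CF.≈ᴹ-refl {[]})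

  incToδ̄-counit : ∀ x → CF.counit (incToδ̄ x) ≈ IG.counit x
  incToδ̄-counit x = trans (incToδ̄-degreePart 0 x (Group.ε (UT 0))) (total (degreePart IGₙ 0 x))
    where
    total : ∀ u → ⟦ incToδ̄ₙ 0 u ⟧ (Group.ε (UT 0)) ≈ foldr (λ (s , _) c → s + c) 0# u
    total []            = refl
    total ((s , π) ∷ u) = +-cong (*-identityʳ s) (total u)

  -- Compatibility with the coproduct

  module _ {n a b : ℕ} (I : Split n a b) where

    open Parabolic I
    open RadicalAverages F K I
    private
      module UR = Group UR
      module UP = Group UP
      UT×UT = DirectProduct.group (UT a) (UT b)
      mean = average UR-finite UR.ε

    point : Group.Carrier UT×UT → UR.Carrier → PatternMatrix (fullPattern n)
    point y x = toUT I (fromLevi I (glue y) UP.∙ fromRadical I x)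

    -- As `st` is `split` after pullback along `glue`, this is a component of the coproduct just
    -- before splitting: a function of two matrices, whose values can be compared.
    cut : ClassFunction (UT n) → ClassFunction UT×UT
    cut ψ = pullback glue-isHomomorphism (Def I (Res I ψ))

    average-vanishing-ascents : ∀ π → mean (vanishing (ascents I π)) ≈ q⁻¹ ^ asc I π
    average-vanishing-ascents π = average-vanishing (ascents I π) (Unique-ascents I π)
      (All.map (λ (i∈ , j∉ , i<j , _) → i<j , i∈ , j∉) (All-ascents I π))

    δ̄-point : ∀ π g h x → ⟦ δ̄ π ⟧ (point (g , h) x) ≈
      (⟦ δ̄ (restrictˡ I π) ⟧ g * ⟦ δ̄ (restrictʳ I π) ⟧ h) * vanishing (ascents I π) x
    δ̄-point π g h x = trans
      (reflexive (≡.cong indicate (does-⇔ equivalence (InUT? π (point (g , h) x))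
        ((InUT? (restrictˡ I π) g ×-dec InUT? (restrictʳ I π) h) ×-dec vanishes? (ascents I π) x))))
      (trans (indicate-∧ (does (InUT? (restrictˡ I π) g) ∧ does (InUT? (restrictʳ I π) h)) (does (vanishes? (ascents I π) x)))
        (*-congʳ (indicate-∧ (does (InUT? (restrictˡ I π) g)) (does (InUT? (restrictʳ I π) h)))))
      where
      module E = Equivalence (InUT-levi-radical I π g h x)
      module E′ = Equivalence (InUT-radical I π x)
      equivalence : InUT π (point (g , h) x) ⇔ ((InUT (restrictˡ I π) g × InUT (restrictʳ I π) h) × Vanishes (ascents I π) x)
      equivalence = mk⇔ (λ p → Product.map₂ E′.to (E.to p)) (λ (p , q) → E.from (p , E′.from q))

    -- The conditions on `g` and `h` do not involve `x` and leave the average; what remains is the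
    -- mean of the vanishing at the ascents.
    cut-δ̄ : ∀ π g h → ⟦ cut (δ̄ π) ⟧ (g , h) ≈ q⁻¹ ^ asc I π * ⟦ δ̄ (restrictˡ I π) ⟧ g * ⟦ δ̄ (restrictʳ I π) ⟧ h
    cut-δ̄ π g h = begin
      mean (λ x → ⟦ δ̄ π ⟧ (point (g , h) x))            ≈⟨ average-cong UR-finite UR.ε (δ̄-point π g h) ⟩
      mean (λ x → u * vanishing (ascents I π) x)       ≈⟨ average-* UR-finite UR.ε u (vanishing (ascents I π)) ⟩
      u * mean (vanishing (ascents I π))               ≈⟨ *-congˡ (average-vanishing-ascents π) ⟩
      u * q⁻¹ ^ asc I π                                  ≈⟨ *-comm u _ ⟩
      q⁻¹ ^ asc I π * u                                  ≈⟨ *-assoc _ _ _ ⟨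
      q⁻¹ ^ asc I π * ⟦ δ̄ (restrictˡ I π) ⟧ g * ⟦ δ̄ (restrictʳ I π) ⟧ h ∎
      where
      open SetoidReasoning setoid
      u : Carrier
      u = ⟦ δ̄ (restrictˡ I π) ⟧ g * ⟦ δ̄ (restrictʳ I π) ⟧ h

    factors : Carrier × NaturalUnitIntervalOrder n → ClassFunction (UT a) × ClassFunction (UT b)
    factors (s , π) = cfUT._*ₗ_ a s (cfUT._*ₗ_ a (q⁻¹ ^ asc I π) (δ̄ (restrictˡ I π))) , δ̄ (restrictʳ I π)

    cut-incToδ̄ₙ : ∀ u y → ⟦ cut (incToδ̄ₙ n u) ⟧ y ≈ ⟦ join (UT a) (UT b) (map factors u) ⟧ y
    cut-incToδ̄ₙ []            y       = average-constant UR-finite UR.ε 0#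
    cut-incToδ̄ₙ ((s , π) ∷ u) (g , h) = trans
      (average-+ UR-finite UR.ε (λ x → s * ⟦ δ̄ π ⟧ (point (g , h) x)) (λ x → ⟦ incToδ̄ₙ n u ⟧ (point (g , h) x)))
      (+-cong
        (trans (average-* UR-finite UR.ε s (λ x → ⟦ δ̄ π ⟧ (point (g , h) x)))
          (trans (*-congˡ (cut-δ̄ π g h)) (sym (*-assoc s _ _))))
        (cut-incToδ̄ₙ u (g , h)))

    -- `split` respects pointwise equality and undoes `join`, so the equality of values in
    -- `cut-incToδ̄ₙ` becomes one of tensors.
    st-incToδ̄ₙ : ∀ u → LeftModule._≈ᴹ_ (cfUT a ⊗ cfUT b) (st I (Def I (Res I (incToδ̄ₙ n u)))) (map factors u)
    st-incToδ̄ₙ u = ⊗-trans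
      (split-cong (UT a) (UT b) (UT-finite a) (UT-finite b) (cut (incToδ̄ₙ n u)) (join (UT a) (UT b) (map factors u)) (cut-incToδ̄ₙ u))
      (split-join (UT a) (UT b) (UT-finite a) (UT-finite b) (map factors u))

  infix 4 _≈⊗_
  _≈⊗_ : LeftModule.Carrierᴹ (cfUT-space ⊗ cfUT-space) → LeftModule.Carrierᴹ (cfUT-space ⊗ cfUT-space) → Set (k ⊔ κ₁ ⊔ c ⊔ ℓ₁)
  _≈⊗_ = LeftModule._≈ᴹ_ (cfUT-space ⊗ cfUT-space)

  module _ {n : ℕ} where

    homogeneousPair : (I : Subset n) → ClassFunction (UT ∣ I ∣) × ClassFunction (UT ∣ ∁ I ∣) → CF.Carrierᴹ × CF.Carrierᴹ
    homogeneousPair I = Product.map (homogeneous cfUT ∣ I ∣) (homogeneous cfUT ∣ ∁ I ∣)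

    summand : Subset n → Carrier × NaturalUnitIntervalOrder n → CF.Carrierᴹ × CF.Carrierᴹ
    summand I y = homogeneousPair I (factors (subsetSplit I) y)

    coproduct-summands : ∀ u → coproduct (incToδ̄ₙ n u) ≈⊗ concatMap (λ I → map (summand I) u) (subsets n)
    coproduct-summands u = ⊗-concatMap-cong commutativeRing (λ I → let S = subsetSplit I in ⊗-trans
      (⊗-map-cong commutativeRing {M = cfUT ∣ I ∣} {N = cfUT ∣ ∁ I ∣}
        (⨁cf.homogeneous-isLeftModuleHomomorphism ∣ I ∣) (⨁cf.homogeneous-isLeftModuleHomomorphism ∣ ∁ I ∣) (st-incToδ̄ₙ S u))
      (≡.subst (TensorEq cfUT-space cfUT-space _) (≡.sym (map-∘ u)) ⊗-refl)) (subsets n)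

    incToδ̄-pair : Carrier → IG.Carrierᴹ × IG.Carrierᴹ → CF.Carrierᴹ × CF.Carrierᴹ
    incToδ̄-pair s = Product.map incToδ̄ incToδ̄ ∘ scaleˡ IG-space IG-space s

    basisTerm : NaturalUnitIntervalOrder n → Subset n → IG.Carrierᴹ × IG.Carrierᴹ
    basisTerm π I = let S = subsetSplit I in
        LeftModule._*ₗ_ IG-space (q⁻¹ ^ asc S π) (homogeneous IGₙ ∣ I ∣ (inc (restrictˡ S π)))
      , homogeneous IGₙ ∣ ∁ I ∣ (inc (restrictʳ S π))

    summand-basisTerm : ∀ s π I → List.[ summand I (s , π) ] ≈⊗ List.[ incToδ̄-pair s (basisTerm π I) ]
    summand-basisTerm s π I = ⊗-pair
      (⨁cf.∷-cong ∣ I ∣ {x = proj₁ (factors S (s , π))} {incToδ̄ₙ ∣ I ∣ List.[ s * (q⁻¹ ^ asc S π * 1#) , restrictˡ S π ]} {[]} {[]}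
        -- The factor `1#` is the coefficient in `inc`, and the `0#` ends the fold in `incToδ̄ₙ`.
        (λ g → trans (sym (*-assoc s _ _)) (trans (*-congʳ (*-congˡ (sym (*-identityʳ _)))) (sym (+-identityʳ _)))) (CF.≈ᴹ-refl {[]}))
      (⨁cf.∷-cong ∣ ∁ I ∣ {x = δ̄ (restrictʳ S π)} {incToδ̄ₙ ∣ ∁ I ∣ List.[ 1# , restrictʳ S π ]} {[]} {[]}
        (λ g → sym (trans (+-identityʳ _) (*-identityˡ _))) (CF.≈ᴹ-refl {[]}))
      where S = subsetSplit I

    summands-basisCoproduct : ∀ s π Is → map (λ I → summand I (s , π)) Is ≈⊗
      map (Product.map incToδ̄ incToδ̄) (map (scaleˡ IG-space IG-space s) (map (basisTerm π) Is))
    summands-basisCoproduct s π []       = ⊗-refl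
    summands-basisCoproduct s π (I ∷ Is) = ⊗-cong (summand-basisTerm s π I) (summands-basisCoproduct s π Is)

    -- For class functions the sum over subsets is outermost, for graphs the sum over the terms of
    -- `u`; `exchange` swaps the two by recursion on `u`.
    coproduct-incToδ̄ₙ : ∀ u → coproduct (incToδ̄ₙ n u) ≈⊗ map (Product.map incToδ̄ incToδ̄) (IG-coproduct u)
    coproduct-incToδ̄ₙ u = ⊗-trans (coproduct-summands u) (exchange u)
      where
      Is = subsets n
      none : ∀ (Is : List (Subset n)) → concatMap (λ I → map (summand I) []) Is ≈⊗ []
      none []       = ⊗-refl
      none (_ ∷ Is) = none Is
      exchange : ∀ u → concatMap (λ I → map (summand I) u) Is ≈⊗ map (Product.map incToδ̄ incToδ̄) (IG-coproduct u)
      exchange []            = none Is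
      exchange ((s , π) ∷ u) = ⊗-trans
        (⊗-concatMap-∷ commutativeRing (λ I → summand I (s , π)) (λ I → map (summand I) u) Is)
        (≡.subst (TensorEq cfUT-space cfUT-space _) (≡.sym (map-++ (Product.map incToδ̄ incToδ̄)
            (map (scaleˡ IG-space IG-space s) (map (basisTerm π) Is)) (IG-coproduct u)))
          (⊗-cong (summands-basisCoproduct s π Is) (exchange u)))

  incToδ̄-comultiplication : ∀ x → CF.comultiplication (incToδ̄ x) ≈⊗ map (Product.map incToδ̄ incToδ̄) (IG.comultiplication x)
  incToδ̄-comultiplication []            = ⊗-refl
  incToδ̄-comultiplication ((n , u) ∷ x) =
    ≡.subst (TensorEq cfUT-space cfUT-space _) (≡.sym (map-++ (Product.map incToδ̄ incToδ̄) (IG-coproduct u) (IG.comultiplication x)))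
      (⊗-cong (coproduct-incToδ̄ₙ u) (incToδ̄-comultiplication x))

theorem7p5 : ∀ {c ℓ₁ ℓ₂ k κ₁ κ₂}
    (F : FiniteField c ℓ₁ ℓ₂) (K : CharacteristicZeroField k κ₁ κ₂) →
    LinearAlgebra.IsInjectiveHopfAlgebraHomomorphism (CharacteristicZeroField.commutativeRing K)
    (IncomparabilityGraphs.IG (CharacteristicZeroField.commutativeRing K) (UnipotentClassFunctions.q⁻¹ F K))
    (UnipotentClassFunctions.cfUT-Hopf F K)
    (UnipotentClassFunctions.incToδ̄ F K)
theorem7p5 F K = record
  { isHopfAlgebraHomomorphism = record
    { isLeftModuleHomomorphism = incToδ̄-isLeftModuleHomomorphism
    ; multiplication-homo = incToδ̄-multiplication
    ; unit-homo = incToδ̄-unit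
    ; comultiplication-homo = incToδ̄-comultiplication
    ; counit-homo = incToδ̄-counit
    }
  ; injective = λ {x} {y} → incToδ̄-injective {x} {y}
  }
  where open Morphism F K
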